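{- Let $\Gamma=(X,\mathcal E)$ be the 3-cube (the distance-regular graph with $8$ vertices and intersection array $\{3,2,1;1,2,3\}$); the spectrum of its adjacency matrix $A$ is $3^11^3(-1)^3(-3)^1$. Let $x\in X$, $T=T(x)$, and fix any ordering of the three vertices of $\Gamma_1(x)$. Then the standard module $V=\mathbb C^X$ is an orthogonal direct sum of irreducible $T$-modules $V=W_0\oplus W_{1,a}\oplus W_{1,b}$, where two summands are isomorphic if and only if they have the same type in the following list, and the data are as listed. Each listed basis is a pure basis of the module. For each summand other than $W_0$, the seed vector $\nu$ spans $E_r^*W$ (so $\dim E_r^*W=1$), where $r$ is the endpoint of the summand $W$, and is given by its essential part. Type I ($W_0$): endpoint 0, multiplicity 1, dimension 4, diameter 3, shape $(1,1,1,1)$; basis $e_0^*,e_1^*,e_2^*,e_3^*$; matrix representing $A$: $\begin{pmatrix}0&3&0&0\\1&0&2&0\\0&2&0&1\\0&0&3&0\end{pmatrix}$, with eigenvalues $3,1,-1,-3$. Type II ($W_{1,a},W_{1,b}$): endpoint 1, multiplicity 2, dimension 2, diameter 1, shape $(1,1)$; basis $\nu,A\nu$ (with $A\nu=E_2^*A\nu$), where $\nu=[1,-1,0]$ for $W_{1,a}$ and $\nu=[1,1,-2]$ for $W_{1,b}$; matrix representing $A$: $\begin{pmatrix}0&1\\1&0\end{pmatrix}$, with eigenvalues $1,-1$. Moreover $\dim T=4^2+2^2=20$.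
   Context: Let $\Gamma=(X,\mathcal E)$ be a finite undirected connected graph without loops or multiple edges, with path-length distance $d$ and diameter $D\ge1$; put $\Gamma_i(x)=\{y\in X:d(x,y)=i\}$. $\Gamma$ is distance-regular if for all $0\le h,i,j\le D$ the number $p^h_{i,j}=|\Gamma_i(y)\cap\Gamma_j(z)|$ is the same for all $y,z\in X$ with $d(y,z)=h$. Its intersection array is $\{b_0,\dots,b_{D-1};c_1,\dots,c_D\}$ with $b_i=p^i_{1,i+1}$, $c_i=p^i_{1,i-1}$. $A\in\mathrm{Mat}_X(\mathbb C)$ is the adjacency matrix; in its spectrum, exponents denote multiplicities. The standard module $V=\mathbb C^X$ (column vectors) carries the Hermitian inner product $\langle u,v\rangle=u^t\bar v$. Fix a base vertex $x\in X$. For $0\le i\le D$, $E_i^*=E_i^*(x)$ is the diagonal matrix with $(y,y)$-entry $1$ if $d(x,y)=i$ and $0$ otherwise, and $e_i^*\in V$ is the vector with $y$-entry $1$ if $d(x,y)=i$ and $0$ otherwise. The Terwilliger algebra $T=T(x)$ is the subalgebra of $\mathrm{Mat}_X(\mathbb C)$ generated by $A$ and $E_0^*,\dots,E_D^*$. A $T$-module is a subspace $W\subseteq V$ with $BW\subseteq W$ for all $B\in T$; it is irreducible if $W\ne0$ and it properly contains no nonzero $T$-module. Isomorphisms of $T$-modules are vector space isomorphisms commuting with every $B\in T$. The endpoint of $W$ is $r=\min\{i:E_i^*W\ne0\}$; the diameter of an irreducible $W$ is $\delta=|\{i:E_i^*W\ne0\}|-1$, and its shape is $(\dim E_r^*W,\dots,\dim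 E_{r+\delta}^*W)$. The multiplicity of an irreducible module is the number of summands isomorphic to it in an orthogonal decomposition of $V$ into irreducible $T$-modules. A nonzero vector is pure with support $i$ if it lies in $E_i^*V$; its essential part is the row vector of its coordinates at the vertices of $\Gamma_i(x)$ (all its other coordinates are $0$). A pure basis of an irreducible $T$-module is an ordered basis of pure vectors with weakly increasing supports. The matrix $B$ representing $A$ with respect to a basis $v_1,\dots,v_\ell$ is given by $Av_j=\sum_iB_{ij}v_i$. -}

module Defs where

open import Algebra.Bundles using (CommutativeRing)
import Algebra.Properties.Semiring.Sum as SemiringSum
open import Data.Bool.Base using (if_then_else_)
open import Data.Fin.Base as Fin using (Fin; toℕ)
import Data.Fin.Properties as Fin
open import Data.Fin.Subset using (Subset; ∣_∣; _∩_) renaming (_∈_ to _∈ˢ_)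
open import Data.Integer.Base using (ℤ)
open import Data.List.Base using (List)
import Data.List.Base as List
open import Data.List.Relation.Unary.All using (All)
open import Data.List.Relation.Unary.AllPairs using (AllPairs)
open import Data.List.Relation.Unary.Any using (Any)
open import Data.Nat.Base as ℕ using (ℕ; zero; suc; _≤_; _⊔_)
import Data.Nat.Properties as ℕ
open import Data.Product.Base using (Σ; ∃; _×_; _,_; proj₁; proj₂; curry)
open import Data.Rational.Base as ℚ using (ℚ; 0ℚ; 1ℚ; ½; Positive; NonZero; 1/_)
import Data.Rational.Properties as ℚ
open import Data.Rational.Solver using (module +-*-Solver)
open import Data.Vec.Base using (Vec; lookup; tabulate; []; _∷_)
open import Data.Vec.Functional using (foldr)
open import Function.Bundles using (_⇔_; _↔_; Inverse)
open import Level using (0ℓ)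
open import Relation.Binary.Core using (Rel)
open import Relation.Binary.Definitions using (Decidable; Symmetric)
open import Relation.Binary.PropositionalEquality
  using (_≡_; _≢_; refl; sym; trans; cong; subst; subst₂)
open import Relation.Binary.Structures using (IsEquivalence)
open import Relation.Nullary.Decidable using (Dec; yes; no; does; _×-dec_)
open import Relation.Nullary.Negation using (¬_)
open import Relation.Unary using (Pred; _∈_; _⊆_; U)

------------------------------------------------------------------------
-- Real numbers: Cauchy sequences of rationals, equal when their
-- difference tends to 0.

IsCauchy : (ℕ → ℚ) → Set
IsCauchy u = ∀ ε → 0ℚ ℚ.< ε →
  ∃ λ N → ∀ m n → N ≤ m → N ≤ n → ℚ.∣ u m ℚ.- u n ∣ ℚ.< ε

record ℝ : Set where
  no-eta-equality
  constructor mkℝ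
  field
    seq    : ℕ → ℚ
    cauchy : IsCauchy seq

open ℝ

infix 4 _≈ᴿ_

-- A record, so that both sides can be inferred from a proof.
record _≈ᴿ_ (x y : ℝ) : Set where
  constructor mk≈
  field
    close : ∀ ε → 0ℚ ℚ.< ε →
            ∃ λ N → ∀ n → N ≤ n → ℚ.∣ seq x n ℚ.- seq y n ∣ ℚ.< ε

open _≈ᴿ_

private
  open +-*-Solver using (_:+_; _:*_; _:-_; :-_; _:=_; con) renaming (solve to solveℚ)

  half : ℚ → ℚ
  half ε = ½ ℚ.* ε

  half>0 : ∀ {ε} → 0ℚ ℚ.< ε → 0ℚ ℚ.< half ε
  half>0 {ε} ε>0 = ℚ.*-monoʳ-<-pos ½ ε>0

  half+half : ∀ ε → half ε ℚ.+ half ε ≡ ε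
  half+half ε = trans (sym (ℚ.*-distribʳ-+ ε ½ ½)) (ℚ.*-identityˡ ε)

  add< : ∀ p q {ε} → ℚ.∣ p ∣ ℚ.< half ε → ℚ.∣ q ∣ ℚ.< half ε → ℚ.∣ p ℚ.+ q ∣ ℚ.< ε
  add< p q {ε} p< q< = ℚ.≤-<-trans (ℚ.∣p+q∣≤∣p∣+∣q∣ p q)
    (subst (_ ℚ.<_) (half+half ε) (ℚ.+-mono-< p< q<))

  -≡ : ∀ p q → ℚ.∣ p ℚ.- q ∣ ≡ ℚ.∣ q ℚ.- p ∣
  -≡ p q = trans (cong ℚ.∣_∣ (solveℚ 2 (λ p q → p :- q := :- (q :- p)) refl p q))
                 (ℚ.∣-p∣≡∣p∣ (q ℚ.- p))

  +-lemma : ∀ a b c d → (a ℚ.- c) ℚ.+ (b ℚ.- d) ≡ (a ℚ.+ b) ℚ.- (c ℚ.+ d)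
  +-lemma = solveℚ 4 (λ a b c d → (a :- c) :+ (b :- d) := (a :+ b) :- (c :+ d)) refl

  *-lemma : ∀ a b c d → a ℚ.* (b ℚ.- d) ℚ.+ (a ℚ.- c) ℚ.* d ≡ a ℚ.* b ℚ.- c ℚ.* d
  *-lemma = solveℚ 4 (λ a b c d → a :* (b :- d) :+ (a :- c) :* d := a :* b :- c :* d) refl

  tri-lemma : ∀ a b c → (a ℚ.- b) ℚ.+ (b ℚ.- c) ≡ a ℚ.- c
  tri-lemma = solveℚ 3 (λ a b c → (a :- b) :+ (b :- c) := a :- c) refl

  neg-lemma : ∀ a b → ℚ.∣ ℚ.- a ℚ.- ℚ.- b ∣ ≡ ℚ.∣ a ℚ.- b ∣
  neg-lemma a b = trans (cong ℚ.∣_∣ (solveℚ 2 (λ p q → :- p :- :- q := :- (p :- q)) refl a b))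
                        (ℚ.∣-p∣≡∣p∣ (a ℚ.- b))

  ⊔ˡ : ∀ {M N n} → M ⊔ N ≤ n → M ≤ n
  ⊔ˡ {M} {N} = ℕ.≤-trans (ℕ.m≤m⊔n M N)

  ⊔ʳ : ∀ {M N n} → M ⊔ N ≤ n → N ≤ n
  ⊔ʳ {M} {N} = ℕ.≤-trans (ℕ.m≤n⊔m M N)

  0<1 : 0ℚ ℚ.< 1ℚ
  0<1 = ℚ.positive⁻¹ 1ℚ

  mul< : ∀ p q {B δ} → .{{Positive B}} → ℚ.∣ p ∣ ℚ.< B → ℚ.∣ q ∣ ℚ.< δ →
         ℚ.∣ p ℚ.* q ∣ ℚ.< B ℚ.* δ
  mul< p q {B} {δ} p<B q<δ = begin-strict
    ℚ.∣ p ℚ.* q ∣         ≡⟨ ℚ.∣p*q∣≡∣p∣*∣q∣ p q ⟩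
    ℚ.∣ p ∣ ℚ.* ℚ.∣ q ∣   ≤⟨ ℚ.*-monoʳ-≤-nonNeg ℚ.∣ q ∣ {{ℚ.∣-∣-nonNeg q}} (ℚ.<⇒≤ p<B) ⟩
    B ℚ.* ℚ.∣ q ∣         <⟨ ℚ.*-monoʳ-<-pos B q<δ ⟩
    B ℚ.* δ               ∎
    where open ℚ.≤-Reasoning

  bounded : ∀ x → ∃ λ B → (0ℚ ℚ.< B) × ∃ λ N → ∀ n → N ≤ n → ℚ.∣ seq x n ∣ ℚ.< B
  bounded x with cauchy x 1ℚ 0<1
  ... | N , close-N = ℚ.∣ seq x N ∣ ℚ.+ 1ℚ , B>0 , N , bound
    where
    B>0 : 0ℚ ℚ.< ℚ.∣ seq x N ∣ ℚ.+ 1ℚ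
    B>0 = ℚ.+-mono-≤-< (ℚ.0≤∣p∣ (seq x N)) 0<1
    bound : ∀ n → N ≤ n → ℚ.∣ seq x n ∣ ℚ.< ℚ.∣ seq x N ∣ ℚ.+ 1ℚ
    bound n N≤n = begin-strict
      ℚ.∣ seq x n ∣
        ≡⟨ cong ℚ.∣_∣ (solveℚ 2 (λ a b → a := b :+ (a :- b)) refl (seq x n) (seq x N)) ⟩
      ℚ.∣ seq x N ℚ.+ (seq x n ℚ.- seq x N) ∣
        ≤⟨ ℚ.∣p+q∣≤∣p∣+∣q∣ (seq x N) (seq x n ℚ.- seq x N) ⟩
      ℚ.∣ seq x N ∣ ℚ.+ ℚ.∣ seq x n ℚ.- seq x N ∣
        <⟨ ℚ.+-monoʳ-< ℚ.∣ seq x N ∣ (close-N n N N≤n ℕ.≤-refl) ⟩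
      ℚ.∣ seq x N ∣ ℚ.+ 1ℚ ∎
      where open ℚ.≤-Reasoning

  -- δ = ε / 2B: if |a|, |d| < B and |a − c|, |b − d| < δ then |ab − cd| < ε.
  module Product (B : ℚ) (B>0 : 0ℚ ℚ.< B) (ε : ℚ) (ε>0 : 0ℚ ℚ.< ε) where
    instance
      posB : Positive B
      posB = ℚ.positive B>0
      nzB : NonZero B
      nzB = ℚ.pos⇒nonZero B

    δ : ℚ
    δ = (1/ B) ℚ.* half ε

    δ>0 : 0ℚ ℚ.< δ
    δ>0 = subst (ℚ._< δ) (ℚ.*-zeroʳ (1/ B))
      (ℚ.*-monoʳ-<-pos (1/ B) {{ℚ.1/pos⇒pos B}} (half>0 ε>0))

    Bδ : B ℚ.* δ ≡ half ε
    Bδ = trans (sym (ℚ.*-assoc B (1/ B) (half ε)))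
        (trans (cong (ℚ._* half ε) (ℚ.*-inverseʳ B)) (ℚ.*-identityˡ (half ε)))

    product< : ∀ a b c d → ℚ.∣ a ∣ ℚ.< B → ℚ.∣ d ∣ ℚ.< B →
               ℚ.∣ a ℚ.- c ∣ ℚ.< δ → ℚ.∣ b ℚ.- d ∣ ℚ.< δ →
               ℚ.∣ a ℚ.* b ℚ.- c ℚ.* d ∣ ℚ.< ε
    product< a b c d a<B d<B a-c b-d =
      subst (λ t → ℚ.∣ t ∣ ℚ.< ε) (*-lemma a b c d)
        (add< (a ℚ.* (b ℚ.- d)) ((a ℚ.- c) ℚ.* d)
          (subst (_ ℚ.<_) Bδ (mul< a (b ℚ.- d) a<B b-d))
          (subst₂ ℚ._<_ (cong ℚ.∣_∣ (ℚ.*-comm d (a ℚ.- c))) Bδ (mul< d (a ℚ.- c) d<B a-c)))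

  <-+ˡ : ∀ {p B} B′ → 0ℚ ℚ.< B′ → p ℚ.< B → p ℚ.< B ℚ.+ B′
  <-+ˡ {p} B′ B′>0 p<B = subst (ℚ._< _) (ℚ.+-identityʳ p) (ℚ.+-mono-< p<B B′>0)

  <-+ʳ : ∀ {p B} B′ → 0ℚ ℚ.< B′ → p ℚ.< B → p ℚ.< B′ ℚ.+ B
  <-+ʳ {p} B′ B′>0 p<B = subst (ℚ._< _) (ℚ.+-identityˡ p) (ℚ.+-mono-< B′>0 p<B)

  abstract
    const-cauchy : ∀ q → IsCauchy (λ _ → q)
    const-cauchy q ε ε>0 =
      0 , λ _ _ _ _ → subst (ℚ._< ε) (sym (cong ℚ.∣_∣ (ℚ.+-inverseʳ q))) ε>0

    +-cauchy : ∀ x y → IsCauchy (λ n → seq x n ℚ.+ seq y n)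
    +-cauchy x y ε ε>0 =
      let M , p = cauchy x (half ε) (half>0 ε>0)
          N , q = cauchy y (half ε) (half>0 ε>0)
      in M ⊔ N , λ m n m≥ n≥ →
         subst (λ t → ℚ.∣ t ∣ ℚ.< ε) (+-lemma (seq x m) (seq y m) (seq x n) (seq y n))
           (add< (seq x m ℚ.- seq x n) (seq y m ℚ.- seq y n)
             (p m n (⊔ˡ {M} {N} m≥) (⊔ˡ {M} {N} n≥)) (q m n (⊔ʳ {M} {N} m≥) (⊔ʳ {M} {N} n≥)))

    neg-cauchy : ∀ x → IsCauchy (λ n → ℚ.- seq x n)
    neg-cauchy x ε ε>0 =
      let N , p = cauchy x ε ε>0
      in N , λ m n m≥ n≥ → subst (ℚ._< ε) (sym (neg-lemma (seq x m) (seq x n))) (p m n m≥ n≥)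

    *-cauchy : ∀ x y → IsCauchy (λ n → seq x n ℚ.* seq y n)
    *-cauchy x y ε ε>0 =
      let B , B>0 , K , x<B = bounded x
          C , C>0 , L , y<C = bounded y
          B+C>0 = ℚ.+-mono-< B>0 C>0
          δ>0   = Product.δ>0 (B ℚ.+ C) B+C>0 ε ε>0
          M , p = cauchy x (Product.δ (B ℚ.+ C) B+C>0 ε ε>0) δ>0
          N , q = cauchy y (Product.δ (B ℚ.+ C) B+C>0 ε ε>0) δ>0
      in (K ⊔ L) ⊔ (M ⊔ N) , λ m n m≥ n≥ →
         Product.product< (B ℚ.+ C) B+C>0 ε ε>0 (seq x m) (seq y m) (seq x n) (seq y n)
           (<-+ˡ C C>0 (x<B m (⊔ˡ {K} {L} (⊔ˡ {K ⊔ L} {M ⊔ N} m≥))))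
           (<-+ʳ B B>0 (y<C n (⊔ʳ {K} {L} (⊔ˡ {K ⊔ L} {M ⊔ N} n≥))))
           (p m n (⊔ˡ {M} {N} (⊔ʳ {K ⊔ L} {M ⊔ N} m≥)) (⊔ˡ {M} {N} (⊔ʳ {K ⊔ L} {M ⊔ N} n≥)))
           (q m n (⊔ʳ {M} {N} (⊔ʳ {K ⊔ L} {M ⊔ N} m≥)) (⊔ʳ {M} {N} (⊔ʳ {K ⊔ L} {M ⊔ N} n≥)))

infixl 6 _+ᴿ_
infixl 7 _*ᴿ_
infix  8 -ᴿ_

fromℚ : ℚ → ℝ
fromℚ q = mkℝ (λ _ → q) (const-cauchy q)

_+ᴿ_ : ℝ → ℝ → ℝ
x +ᴿ y = mkℝ (λ n → seq x n ℚ.+ seq y n) (+-cauchy x y)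

-ᴿ_ : ℝ → ℝ
-ᴿ x = mkℝ (λ n → ℚ.- seq x n) (neg-cauchy x)

_*ᴿ_ : ℝ → ℝ → ℝ
x *ᴿ y = mkℝ (λ n → seq x n ℚ.* seq y n) (*-cauchy x y)

private
  pointwise : ∀ {x y} → (∀ n → seq x n ≡ seq y n) → x ≈ᴿ y
  pointwise {x} {y} eq = mk≈ λ ε ε>0 → 0 , λ n _ →
    subst (ℚ._< ε)
      (sym (cong ℚ.∣_∣ (trans (cong (ℚ._- seq y n) (eq n)) (ℚ.+-inverseʳ (seq y n))))) ε>0

  ≈ᴿ-isEquivalence : IsEquivalence _≈ᴿ_
  ≈ᴿ-isEquivalence = record
    { refl  = pointwise (λ _ → refl)
    ; sym   = λ {x} {y} x≈y → mk≈ λ ε ε>0 → let N , p = close x≈y ε ε>0 in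
        N , λ n n≥ → subst (ℚ._< ε) (-≡ (seq x n) (seq y n)) (p n n≥)
    ; trans = λ {x} {y} {z} x≈y y≈z → mk≈ λ ε ε>0 →
        let M , p = close x≈y (half ε) (half>0 ε>0)
            N , q = close y≈z (half ε) (half>0 ε>0)
        in M ⊔ N , λ n n≥ →
           subst (λ t → ℚ.∣ t ∣ ℚ.< ε) (tri-lemma (seq x n) (seq y n) (seq z n))
             (add< (seq x n ℚ.- seq y n) (seq y n ℚ.- seq z n)
               (p n (⊔ˡ {M} {N} n≥)) (q n (⊔ʳ {M} {N} n≥)))
    }

  +ᴿ-cong : ∀ {x x′ y y′} → x ≈ᴿ x′ → y ≈ᴿ y′ → x +ᴿ y ≈ᴿ x′ +ᴿ y′
  +ᴿ-cong {x} {x′} {y} {y′} x≈ y≈ = mk≈ λ ε ε>0 →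
    let M , p = close x≈ (half ε) (half>0 ε>0)
        N , q = close y≈ (half ε) (half>0 ε>0)
    in M ⊔ N , λ n n≥ →
       subst (λ t → ℚ.∣ t ∣ ℚ.< ε) (+-lemma (seq x n) (seq y n) (seq x′ n) (seq y′ n))
         (add< (seq x n ℚ.- seq x′ n) (seq y n ℚ.- seq y′ n)
           (p n (⊔ˡ {M} {N} n≥)) (q n (⊔ʳ {M} {N} n≥)))

  -ᴿ-cong : ∀ {x y} → x ≈ᴿ y → -ᴿ x ≈ᴿ -ᴿ y
  -ᴿ-cong {x} {y} x≈y = mk≈ λ ε ε>0 → let N , p = close x≈y ε ε>0 in
    N , λ n n≥ → subst (ℚ._< ε) (sym (neg-lemma (seq x n) (seq y n))) (p n n≥)

  *ᴿ-cong : ∀ {x x′ y y′} → x ≈ᴿ x′ → y ≈ᴿ y′ → x *ᴿ y ≈ᴿ x′ *ᴿ y′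
  *ᴿ-cong {x} {x′} {y} {y′} x≈ y≈ = mk≈ λ ε ε>0 →
    let B , B>0 , K , x<B = bounded x
        C , C>0 , L , y<C = bounded y′
        B+C>0 = ℚ.+-mono-< B>0 C>0
        δ>0   = Product.δ>0 (B ℚ.+ C) B+C>0 ε ε>0
        M , p = close x≈ (Product.δ (B ℚ.+ C) B+C>0 ε ε>0) δ>0
        N , q = close y≈ (Product.δ (B ℚ.+ C) B+C>0 ε ε>0) δ>0
    in (K ⊔ L) ⊔ (M ⊔ N) , λ n n≥ →
       Product.product< (B ℚ.+ C) B+C>0 ε ε>0 (seq x n) (seq y n) (seq x′ n) (seq y′ n)
         (<-+ˡ C C>0 (x<B n (⊔ˡ {K} {L} (⊔ˡ {K ⊔ L} {M ⊔ N} n≥))))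
         (<-+ʳ B B>0 (y<C n (⊔ʳ {K} {L} (⊔ˡ {K ⊔ L} {M ⊔ N} n≥))))
         (p n (⊔ˡ {M} {N} (⊔ʳ {K ⊔ L} {M ⊔ N} n≥)))
         (q n (⊔ʳ {M} {N} (⊔ʳ {K ⊔ L} {M ⊔ N} n≥)))

ℝ-commutativeRing : CommutativeRing 0ℓ 0ℓ
ℝ-commutativeRing = record
  { Carrier = ℝ ; _≈_ = _≈ᴿ_ ; _+_ = _+ᴿ_ ; _*_ = _*ᴿ_ ; -_ = -ᴿ_
  ; 0# = fromℚ 0ℚ ; 1# = fromℚ 1ℚ
  ; isCommutativeRing = record
    { isRing = record
      { +-isAbelianGroup = record
        { isGroup = record
          { isMonoid = record
            { isSemigroup = record
              { isMagma = record { isEquivalence = ≈ᴿ-isEquivalence ; ∙-cong = +ᴿ-cong }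
              ; assoc = λ x y z → pointwise λ n → ℚ.+-assoc (seq x n) (seq y n) (seq z n)
              }
            ; identity = (λ x → pointwise λ n → ℚ.+-identityˡ (seq x n))
                       , (λ x → pointwise λ n → ℚ.+-identityʳ (seq x n))
            }
          ; inverse = (λ x → pointwise λ n → ℚ.+-inverseˡ (seq x n))
                    , (λ x → pointwise λ n → ℚ.+-inverseʳ (seq x n))
          ; ⁻¹-cong = -ᴿ-cong
          }
        ; comm = λ x y → pointwise λ n → ℚ.+-comm (seq x n) (seq y n)
        }
      ; *-cong = *ᴿ-cong
      ; *-assoc = λ x y z → pointwise λ n → ℚ.*-assoc (seq x n) (seq y n) (seq z n)
      ; *-identity = (λ x → pointwise λ n → ℚ.*-identityˡ (seq x n))
                   , (λ x → pointwise λ n → ℚ.*-identityʳ (seq x n))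
      ; distrib = (λ x y z → pointwise λ n → ℚ.*-distribˡ-+ (seq x n) (seq y n) (seq z n))
                , (λ x y z → pointwise λ n → ℚ.*-distribʳ-+ (seq x n) (seq y n) (seq z n))
      }
    ; *-comm = λ x y → pointwise λ n → ℚ.*-comm (seq x n) (seq y n)
    }
  }

------------------------------------------------------------------------
-- Complex numbers: pairs (a , b) read as a + bi.

private
  assoc-re : ∀ a b c d e f →
    (a ℚ.* c ℚ.- b ℚ.* d) ℚ.* e ℚ.- (a ℚ.* d ℚ.+ b ℚ.* c) ℚ.* f ≡
    a ℚ.* (c ℚ.* e ℚ.- d ℚ.* f) ℚ.- b ℚ.* (c ℚ.* f ℚ.+ d ℚ.* e)
  assoc-re = solveℚ 6 (λ a b c d e f →
    (a :* c :- b :* d) :* e :- (a :* d :+ b :* c) :* f :=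
    a :* (c :* e :- d :* f) :- b :* (c :* f :+ d :* e)) refl

  assoc-im : ∀ a b c d e f →
    (a ℚ.* c ℚ.- b ℚ.* d) ℚ.* f ℚ.+ (a ℚ.* d ℚ.+ b ℚ.* c) ℚ.* e ≡
    a ℚ.* (c ℚ.* f ℚ.+ d ℚ.* e) ℚ.+ b ℚ.* (c ℚ.* e ℚ.- d ℚ.* f)
  assoc-im = solveℚ 6 (λ a b c d e f →
    (a :* c :- b :* d) :* f :+ (a :* d :+ b :* c) :* e :=
    a :* (c :* f :+ d :* e) :+ b :* (c :* e :- d :* f)) refl

  distˡ-re : ∀ a b c d e f →
    a ℚ.* (c ℚ.+ e) ℚ.- b ℚ.* (d ℚ.+ f) ≡
    (a ℚ.* c ℚ.- b ℚ.* d) ℚ.+ (a ℚ.* e ℚ.- b ℚ.* f)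
  distˡ-re = solveℚ 6 (λ a b c d e f →
    a :* (c :+ e) :- b :* (d :+ f) :=
    (a :* c :- b :* d) :+ (a :* e :- b :* f)) refl

  distˡ-im : ∀ a b c d e f →
    a ℚ.* (d ℚ.+ f) ℚ.+ b ℚ.* (c ℚ.+ e) ≡
    (a ℚ.* d ℚ.+ b ℚ.* c) ℚ.+ (a ℚ.* f ℚ.+ b ℚ.* e)
  distˡ-im = solveℚ 6 (λ a b c d e f →
    a :* (d :+ f) :+ b :* (c :+ e) :=
    (a :* d :+ b :* c) :+ (a :* f :+ b :* e)) refl

  distʳ-re : ∀ a b c d e f →
    (c ℚ.+ e) ℚ.* a ℚ.- (d ℚ.+ f) ℚ.* b ≡
    (c ℚ.* a ℚ.- d ℚ.* b) ℚ.+ (e ℚ.* a ℚ.- f ℚ.* b)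
  distʳ-re = solveℚ 6 (λ a b c d e f →
    (c :+ e) :* a :- (d :+ f) :* b :=
    (c :* a :- d :* b) :+ (e :* a :- f :* b)) refl

  distʳ-im : ∀ a b c d e f →
    (c ℚ.+ e) ℚ.* b ℚ.+ (d ℚ.+ f) ℚ.* a ≡
    (c ℚ.* b ℚ.+ d ℚ.* a) ℚ.+ (e ℚ.* b ℚ.+ f ℚ.* a)
  distʳ-im = solveℚ 6 (λ a b c d e f →
    (c :+ e) :* b :+ (d :+ f) :* a :=
    (c :* b :+ d :* a) :+ (e :* b :+ f :* a)) refl

  comm-re : ∀ a b c d →
    a ℚ.* c ℚ.- b ℚ.* d ≡
    c ℚ.* a ℚ.- d ℚ.* b
  comm-re = solveℚ 4 (λ a b c d →
    a :* c :- b :* d :=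
    c :* a :- d :* b) refl

  comm-im : ∀ a b c d →
    a ℚ.* d ℚ.+ b ℚ.* c ≡
    c ℚ.* b ℚ.+ d ℚ.* a
  comm-im = solveℚ 4 (λ a b c d →
    a :* d :+ b :* c :=
    c :* b :+ d :* a) refl

  1a-0b : ∀ a b →
    1ℚ ℚ.* a ℚ.- 0ℚ ℚ.* b ≡
    a
  1a-0b = solveℚ 2 (λ a b →
    con 1ℚ :* a :- con 0ℚ :* b :=
    a) refl

  1a+0b : ∀ a b →
    1ℚ ℚ.* a ℚ.+ 0ℚ ℚ.* b ≡
    a
  1a+0b = solveℚ 2 (λ a b →
    con 1ℚ :* a :+ con 0ℚ :* b :=
    a) refl

  a1-b0 : ∀ a b →
    a ℚ.* 1ℚ ℚ.- b ℚ.* 0ℚ ≡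
    a
  a1-b0 = solveℚ 2 (λ a b →
    a :* con 1ℚ :- b :* con 0ℚ :=
    a) refl

  a0+b1 : ∀ a b →
    a ℚ.* 0ℚ ℚ.+ b ℚ.* 1ℚ ≡
    b
  a0+b1 = solveℚ 2 (λ a b →
    a :* con 0ℚ :+ b :* con 1ℚ :=
    b) refl

open CommutativeRing ℝ-commutativeRing using ()
  renaming ( refl to reflᴿ; sym to symᴿ; trans to transᴿ
             ; +-assoc to +ᴿ-assoc; +-comm to +ᴿ-comm
             ; +-identityˡ to +ᴿ-identityˡ; +-identityʳ to +ᴿ-identityʳ
             ; -‿inverseˡ to -ᴿ-inverseˡ; -‿inverseʳ to -ᴿ-inverseʳ )

ℂ : Set
ℂ = ℝ × ℝ

ℂ-commutativeRing : CommutativeRing 0ℓ 0ℓ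
ℂ-commutativeRing = record
  { Carrier = ℂ
  ; _≈_ = λ (a , b) (c , d) → (a ≈ᴿ c) × (b ≈ᴿ d)
  ; _+_ = λ (a , b) (c , d) → a +ᴿ c , b +ᴿ d
  ; _*_ = λ (a , b) (c , d) → a *ᴿ c +ᴿ -ᴿ (b *ᴿ d) , a *ᴿ d +ᴿ b *ᴿ c
  ; -_  = λ (a , b) → -ᴿ a , -ᴿ b
  ; 0#  = fromℚ 0ℚ , fromℚ 0ℚ
  ; 1#  = fromℚ 1ℚ , fromℚ 0ℚ
  ; isCommutativeRing = record
    { isRing = record
      { +-isAbelianGroup = record
        { isGroup = record
          { isMonoid = record
            { isSemigroup = record
              { isMagma = record
                { isEquivalence = record
                  { refl  = reflᴿ , reflᴿ
                  ; sym   = λ (p , q) → symᴿ p , symᴿ q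
                  ; trans = λ (p , q) (r , s) → transᴿ p r , transᴿ q s
                  }
                ; ∙-cong = λ (p , q) (r , s) → +ᴿ-cong p r , +ᴿ-cong q s
                }
              ; assoc = λ (a , b) (c , d) (e , f) → +ᴿ-assoc a c e , +ᴿ-assoc b d f
              }
            ; identity = (λ (a , b) → +ᴿ-identityˡ a , +ᴿ-identityˡ b)
                       , (λ (a , b) → +ᴿ-identityʳ a , +ᴿ-identityʳ b)
            }
          ; inverse = (λ (a , b) → -ᴿ-inverseˡ a , -ᴿ-inverseˡ b)
                    , (λ (a , b) → -ᴿ-inverseʳ a , -ᴿ-inverseʳ b)
          ; ⁻¹-cong = λ (p , q) → -ᴿ-cong p , -ᴿ-cong q
          }
        ; comm = λ (a , b) (c , d) → +ᴿ-comm a c , +ᴿ-comm b d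
        }
      ; *-cong = λ (p , q) (r , s) →
          +ᴿ-cong (*ᴿ-cong p r) (-ᴿ-cong (*ᴿ-cong q s)) , +ᴿ-cong (*ᴿ-cong p s) (*ᴿ-cong q r)
      ; *-assoc = λ (a , b) (c , d) (e , f) →
          (pointwise λ n → assoc-re (seq a n) (seq b n) (seq c n) (seq d n) (seq e n) (seq f n)) ,
          (pointwise λ n → assoc-im (seq a n) (seq b n) (seq c n) (seq d n) (seq e n) (seq f n))
      ; *-identity =
          (λ (a , b) →
            (pointwise λ n → 1a-0b (seq a n) (seq b n)) ,
            (pointwise λ n → 1a+0b (seq b n) (seq a n)))
        , (λ (a , b) →
            (pointwise λ n → a1-b0 (seq a n) (seq b n)) ,
            (pointwise λ n → a0+b1 (seq a n) (seq b n)))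
      ; distrib =
          (λ (a , b) (c , d) (e , f) →
            (pointwise λ n → distˡ-re (seq a n) (seq b n) (seq c n) (seq d n) (seq e n) (seq f n)) ,
            (pointwise λ n → distˡ-im (seq a n) (seq b n) (seq c n) (seq d n) (seq e n) (seq f n)))
        , (λ (a , b) (c , d) (e , f) →
            (pointwise λ n → distʳ-re (seq a n) (seq b n) (seq c n) (seq d n) (seq e n) (seq f n)) ,
            (pointwise λ n → distʳ-im (seq a n) (seq b n) (seq c n) (seq d n) (seq e n) (seq f n)))
      }
    ; *-comm = λ (a , b) (c , d) →
        (pointwise λ n → comm-re (seq a n) (seq b n) (seq c n) (seq d n)) ,
        (pointwise λ n → comm-im (seq a n) (seq b n) (seq c n) (seq d n))
    }
  }

open CommutativeRing ℂ-commutativeRing public using ()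
  renaming ( _≈_ to _≈ᶜ_; _+_ to _+ᶜ_; _*_ to _*ᶜ_; -_ to -ᶜ_; 0# to 0ᶜ; 1# to 1ᶜ )
open SemiringSum (CommutativeRing.semiring ℂ-commutativeRing) public using (sum)

conj : ℂ → ℂ
conj (a , b) = a , -ᴿ b

fromℤ : ℤ → ℂ
fromℤ z = fromℚ (z ℚ./ 1) , fromℚ 0ℚ

------------------------------------------------------------------------

module _ {I : Set} where

  infix  4 _≋_
  infixl 6 _⊞_
  infixr 7 _·_

  _≋_ : (u v : I → ℂ) → Set
  u ≋ v = ∀ i → u i ≈ᶜ v i

  𝟎 : I → ℂ
  𝟎 i = 0ᶜ

  _⊞_ : (u v : I → ℂ) → I → ℂ
  (u ⊞ v) i = u i +ᶜ v i

  _·_ : ℂ → (I → ℂ) → I → ℂ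
  (a · v) i = a *ᶜ v i

  Σⱽ : ∀ {m} → (Fin m → I → ℂ) → I → ℂ
  Σⱽ vs i = sum (λ k → vs k i)

  combination : ∀ {m} → (Fin m → ℂ) → (Fin m → I → ℂ) → I → ℂ
  combination a vs = Σⱽ (λ k → a k · vs k)

  Nonzero : Pred (I → ℂ) 0ℓ → Set
  Nonzero P = ¬ (∀ v → v ∈ P → v ≋ 𝟎)

  record IsSubspace (P : Pred (I → ℂ) 0ℓ) : Set where
    field
      resp : ∀ {u v} → u ≋ v → u ∈ P → v ∈ P
      0∈   : 𝟎 ∈ P
      +∈   : ∀ {u v} → u ∈ P → v ∈ P → u ⊞ v ∈ P
      ·∈   : ∀ a {v} → v ∈ P → a · v ∈ P

  -- The remaining definitions are used for subspaces P only.

  Spans : ∀ {m} → Pred (I → ℂ) 0ℓ → (Fin m → I → ℂ) → Set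
  Spans P vs = (∀ k → vs k ∈ P) × (∀ v → v ∈ P → ∃ λ a → v ≋ combination a vs)

  LinearlyIndependent : ∀ {m} → (Fin m → I → ℂ) → Set
  LinearlyIndependent vs = ∀ a → combination a vs ≋ 𝟎 → ∀ k → a k ≈ᶜ 0ᶜ

  IsBasis : ∀ {m} → Pred (I → ℂ) 0ℓ → (Fin m → I → ℂ) → Set
  IsBasis P vs = Spans P vs × LinearlyIndependent vs

  HasDim : Pred (I → ℂ) 0ℓ → ℕ → Set
  HasDim P m = ∃ λ (vs : Fin m → I → ℂ) → IsBasis P vs

⟨_,_⟩ : ∀ {n} → (u v : Fin n → ℂ) → ℂ
⟨ u , v ⟩ = sum (λ i → u i *ᶜ conj (v i))

Mat : ℕ → Set
Mat n = Fin n → Fin n → ℂ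

module _ {n : ℕ} where

  infixl 6 _+ᴹ_
  infixl 7 _*ᴹ_
  infixr 7 _*ᵥ_
  infix  8 _⟨_⟩

  _+ᴹ_ _*ᴹ_ : Mat n → Mat n → Mat n
  (M +ᴹ N) i j = M i j +ᶜ N i j
  (M *ᴹ N) i j = sum (λ k → M i k *ᶜ N k j)

  1ᴹ : Mat n
  1ᴹ i j = if does (i Fin.≟ j) then 1ᶜ else 0ᶜ

  _*ᵥ_ : Mat n → (Fin n → ℂ) → Fin n → ℂ
  (M *ᵥ v) i = sum (λ j → M i j *ᶜ v j)

  _⟨_⟩ : Mat n → Pred (Fin n → ℂ) 0ℓ → Pred (Fin n → ℂ) 0ℓ
  (M ⟨ P ⟩) v = ∃ λ w → w ∈ P × v ≋ M *ᵥ w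

  Eigenspace : Mat n → ℂ → Pred (Fin n → ℂ) 0ℓ
  Eigenspace M θ v = M *ᵥ v ≋ θ · v

  HasEigenvalues : Mat n → List ℂ → Set
  HasEigenvalues M θs = ∀ θ → Nonzero (Eigenspace M θ) ⇔ Any (θ ≈ᶜ_) θs

  -- A list of pairs (eigenvalue , multiplicity), for a diagonalisable M.
  HasSpectrum : Mat n → List (ℂ × ℕ) → Set
  HasSpectrum M spec =
    AllPairs (λ θ η → ¬ (θ ≈ᶜ η)) (List.map proj₁ spec) ×
    HasEigenvalues M (List.map proj₁ spec) ×
    All (λ (θ , m) → HasDim (Eigenspace M θ) m) spec

fromRows : ∀ {n} → Vec (Vec ℤ n) n → Mat n
fromRows rows i j = fromℤ (lookup (lookup rows i) j)

------------------------------------------------------------------------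

module _ {n : ℕ} (_~_ : Rel (Fin n) 0ℓ) where

  Walk : ℕ → Rel (Fin n) 0ℓ
  Walk zero    y z = y ≡ z
  Walk (suc k) y z = ∃ λ w → y ~ w × Walk k w z

  walk? : Decidable _~_ → ∀ k → Decidable (Walk k)
  walk? _~?_ zero    y z = y Fin.≟ z
  walk? _~?_ (suc k) y z = Fin.any? (λ w → (y ~? w) ×-dec walk? _~?_ k w z)

record Graph (n : ℕ) : Set₁ where
  infix 4 _~_
  field
    _~_       : Rel (Fin n) 0ℓ
    _~?_      : Decidable _~_
    ~-sym     : Symmetric _~_
    ~-irrefl  : ∀ y → ¬ (y ~ y)
    connected : ∀ y z → ∃ λ k → Walk _~_ k y z

-- The least i ≤ k satisfying P if there is one, and k otherwise.
least : {P : ℕ → Set} → (∀ i → Dec (P i)) → ℕ → ℕ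
least P? zero    = zero
least P? (suc k) = if does (P? zero) then zero else suc (least (λ i → P? (suc i)) k)

maximum : ∀ {n} → (Fin n → ℕ) → ℕ
maximum = foldr _⊔_ 0

module _ {n : ℕ} (Γ : Graph n) where
  open Graph Γ

  -- The bound is the length of some walk from y to z.
  d : Fin n → Fin n → ℕ
  d y z = least (λ k → walk? _~_ _~?_ k y z) (proj₁ (connected y z))

  diameter : ℕ
  diameter = maximum (λ y → maximum (λ z → d y z))

  sphere : ℕ → Fin n → Subset n
  sphere i x = tabulate (λ y → does (d x y ℕ.≟ i))

  record DistanceRegular : Set where
    field
      p       : ℕ → ℕ → ℕ → ℕ   -- p h i j is the intersection number p^h_{i,j}
      regular : ∀ {h i j} → h ≤ diameter → i ≤ diameter → j ≤ diameter →
                ∀ y z → d y z ≡ h → ∣ sphere i y ∩ sphere j z ∣ ≡ p h i j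

  -- The vectors are (b_0,…,b_{D-1}) and (c_1,…,c_D).
  HasIntersectionArray : DistanceRegular → ∀ {D} → Vec ℕ D → Vec ℕ D → Set
  HasIntersectionArray dr {D} b c =
    diameter ≡ D ×
    (∀ (i : Fin D) → lookup b i ≡ p (toℕ i) 1 (suc (toℕ i))) ×
    (∀ (i : Fin D) → lookup c i ≡ p (suc (toℕ i)) 1 (toℕ i))
    where open DistanceRegular dr

  adjacency : Mat n
  adjacency y z = if does (y ~? z) then 1ᶜ else 0ᶜ

------------------------------------------------------------------------

module Terwilliger {n : ℕ} (Γ : Graph n) (x : Fin n) where

  D : ℕ
  D = diameter Γ

  A : Mat n
  A = adjacency Γ

  V : Set
  V = Fin n → ℂ

  e* : ℕ → V
  e* i y = if does (d Γ x y ℕ.≟ i) then 1ᶜ else 0ᶜ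

  E* : ℕ → Mat n
  E* i y z = if does (y Fin.≟ z) then e* i y else 0ᶜ

  data T : Pred (Mat n) 0ℓ where
    A∈   : A ∈ T
    E*∈  : ∀ {i} → i ≤ D → E* i ∈ T
    1∈   : 1ᴹ ∈ T
    +∈   : ∀ {M N} → M ∈ T → N ∈ T → M +ᴹ N ∈ T
    *∈   : ∀ {M N} → M ∈ T → N ∈ T → M *ᴹ N ∈ T
    ·∈   : ∀ a {M} → M ∈ T → (λ y → a · M y) ∈ T
    resp : ∀ {M N} → (∀ y → M y ≋ N y) → M ∈ T → N ∈ T

  -- T as a subspace of ℂ^(X×X), so that HasDim applies.
  T-space : Pred (Fin n × Fin n → ℂ) 0ℓ
  T-space M = curry M ∈ T

  record TModule : Set₁ where
    field
      Carrier    : Pred V 0ℓ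
      isSubspace : IsSubspace Carrier
      invariant  : ∀ {B} → B ∈ T → ∀ {v} → v ∈ Carrier → B *ᵥ v ∈ Carrier
    open IsSubspace isSubspace public

  open TModule using () renaming (Carrier to ∥_∥) public

  Irreducible : TModule → Set₁
  Irreducible W = Nonzero ∥ W ∥ ×
    ¬ (∃ λ (W′ : TModule) → ∥ W′ ∥ ⊆ ∥ W ∥ × ¬ (∥ W ∥ ⊆ ∥ W′ ∥) × Nonzero ∥ W′ ∥)

  record _≅_ (W W′ : TModule) : Set where
    private
      module W = TModule W
    field
      φ          : ∀ v → v ∈ ∥ W ∥ → V
      φ∈         : ∀ {v} (p : v ∈ ∥ W ∥) → φ v p ∈ ∥ W′ ∥
      φ-cong     : ∀ {u v} (p : u ∈ ∥ W ∥) (q : v ∈ ∥ W ∥) → u ≋ v → φ u p ≋ φ v q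
      φ-+        : ∀ {u v} (p : u ∈ ∥ W ∥) (q : v ∈ ∥ W ∥) →
                   φ (u ⊞ v) (W.+∈ p q) ≋ φ u p ⊞ φ v q
      φ-·        : ∀ a {v} (p : v ∈ ∥ W ∥) → φ (a · v) (W.·∈ a p) ≋ a · φ v p
      injective  : ∀ {u v} (p : u ∈ ∥ W ∥) (q : v ∈ ∥ W ∥) → φ u p ≋ φ v q → u ≋ v
      surjective : ∀ {w} → w ∈ ∥ W′ ∥ → ∃ λ v → Σ (v ∈ ∥ W ∥) λ p → φ v p ≋ w
      commutes   : ∀ {B} (B∈T : B ∈ T) {v} (p : v ∈ ∥ W ∥) →
                   φ (B *ᵥ v) (W.invariant B∈T p) ≋ B *ᵥ φ v p

  record OrthogonalDecomposition {m} (W : Fin m → TModule) : Set₁ where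
    field
      irreducible : ∀ j → Irreducible (W j)
      orthogonal  : ∀ {j k} → j ≢ k → ∀ {u v} → u ∈ ∥ W j ∥ → v ∈ ∥ W k ∥ → ⟨ u , v ⟩ ≈ᶜ 0ᶜ
      spanning    : ∀ v → ∃ λ (w : Fin m → V) → (∀ j → w j ∈ ∥ W j ∥) × v ≋ Σⱽ w
      direct      : ∀ (w : Fin m → V) → (∀ j → w j ∈ ∥ W j ∥) → Σⱽ w ≋ 𝟎 → ∀ j → w j ≋ 𝟎

  -- The number of summands W j isomorphic to U is k.
  HasMultiplicity : ∀ {m} → (Fin m → TModule) → TModule → ℕ → Set
  HasMultiplicity {m} W U k =
    ∃ λ (S : Subset m) → (∀ j → j ∈ˢ S ⇔ W j ≅ U) × ∣ S ∣ ≡ k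

  HasEndpoint : TModule → ℕ → Set
  HasEndpoint W r = r ≤ D × Nonzero (E* r ⟨ ∥ W ∥ ⟩) ×
    (∀ i → i ≤ D → Nonzero (E* i ⟨ ∥ W ∥ ⟩) → r ≤ i)

  HasDiameter : TModule → ℕ → Set
  HasDiameter W δ =
    ∃ λ (S : Subset (suc D)) → (∀ i → i ∈ˢ S ⇔ Nonzero (E* (toℕ i) ⟨ ∥ W ∥ ⟩)) × ∣ S ∣ ≡ suc δ

  -- r and δ are to be the endpoint and the diameter of W.
  HasShape : TModule → (r δ : ℕ) → Vec ℕ (suc δ) → Set
  HasShape W r δ s = ∀ k → HasDim (E* (r ℕ.+ toℕ k) ⟨ ∥ W ∥ ⟩) (lookup s k)

  Pure : V → ℕ → Set
  Pure v i = ¬ (v ≋ 𝟎) × v ∈ E* i ⟨ U ⟩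

  IsPureBasis : ∀ {m} → TModule → (Fin m → V) → Set
  IsPureBasis {m} W vs = IsBasis ∥ W ∥ vs ×
    ∃ λ (s : Fin m → ℕ) → (∀ k → Pure (vs k) (s k)) × (∀ {k l} → k Fin.≤ l → s k ≤ s l)

  Represents : ∀ {m} → Mat m → (Fin m → V) → Set
  Represents B vs = ∀ j → A *ᵥ vs j ≋ combination (λ i → B i j) vs

  -- The vector supported on Γ_i(x) with the given essential part, for an
  -- ordering of Γ_i(x).
  fromEssential : ∀ {m} i → Fin m ↔ (∃ λ y → d Γ x y ≡ i) → (Fin m → ℂ) → V
  fromEssential i ordering c y with d Γ x y ℕ.≟ i
  ... | yes p = c (Inverse.from ordering (y , p))
  ... | no  _ = 0ᶜ

data ModuleType : Set where
  typeI typeII : ModuleType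

{-# OPTIONS --safe #-}
module Submission where

-- From a base vertex x with neighbours y₀, y₁, y₂, the intersection numbers leave only the cube:
-- y_j and y_k have exactly one common neighbour z_i besides x, the z_i are distinct, and the eighth
-- vertex is adjacent to all of them.  In these coordinates the spectrum of A comes from the
-- characters of (ℤ/2)³.  A module spanned by one vector on each of several consecutive levels is
-- irreducible as soon as the matrix of A on that basis has invertible sub- and superdiagonal
-- entries, since the E*_i extract the basis vectors from any nonzero element; and two such modules
-- with the same first level and the same matrix are isomorphic, because every element of T acts on
-- both by the same matrix.  Finally T is the algebra of matrices invariant under the permutations
-- of the y_i, whose dimension is the number of orbits on pairs of vertices.
--
-- Invertibility of a nonzero complex number and the disjunction "θ is one of the eigenvalues" are
-- not available constructively.  Equality of Cauchy reals is stable under double negation, which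
-- makes the first harmless; the second is recovered by approximating θ, as the eigenvalues are
-- distinct integers.

open import Defs
open import Algebra.Bundles using (CommutativeRing)
import Algebra.Properties.CommutativeSemigroup as CommutativeSemigroupProperties
import Algebra.Properties.Group as GroupProperties
import Algebra.Properties.Ring as RingProperties
import Algebra.Properties.Semiring.Sum as SemiringSum
open import Data.Bool.Base using (Bool; true; false; if_then_else_)
open import Data.Fin using (#_)
open import Data.Fin.Base as Fin using (Fin; zero; suc; toℕ; _↑ˡ_; _↑ʳ_)
import Data.Fin.Induction as Fin
open import Data.Fin.Patterns using (0F; 1F; 2F; 3F; 4F; 5F; 6F; 7F)
import Data.Fin.Permutation as Perm
import Data.Fin.Properties as Fin
open import Data.Fin.Subset using (Subset; ∣_∣; _∩_; _-_; ⊤) renaming (_∈_ to _∈ˢ_; _∉_ to _∉ˢ_)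
import Data.Fin.Subset.Properties as Subset
open import Data.Integer.Base as ℤ using (ℤ; +_; -_; 0ℤ; 1ℤ; -1ℤ)
import Data.Integer.Properties as ℤ
open import Data.List.Base as List using (List) renaming ([] to []ˡ; _∷_ to _∷ˡ_)
import Data.List.Membership.DecPropositional as DecMembership
open import Data.List.Membership.Propositional using () renaming (_∈_ to _∈ˡ_)
open import Data.List.Relation.Unary.All as All using (All)
open import Data.List.Relation.Unary.AllPairs as AllPairs using (AllPairs)
import Data.List.Relation.Unary.AllPairs.Properties as AllPairs
open import Data.List.Relation.Unary.Any as Any using (Any; here; there)
import Data.List.Relation.Unary.Any.Properties as Any
open import Data.Nat.Base as ℕ using (ℕ; zero; suc; _≤_; z≤n; s≤s; _⊔_; _+_; _^_)
import Data.Nat.Coprimality as Coprimality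
import Data.Nat.Properties as ℕ
open import Data.Product.Base using (∃; _×_; _,_; proj₁; proj₂)
import Data.Product.Properties as Product
open import Data.Rational.Base as ℚ using (ℚ; 0ℚ; 1ℚ; ½; 1/_)
import Data.Rational.Properties as ℚ
open import Data.Rational.Solver using (module +-*-Solver)
open import Data.Sum.Base using (_⊎_; inj₁; inj₂; [_,_]′)
open import Data.Vec.Base as Vec using (Vec; []; _∷_; lookup; tabulate)
open import Data.Vec.Functional using () renaming ([] to []ᶠ; _∷_ to _∷ᶠ_)
open import Data.Vec.Membership.Propositional.Properties using (∈-allFin⁺)
import Data.Vec.Properties as Vec
import Data.Vec.Relation.Unary.All as VecAll
open import Function.Base using (_∘_)
open import Function.Bundles using (_⇔_; mk⇔; _↔_; Inverse; Equivalence)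
open import Function.Definitions using (Injective)
open import Level using (0ℓ)
open import Relation.Binary.Definitions using (tri<; tri≈; tri>)
open import Relation.Binary.PropositionalEquality
  using (_≡_; _≢_; refl; sym; trans; cong; cong₂; subst; subst₂)
import Relation.Binary.Reasoning.Setoid as SetoidReasoning
open import Relation.Nullary.Decidable
  using (Dec; yes; no; does; toSum; dec-true; dec-false; from-yes; True; toWitness;
         _→-dec_; _⊎-dec_; _×-dec_; ¬?)
open import Relation.Nullary.Negation using (¬_; contradiction)
open import Relation.Unary using (Pred; _∈_; _⊆_)
open +-*-Solver using (_:+_; _:*_; _:-_; :-_; _:=_; con) renaming (solve to solveℚ)
open SemiringSum ℤ.+-*-semiring using () renaming (sum to sumᶻ)
open ℝ using (seq; cauchy)

-- The obstacle is that equality in ℂ is undecidable, so no identity between complex vectors or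
-- matrices can be settled by evaluation. However, once the vertices carry cube labels, the
-- adjacency matrix, the seed vectors, the module bases and the orbit matrices all have integer
-- entries. Each concrete identity is therefore decided on a finite integer table indexed by labels
-- and carried to ℂ along `fromℤ` and `label`. Inverse base changes have rational entries; to stay
-- in ℤ, a basis is paired with a dual basis only up to a nonzero integer factor. The negative form
-- of `Nonzero` and `Irreducible` matters as well: what has to be derived in the end is that some
-- coefficient vanishes, a stable statement, so the inverse of a nonzero coefficient may be used
-- although it exists only up to double negation.

module ℝ-ring = CommutativeRing ℝ-commutativeRing
module ℂ = CommutativeRing ℂ-commutativeRing
module ≈ᶜ-Reasoning = SetoidReasoning ℂ.setoid

-- Cauchy reals: apartness from zero, reciprocals, comparison with rationals

pointwise : ∀ {x y} → (∀ n → seq x n ≡ seq y n) → x ≈ᴿ y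
pointwise {x} {y} eq = mk≈ λ ε ε>0 → 0 , λ n _ →
  subst (ℚ._< ε)
    (sym (cong ℚ.∣_∣ (trans (cong (ℚ._- seq y n) (eq n)) (ℚ.+-inverseʳ (seq y n))))) ε>0

<⇒≱ : ∀ {p q} → p ℚ.< q → ¬ (q ℚ.≤ p)
<⇒≱ p<q q≤p = ℚ.<-irrefl refl (ℚ.<-≤-trans p<q q≤p)

half : ℚ → ℚ
half ε = ½ ℚ.* ε

half>0 : ∀ {ε} → 0ℚ ℚ.< ε → 0ℚ ℚ.< half ε
half>0 = ℚ.*-monoʳ-<-pos ½

half+half : ∀ ε → half ε ℚ.+ half ε ≡ ε
half+half ε = trans (sym (ℚ.*-distribʳ-+ ε ½ ½)) (ℚ.*-identityˡ ε)

∣-∣-comm : ∀ p q → ℚ.∣ p ℚ.- q ∣ ≡ ℚ.∣ q ℚ.- p ∣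
∣-∣-comm p q = trans (cong ℚ.∣_∣ (solveℚ 2 (λ p q → p :- q := :- (q :- p)) refl p q))
                     (ℚ.∣-p∣≡∣p∣ (q ℚ.- p))

∣-∣-triangle : ∀ p q r → ℚ.∣ p ℚ.- r ∣ ℚ.≤ ℚ.∣ p ℚ.- q ∣ ℚ.+ ℚ.∣ q ℚ.- r ∣
∣-∣-triangle p q r = subst (λ t → ℚ.∣ t ∣ ℚ.≤ ℚ.∣ p ℚ.- q ∣ ℚ.+ ℚ.∣ q ℚ.- r ∣)
  (solveℚ 3 (λ p q r → (p :- q) :+ (q :- r) := p :- r) refl p q r)
  (ℚ.∣p+q∣≤∣p∣+∣q∣ (p ℚ.- q) (q ℚ.- r))

triangle-half : ∀ p q r {ε} → ℚ.∣ p ℚ.- q ∣ ℚ.< half ε → ℚ.∣ q ℚ.- r ∣ ℚ.< half ε →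
                ℚ.∣ p ℚ.- r ∣ ℚ.< ε
triangle-half p q r {ε} pq qr = ℚ.≤-<-trans (∣-∣-triangle p q r)
  (subst (_ ℚ.<_) (half+half ε) (ℚ.+-mono-< pq qr))

0<∣-∣ : ∀ {p q} → p ≢ q → 0ℚ ℚ.< ℚ.∣ p ℚ.- q ∣
0<∣-∣ {p} {q} p≢q with ℚ.<-cmp 0ℚ ℚ.∣ p ℚ.- q ∣
... | tri< 0< _ _ = 0<
... | tri≈ _ 0≡ _ = contradiction
  (GroupProperties.x∙y⁻¹≈ε⇒x≈y ℚ.+-0-group p q (ℚ.∣p∣≡0⇒p≡0 _ (sym 0≡))) p≢q
... | tri> _ _ <0 = contradiction (ℚ.0≤∣p∣ (p ℚ.- q)) (<⇒≱ <0)

-- Total, with default value 0 at 0, so that it can be applied termwise to a sequence some of whose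
-- early terms vanish.
recip : ℚ → ℚ
recip p with p ℚ.≟ 0ℚ
... | yes _   = 0ℚ
... | no  p≢0 = (1/ p) {{ℚ.≢-nonZero p≢0}}

recip-inverse : ∀ p → p ≢ 0ℚ → recip p ℚ.* p ≡ 1ℚ
recip-inverse p p≢0 with p ℚ.≟ 0ℚ
... | yes p≡0 = contradiction p≡0 p≢0
... | no  p≢0 = ℚ.*-inverseˡ p {{ℚ.≢-nonZero p≢0}}

-- The strong form of x ≉ 0: it carries the lower bound and the index that inversion needs.
Apart₀ : ℝ → Set
Apart₀ x = ∃ λ δ → 0ℚ ℚ.< δ × ∃ λ N → ∀ n → N ≤ n → δ ℚ.≤ ℚ.∣ seq x n ∣

0ᴿ : ℝ
0ᴿ = fromℚ 0ℚ

close-0 : ∀ {x} → x ≈ᴿ 0ᴿ → ∀ ε → 0ℚ ℚ.< ε → ∃ λ N → ∀ n → N ≤ n → ℚ.∣ seq x n ∣ ℚ.< ε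
close-0 {x} x≈0 ε ε>0 = let N , p = _≈ᴿ_.close x≈0 ε ε>0 in N , λ n n≥ →
  subst (λ t → ℚ.∣ t ∣ ℚ.< ε) (solveℚ 1 (λ a → a :- con 0ℚ := a) refl (seq x n)) (p n n≥)

close-0⁻¹ : ∀ {x} → (∀ ε → 0ℚ ℚ.< ε → ∃ λ N → ∀ n → N ≤ n → ℚ.∣ seq x n ∣ ℚ.< ε) → x ≈ᴿ 0ᴿ
close-0⁻¹ {x} small = mk≈ λ ε ε>0 → let N , p = small ε ε>0 in N , λ n n≥ →
  subst (λ t → ℚ.∣ t ∣ ℚ.< ε) (solveℚ 1 (λ a → a := a :- con 0ℚ) refl (seq x n)) (p n n≥)

apart⇒≉0 : ∀ {x} → Apart₀ x → ¬ (x ≈ᴿ 0ᴿ)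
apart⇒≉0 (δ , δ>0 , N , p) x≈0 = let M , q = close-0 x≈0 δ δ>0 in
  <⇒≱ (q (N ⊔ M) (ℕ.m≤n⊔m N M)) (p (N ⊔ M) (ℕ.m≤m⊔n N M))

-- Take N from which terms differ by less than ε/4. The rational comparison of |x_N| with ε/2 is
-- decidable: if |x_N| is smaller, all later terms are below ε; otherwise they stay at or above ε/4,
-- which is apartness.
¬apart⇒≈0 : ∀ {x} → ¬ Apart₀ x → x ≈ᴿ 0ᴿ
¬apart⇒≈0 {x} ¬apart = close-0⁻¹ λ ε ε>0 → small ε ε>0 (cauchy x _ (half>0 (half>0 ε>0)))
  where
  ∣_-0∣ : ∀ a → ℚ.∣ a ℚ.- 0ℚ ∣ ≡ ℚ.∣ a ∣
  ∣ a -0∣ = cong ℚ.∣_∣ (ℚ.+-identityʳ a)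
  small : ∀ ε → 0ℚ ℚ.< ε →
          (∃ λ N → ∀ m n → N ≤ m → N ≤ n → ℚ.∣ seq x m ℚ.- seq x n ∣ ℚ.< half (half ε)) →
          ∃ λ N → ∀ n → N ≤ n → ℚ.∣ seq x n ∣ ℚ.< ε
  small ε ε>0 (N , near) with ℚ.∣ seq x N ∣ ℚ.<? half ε
  ... | yes xN<ε/2 = N , λ n n≥ → subst (ℚ._< ε) ∣ seq x n -0∣
    (triangle-half (seq x n) (seq x N) 0ℚ
      (ℚ.<-trans (near n N n≥ ℕ.≤-refl) (half< (half>0 ε>0)))
      (subst (ℚ._< half ε) (sym ∣ seq x N -0∣) xN<ε/2))
    where
    half< : ∀ {δ} → 0ℚ ℚ.< δ → half δ ℚ.< δ
    half< {δ} δ>0 = subst₂ ℚ._<_ (ℚ.+-identityʳ (half δ)) (half+half δ)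
      (ℚ.+-monoʳ-< (half δ) (half>0 δ>0))
  ... | no xN≮ε/2 = contradiction
    (half (half ε) , half>0 (half>0 ε>0) , N , λ n n≥ → ℚ.≮⇒≥ λ xn<ε/4 → xN≮ε/2
      (subst (ℚ._< half ε) ∣ seq x N -0∣
        (triangle-half (seq x N) (seq x n) 0ℚ (near N n ℕ.≤-refl n≥)
          (subst (ℚ._< half (half ε)) (sym ∣ seq x n -0∣) xn<ε/4))))
    ¬apart

≈0-stable : ∀ {x} → ¬ ¬ (x ≈ᴿ 0ᴿ) → x ≈ᴿ 0ᴿ
≈0-stable ¬¬x≈0 = ¬apart⇒≈0 λ x#0 → ¬¬x≈0 (apart⇒≉0 x#0)

-- Termwise reciprocals form a Cauchy sequence because |1/p - 1/q| = |p - q| / |pq| ≤ |p - q| / δ²;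
-- precision δ²ε for x thus gives precision ε for the inverse. From index N on, the product is
-- exactly 1.
1/ᴿ : ∀ x → Apart₀ x → ∃ λ y → y *ᴿ x ≈ᴿ fromℚ 1ℚ
1/ᴿ x (δ , δ>0 , N , x≥δ) = y , mk≈ λ ε ε>0 → N , λ n n≥ →
    subst (ℚ._< ε) (sym (trans (cong (λ t → ℚ.∣ t ℚ.- 1ℚ ∣) (recip-inverse _ (x≢0 n n≥)))
                               (cong ℚ.∣_∣ (ℚ.+-inverseʳ 1ℚ)))) ε>0
  where
  x≢0 : ∀ n → N ≤ n → seq x n ≢ 0ℚ
  x≢0 n n≥ x≡0 = <⇒≱ δ>0 (subst (λ t → δ ℚ.≤ ℚ.∣ t ∣) x≡0 (x≥δ n n≥))

  instance
    δ-pos : ℚ.Positive δ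
    δ-pos = ℚ.positive δ>0
    δ-nonNeg : ℚ.NonNegative δ
    δ-nonNeg = ℚ.pos⇒nonNeg δ
    δδ-pos : ℚ.Positive (δ ℚ.* δ)
    δδ-pos = ℚ.pos*pos⇒pos δ δ
    δδ-nonNeg : ℚ.NonNegative (δ ℚ.* δ)
    δδ-nonNeg = ℚ.pos⇒nonNeg (δ ℚ.* δ)

  δδ≤ : ∀ p q → δ ℚ.≤ ℚ.∣ p ∣ → δ ℚ.≤ ℚ.∣ q ∣ → δ ℚ.* δ ℚ.≤ ℚ.∣ p ℚ.* q ∣
  δδ≤ p q δ≤p δ≤q = begin
    δ ℚ.* δ               ≤⟨ ℚ.*-monoʳ-≤-nonNeg δ δ≤p ⟩
    ℚ.∣ p ∣ ℚ.* δ         ≤⟨ ℚ.*-monoˡ-≤-nonNeg ℚ.∣ p ∣ {{ℚ.∣-∣-nonNeg p}} δ≤q ⟩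
    ℚ.∣ p ∣ ℚ.* ℚ.∣ q ∣   ≡⟨ ℚ.∣p*q∣≡∣p∣*∣q∣ p q ⟨
    ℚ.∣ p ℚ.* q ∣         ∎
    where open ℚ.≤-Reasoning

  difference : ∀ p q → p ≢ 0ℚ → q ≢ 0ℚ → (recip p ℚ.- recip q) ℚ.* (p ℚ.* q) ≡ q ℚ.- p
  difference p q p≢0 q≢0 =
    trans (solveℚ 4 (λ a b p q → (a :- b) :* (p :* q) := (a :* p) :* q :- (b :* q) :* p) refl
             (recip p) (recip q) p q)
          (trans (cong₂ (λ s t → s ℚ.* q ℚ.- t ℚ.* p) (recip-inverse p p≢0) (recip-inverse q q≢0))
                 (cong₂ ℚ._-_ (ℚ.*-identityˡ q) (ℚ.*-identityˡ p)))

  recip-close : ∀ ε p q → p ≢ 0ℚ → q ≢ 0ℚ → δ ℚ.≤ ℚ.∣ p ∣ → δ ℚ.≤ ℚ.∣ q ∣ →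
                ℚ.∣ p ℚ.- q ∣ ℚ.< (δ ℚ.* δ) ℚ.* ε → ℚ.∣ recip p ℚ.- recip q ∣ ℚ.< ε
  recip-close ε p q p≢0 q≢0 δ≤p δ≤q p-q<δδε = ℚ.*-cancelˡ-<-nonNeg (δ ℚ.* δ) (begin-strict
    (δ ℚ.* δ) ℚ.* ℚ.∣ r ∣
      ≤⟨ ℚ.*-monoʳ-≤-nonNeg ℚ.∣ r ∣ {{ℚ.∣-∣-nonNeg r}} (δδ≤ p q δ≤p δ≤q) ⟩
    ℚ.∣ p ℚ.* q ∣ ℚ.* ℚ.∣ r ∣    ≡⟨ ℚ.*-comm ℚ.∣ p ℚ.* q ∣ ℚ.∣ r ∣ ⟩
    ℚ.∣ r ∣ ℚ.* ℚ.∣ p ℚ.* q ∣    ≡⟨ ℚ.∣p*q∣≡∣p∣*∣q∣ r (p ℚ.* q) ⟨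
    ℚ.∣ r ℚ.* (p ℚ.* q) ∣        ≡⟨ cong ℚ.∣_∣ (difference p q p≢0 q≢0) ⟩
    ℚ.∣ q ℚ.- p ∣                ≡⟨ ∣-∣-comm q p ⟩
    ℚ.∣ p ℚ.- q ∣                <⟨ p-q<δδε ⟩
    (δ ℚ.* δ) ℚ.* ε              ∎)
    where
    open ℚ.≤-Reasoning
    r : ℚ
    r = recip p ℚ.- recip q

  y : ℝ
  y = mkℝ (λ n → recip (seq x n)) λ ε ε>0 →
    let M , near = cauchy x ((δ ℚ.* δ) ℚ.* ε)
                     (subst (ℚ._< (δ ℚ.* δ) ℚ.* ε) (ℚ.*-zeroʳ (δ ℚ.* δ))
                       (ℚ.*-monoʳ-<-pos (δ ℚ.* δ) ε>0))
    in N ⊔ M , λ m n m≥ n≥ →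
       let m≥N = ℕ.≤-trans (ℕ.m≤m⊔n N M) m≥
           n≥N = ℕ.≤-trans (ℕ.m≤m⊔n N M) n≥
       in recip-close ε (seq x m) (seq x n) (x≢0 m m≥N) (x≢0 n n≥N) (x≥δ m m≥N) (x≥δ n n≥N)
            (near m n (ℕ.≤-trans (ℕ.m≤n⊔m N M) m≥) (ℕ.≤-trans (ℕ.m≤n⊔m N M) n≥))

sum-of-squares≈0 : ∀ {x y} → x *ᴿ x +ᴿ y *ᴿ y ≈ᴿ 0ᴿ → x ≈ᴿ 0ᴿ
sum-of-squares≈0 {x} {y} xx+yy≈0 = close-0⁻¹ λ ε ε>0 →
  -- Since a² ≤ a² + b², precision ε² for the sum gives precision ε for x.
  let N , p = close-0 xx+yy≈0 (ε ℚ.* ε) (εε>0 ε>0)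
  in N , λ n n≥ → bound ε ε>0 (seq x n) (seq y n) (p n n≥)
  where
  εε>0 : ∀ {ε} → 0ℚ ℚ.< ε → 0ℚ ℚ.< ε ℚ.* ε
  εε>0 {ε} ε>0 = ℚ.positive⁻¹ _ {{ℚ.pos*pos⇒pos ε {{ℚ.positive ε>0}} ε {{ℚ.positive ε>0}}}}

  0≤square : ∀ a → 0ℚ ℚ.≤ a ℚ.* a
  0≤square a with ℚ.≤-total 0ℚ a
  ... | inj₁ 0≤a = subst (ℚ._≤ a ℚ.* a) (ℚ.*-zeroˡ a)
    (ℚ.*-monoʳ-≤-nonNeg a {{ℚ.nonNegative 0≤a}} 0≤a)
  ... | inj₂ a≤0 = subst (ℚ._≤ a ℚ.* a) (ℚ.*-zeroˡ a)
    (ℚ.*-monoʳ-≤-nonPos a {{ℚ.nonPositive a≤0}} a≤0)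

  bound : ∀ ε → 0ℚ ℚ.< ε → ∀ a b → ℚ.∣ a ℚ.* a ℚ.+ b ℚ.* b ∣ ℚ.< ε ℚ.* ε → ℚ.∣ a ∣ ℚ.< ε
  bound ε ε>0 a b aa+bb<εε = ℚ.≰⇒> λ ε≤a → <⇒≱ aa+bb<εε (begin
    ε ℚ.* ε                     ≤⟨ ℚ.*-monoʳ-≤-nonNeg ε {{ℚ.nonNegative (ℚ.<⇒≤ ε>0)}} ε≤a ⟩
    ℚ.∣ a ∣ ℚ.* ε               ≤⟨ ℚ.*-monoˡ-≤-nonNeg ℚ.∣ a ∣ {{ℚ.∣-∣-nonNeg a}} ε≤a ⟩
    ℚ.∣ a ∣ ℚ.* ℚ.∣ a ∣         ≡⟨ ℚ.∣p*q∣≡∣p∣*∣q∣ a a ⟨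
    ℚ.∣ a ℚ.* a ∣               ≡⟨ ℚ.0≤p⇒∣p∣≡p (0≤square a) ⟩
    a ℚ.* a                     ≡⟨ ℚ.+-identityʳ (a ℚ.* a) ⟨
    a ℚ.* a ℚ.+ 0ℚ              ≤⟨ ℚ.+-monoʳ-≤ (a ℚ.* a) (0≤square b) ⟩
    a ℚ.* a ℚ.+ b ℚ.* b         ≡⟨ ℚ.0≤p⇒∣p∣≡p (ℚ.+-mono-≤ (0≤square a) (0≤square b)) ⟨
    ℚ.∣ a ℚ.* a ℚ.+ b ℚ.* b ∣   ∎)
    where open ℚ.≤-Reasoning

-- One late term of x decides. Later terms stay within a quarter of the gap |p - q| from it, so if
-- it lies within half the gap of p then x cannot tend to q, and otherwise x cannot tend to p.
≉-cotransitive : ∀ x {p q} → p ≢ q → ¬ (x ≈ᴿ fromℚ p) ⊎ ¬ (x ≈ᴿ fromℚ q)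
≉-cotransitive x {p} {q} p≢q with cauchy x _ (half>0 (half>0 (0<∣-∣ p≢q)))
... | N , near with ℚ.∣ p ℚ.- seq x N ∣ ℚ.<? half ℚ.∣ p ℚ.- q ∣
...   | yes p-xN< = inj₂ λ x≈q → let M , x-q< = _≈ᴿ_.close x≈q _ (half>0 (half>0 (0<∣-∣ p≢q))) in
  ℚ.<-irrefl refl (triangle-half p (seq x N) q p-xN<
    (triangle-half (seq x N) (seq x (N ⊔ M)) q
      (near N (N ⊔ M) ℕ.≤-refl (ℕ.m≤m⊔n N M)) (x-q< (N ⊔ M) (ℕ.m≤n⊔m N M))))
...   | no p-xN≮ = inj₁ λ x≈p → let M , x-p< = _≈ᴿ_.close x≈p _ (half>0 (half>0 (0<∣-∣ p≢q))) in
  p-xN≮ (triangle-half p (seq x (N ⊔ M)) (seq x N)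
    (subst (ℚ._< _) (∣-∣-comm _ p) (x-p< (N ⊔ M) (ℕ.m≤n⊔m N M)))
    (near (N ⊔ M) N (ℕ.m≤m⊔n N M) ℕ.≤-refl))

fromℚ-injective : ∀ {p q} → fromℚ p ≈ᴿ fromℚ q → p ≡ q
fromℚ-injective {p} {q} p≈q with p ℚ.≟ q
... | yes p≡q = p≡q
... | no  p≢q = let N , close = _≈ᴿ_.close p≈q _ (0<∣-∣ p≢q) in
  contradiction (close N ℕ.≤-refl) (ℚ.<-irrefl refl)

-- Complex numbers: stable equality, invertibility, the embedded integers

≈ᶜ-stable : ∀ {z w} → ¬ ¬ (z ≈ᶜ w) → z ≈ᶜ w
≈ᶜ-stable ¬¬z≈w = stable (λ k → ¬¬z≈w (k ∘ proj₁)) , stable (λ k → ¬¬z≈w (k ∘ proj₂))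
  where
  open GroupProperties ℝ-ring.+-group
  stable : ∀ {x y} → ¬ ¬ (x ≈ᴿ y) → x ≈ᴿ y
  stable {x} {y} ¬¬x≈y = x∙y⁻¹≈ε⇒x≈y x y (≈0-stable λ k → ¬¬x≈y (k ∘ x≈y⇒x∙y⁻¹≈ε))

Invertible : ℂ → Set
Invertible z = ∃ λ w → w *ᶜ z ≈ᶜ 1ᶜ

-- Invertibility asks for a positive lower bound on |z|², which z ≉ 0 yields only up to ¬¬.
≉0⇒¬¬invertible : ∀ {z} → ¬ (z ≈ᶜ 0ᶜ) → ¬ ¬ Invertible z
≉0⇒¬¬invertible {a , b} z≉0 ¬inv = z≉0 (sum-of-squares≈0 aa+bb≈0 , sum-of-squares≈0 bb+aa≈0)
  where
  aa+bb≈0 : a *ᴿ a +ᴿ b *ᴿ b ≈ᴿ 0ᴿ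
  aa+bb≈0 = ¬apart⇒≈0 λ #0 → let r , r*≈1 = 1/ᴿ (a *ᴿ a +ᴿ b *ᴿ b) #0 in ¬inv
    ( (r *ᴿ a , r *ᴿ (-ᴿ b))
    , ℝ-ring.trans {j = r *ᴿ (a *ᴿ a +ᴿ b *ᴿ b)} (pointwise λ n → solveℚ 3 (λ a b r →
        (r :* a) :* a :+ :- ((r :* :- b) :* b) := r :* (a :* a :+ b :* b)) refl
        (seq a n) (seq b n) (seq r n)) r*≈1
    , pointwise λ n → solveℚ 3 (λ a b r →
        (r :* a) :* b :+ (r :* :- b) :* a := con 0ℚ) refl (seq a n) (seq b n) (seq r n) )
  bb+aa≈0 : b *ᴿ b +ᴿ a *ᴿ a ≈ᴿ 0ᴿ
  bb+aa≈0 = ℝ-ring.trans (ℝ-ring.+-comm (b *ᴿ b) (a *ᴿ a)) aa+bb≈0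

invertible-cancel : ∀ {z w} → Invertible z → z *ᶜ w ≈ᶜ 0ᶜ → w ≈ᶜ 0ᶜ
invertible-cancel {z} {w} (z⁻¹ , z⁻¹z≈1) zw≈0 = begin
  w                   ≈⟨ ℂ.*-identityˡ w ⟨
  1ᶜ *ᶜ w             ≈⟨ ℂ.*-congʳ z⁻¹z≈1 ⟨
  (z⁻¹ *ᶜ z) *ᶜ w     ≈⟨ ℂ.*-assoc z⁻¹ z w ⟩
  z⁻¹ *ᶜ (z *ᶜ w)     ≈⟨ ℂ.*-congˡ zw≈0 ⟩
  z⁻¹ *ᶜ 0ᶜ           ≈⟨ ℂ.zeroʳ z⁻¹ ⟩
  0ᶜ                  ∎
  where open ≈ᶜ-Reasoning

-- The conclusion is a stable equality, so an inverse of z under a double negation is enough.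
≉0-cancel : ∀ {z w} → ¬ (z ≈ᶜ 0ᶜ) → z *ᶜ w ≈ᶜ 0ᶜ → w ≈ᶜ 0ᶜ
≉0-cancel z≉0 zw≈0 = ≈ᶜ-stable λ w≉0 → ≉0⇒¬¬invertible z≉0 λ inv → w≉0 (invertible-cancel inv zw≈0)

1≉0 : ¬ (1ᶜ ≈ᶜ 0ᶜ)
1≉0 (1≈0 , _) with fromℚ-injective 1≈0
... | ()

invertible⇒≉0 : ∀ {z} → Invertible z → ¬ (z ≈ᶜ 0ᶜ)
invertible⇒≉0 (z⁻¹ , z⁻¹z≈1) z≈0 =
  1≉0 (ℂ.trans (ℂ.sym z⁻¹z≈1) (ℂ.trans (ℂ.*-congˡ z≈0) (ℂ.zeroʳ z⁻¹)))

-- For a variable z the left side is stuck on the reduction of the fraction by a gcd; the normal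
-- form on the right lets rational arithmetic compute.
z/1≡ : ∀ z → z ℚ./ 1 ≡ ℚ.mkℚ z 0 (Coprimality.sym (Coprimality.1-coprimeTo _))
z/1≡ z = ℚ.↥p/↧p≡p (ℚ.mkℚ z 0 _)

fromℤ-+ : ∀ a b → fromℤ (a ℤ.+ b) ≈ᶜ fromℤ a +ᶜ fromℤ b
fromℤ-+ a b = (pointwise λ _ → trans
    (cong₂ (λ s t → (s ℤ.+ t) ℚ./ 1) (sym (ℤ.*-identityʳ a)) (sym (ℤ.*-identityʳ b)))
    (sym (cong₂ ℚ._+_ (z/1≡ a) (z/1≡ b)))) , pointwise λ _ → refl

fromℤ-* : ∀ a b → fromℤ (a ℤ.* b) ≈ᶜ fromℤ a *ᶜ fromℤ b
fromℤ-* a b = (pointwise λ _ → trans (sym (cong₂ ℚ._*_ (z/1≡ a) (z/1≡ b)))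
      (solveℚ 2 (λ p q → p :* q := p :* q :+ :- (con 0ℚ :* con 0ℚ)) refl (a ℚ./ 1) (b ℚ./ 1))) ,
  pointwise λ _ → solveℚ 2 (λ p q → con 0ℚ := p :* con 0ℚ :+ con 0ℚ :* q) refl (a ℚ./ 1) (b ℚ./ 1)

fromℤ-injective : ∀ {a b} → fromℤ a ≈ᶜ fromℤ b → a ≡ b
fromℤ-injective {a} {b} (a≈b , _) =
  proj₁ (ℚ.mkℚ-injective (trans (sym (z/1≡ a)) (trans (fromℚ-injective a≈b) (z/1≡ b))))

fromℤ-invertible : ∀ {z} → z ≢ 0ℤ → Invertible (fromℤ z)
fromℤ-invertible {z} z≢0 = (fromℚ (recip (z ℚ./ 1)) , 0ᴿ) ,
  (pointwise λ _ → trans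
    (solveℚ 2 (λ p q → p :* q :+ :- (con 0ℚ :* con 0ℚ) := p :* q) refl (recip (z ℚ./ 1)) (z ℚ./ 1))
    (recip-inverse (z ℚ./ 1) λ z/1≡0 →
      z≢0 (proj₁ (ℚ.mkℚ-injective (trans (sym (z/1≡ z)) z/1≡0))))) ,
  pointwise λ _ →
    solveℚ 2 (λ p q → p :* con 0ℚ :+ con 0ℚ :* q := con 0ℚ) refl (recip (z ℚ./ 1)) (z ℚ./ 1)

fromℤ-≉-cotransitive : ∀ θ {a b} → a ≢ b → ¬ (θ ≈ᶜ fromℤ a) ⊎ ¬ (θ ≈ᶜ fromℤ b)
fromℤ-≉-cotransitive (x , _) {a} {b} a≢b
  with ≉-cotransitive x {a ℚ./ 1} {b ℚ./ 1}
         (λ eq → a≢b (proj₁ (ℚ.mkℚ-injective (trans (sym (z/1≡ a)) (trans eq (z/1≡ b))))))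
... | inj₁ x≉a = inj₁ (x≉a ∘ proj₁)
... | inj₂ x≉b = inj₂ (x≉b ∘ proj₁)

-- Finite sums in ℂ and in ℤ

module Σᶜ = SemiringSum ℂ.semiring
module Σᶻ = SemiringSum ℤ.+-*-semiring
module ×ᶜ = CommutativeSemigroupProperties ℂ.*-commutativeSemigroup

δᶻ : ∀ {n} → Fin n → Fin n → ℤ
δᶻ i j = if does (i Fin.≟ j) then 1ℤ else 0ℤ

fromℤ-sum : ∀ {n} (f : Fin n → ℤ) → fromℤ (sumᶻ f) ≈ᶜ sum (fromℤ ∘ f)
fromℤ-sum {zero}  f = ℂ.refl
fromℤ-sum {ℕ.suc n} f = ℂ.trans (fromℤ-+ (f zero) _) (ℂ.+-congˡ (fromℤ-sum (f ∘ suc)))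

fromℤ-sum-* : ∀ {n} (f g : Fin n → ℤ) →
              sum (λ i → fromℤ (f i) *ᶜ fromℤ (g i)) ≈ᶜ fromℤ (sumᶻ (λ i → f i ℤ.* g i))
fromℤ-sum-* f g = ℂ.trans (Σᶜ.sum-cong-≋ λ i → ℂ.sym (fromℤ-* (f i) (g i)))
                           (ℂ.sym (fromℤ-sum λ i → f i ℤ.* g i))

fromℤ-if : ∀ {A : Set} (a? : Dec A) →
           (if does a? then 1ᶜ else 0ᶜ) ≈ᶜ fromℤ (if does a? then 1ℤ else 0ℤ)
fromℤ-if (yes _) = ℂ.refl
fromℤ-if (no  _) = ℂ.refl

fromℤ-δ : ∀ {n} (i j : Fin n) → fromℤ (δᶻ i j) ≈ᶜ 1ᴹ i j
fromℤ-δ i j = ℂ.sym (fromℤ-if (i Fin.≟ j))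

sum≈0 : ∀ {n} {f : Fin n → ℂ} → (∀ i → f i ≈ᶜ 0ᶜ) → sum f ≈ᶜ 0ᶜ
sum≈0 {n} f≈0 = ℂ.trans (Σᶜ.sum-cong-≋ f≈0) (Σᶜ.sum-replicate-zero n)

sum-single : ∀ {n} {f : Fin n → ℂ} i → (∀ j → j ≢ i → f j ≈ᶜ 0ᶜ) → sum f ≈ᶜ f i
sum-single zero f≈0 =
  ℂ.trans (ℂ.+-congˡ (sum≈0 λ j → f≈0 (suc j) λ ())) (ℂ.+-identityʳ _)
sum-single (suc i) f≈0 =
  ℂ.trans (ℂ.+-cong (f≈0 zero λ ()) (sum-single i λ j j≢i → f≈0 (suc j) (j≢i ∘ Fin.suc-injective)))
           (ℂ.+-identityˡ _)

1ᴹ-diagonal : ∀ {n} (i : Fin n) → 1ᴹ i i ≈ᶜ 1ᶜ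
1ᴹ-diagonal i with i Fin.≟ i
... | yes _   = ℂ.refl
... | no  i≢i = contradiction refl i≢i

1ᴹ-off-diagonal : ∀ {n} {i j : Fin n} → i ≢ j → 1ᴹ i j ≈ᶜ 0ᶜ
1ᴹ-off-diagonal {i = i} {j} i≢j with i Fin.≟ j
... | yes i≡j = contradiction i≡j i≢j
... | no  _   = ℂ.refl

sum-δˡ : ∀ {n} (f : Fin n → ℂ) i → sum (λ j → 1ᴹ i j *ᶜ f j) ≈ᶜ f i
sum-δˡ f i = ℂ.trans
  (sum-single i λ j j≢i → ℂ.trans (ℂ.*-congʳ (1ᴹ-off-diagonal (j≢i ∘ sym))) (ℂ.zeroˡ (f j)))
  (ℂ.trans (ℂ.*-congʳ (1ᴹ-diagonal i)) (ℂ.*-identityˡ (f i)))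

-- Linear combinations

module _ {I : Set} where

  ≋-refl : {u : I → ℂ} → u ≋ u
  ≋-refl i = ℂ.refl

  ≋-sym : {u v : I → ℂ} → u ≋ v → v ≋ u
  ≋-sym u≋v i = ℂ.sym (u≋v i)

  ≋-trans : {u v w : I → ℂ} → u ≋ v → v ≋ w → u ≋ w
  ≋-trans u≋v v≋w i = ℂ.trans (u≋v i) (v≋w i)

  module _ {m : ℕ} where

    combination-cong : {a b : Fin m → ℂ} {u v : Fin m → I → ℂ} →
                       a ≋ b → (∀ k → u k ≋ v k) → combination a u ≋ combination b v
    combination-cong a≋b u≋v i = Σᶜ.sum-cong-≋ λ k → ℂ.*-cong (a≋b k) (u≋v k i)

    combination-congˡ : {a b : Fin m → ℂ} (u : Fin m → I → ℂ) →
                        a ≋ b → combination a u ≋ combination b u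
    combination-congˡ u a≋b = combination-cong a≋b λ _ → ≋-refl

    combination-+ : (a b : Fin m → ℂ) (u : Fin m → I → ℂ) →
                    combination (a ⊞ b) u ≋ combination a u ⊞ combination b u
    combination-+ a b u i = ℂ.trans
      (Σᶜ.sum-cong-≋ λ k → ℂ.distribʳ (u k i) (a k) (b k))
      (Σᶜ.∑-distrib-+ (λ k → a k *ᶜ u k i) (λ k → b k *ᶜ u k i))

    combination-· : (c : ℂ) (a : Fin m → ℂ) (u : Fin m → I → ℂ) →
                    combination (c · a) u ≋ c · combination a u
    combination-· c a u i = ℂ.trans
      (Σᶜ.sum-cong-≋ λ k → ℂ.*-assoc c (a k) (u k i))
      (ℂ.sym (Σᶜ.*-distribˡ-sum c (λ k → a k *ᶜ u k i)))

    combination-𝟎 : (u : Fin m → I → ℂ) → combination 𝟎 u ≋ 𝟎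
    combination-𝟎 u i = sum≈0 λ k → ℂ.zeroˡ (u k i)

    combination-δ : (u : Fin m → I → ℂ) (k : Fin m) → combination (1ᴹ k) u ≋ u k
    combination-δ u k i = sum-δˡ (λ j → u j i) k

    combination-combination : ∀ {l} (a : Fin l → ℂ) (β : Fin m → Fin l → ℂ) (u : Fin m → I → ℂ) →
      combination a (λ k → combination (λ j → β j k) u) ≋
      combination (λ j → sum (λ k → β j k *ᶜ a k)) u
    combination-combination a β u i = begin
      sum (λ k → a k *ᶜ sum (λ j → β j k *ᶜ u j i))
        ≈⟨ Σᶜ.sum-cong-≋ (λ k → Σᶜ.*-distribˡ-sum (a k) (λ j → β j k *ᶜ u j i)) ⟩
      sum (λ k → sum (λ j → a k *ᶜ (β j k *ᶜ u j i)))
        ≈⟨ Σᶜ.∑-comm (λ k j → a k *ᶜ (β j k *ᶜ u j i)) ⟩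
      sum (λ j → sum (λ k → a k *ᶜ (β j k *ᶜ u j i)))
        ≈⟨ Σᶜ.sum-cong-≋ (λ j → Σᶜ.sum-cong-≋ λ k →
             ℂ.trans (ℂ.sym (ℂ.*-assoc (a k) (β j k) (u j i)))
                      (ℂ.*-congʳ (ℂ.*-comm (a k) (β j k)))) ⟩
      sum (λ j → sum (λ k → (β j k *ᶜ a k) *ᶜ u j i))
        ≈⟨ Σᶜ.sum-cong-≋ (λ j → Σᶜ.*-distribʳ-sum (u j i) (λ k → β j k *ᶜ a k)) ⟨
      sum (λ j → sum (λ k → β j k *ᶜ a k) *ᶜ u j i) ∎
      where open ≈ᶜ-Reasoning

    span : (Fin m → I → ℂ) → Pred (I → ℂ) 0ℓ
    span u v = ∃ λ a → v ≋ combination a u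

    span-isSubspace : (u : Fin m → I → ℂ) → IsSubspace (span u)
    span-isSubspace u = record
      { resp = λ u≋v (a , u≋) → a , ≋-trans (≋-sym u≋v) u≋
      ; 0∈   = 𝟎 , ≋-sym (combination-𝟎 u)
      ; +∈   = λ (a , v≋) (b , w≋) → a ⊞ b , λ i →
                 ℂ.trans (ℂ.+-cong (v≋ i) (w≋ i)) (ℂ.sym (combination-+ a b u i))
      ; ·∈   = λ c (a , v≋) → c · a , λ i →
                 ℂ.trans (ℂ.*-congˡ (v≋ i)) (ℂ.sym (combination-· c a u i))
      }

    generator∈span : (u : Fin m → I → ℂ) → ∀ k → u k ∈ span u
    generator∈span u k = 1ᴹ k , ≋-sym (combination-δ u k)

  sum∈ : ∀ {P : Pred (I → ℂ) 0ℓ} → IsSubspace P → ∀ {m} (vs : Fin m → I → ℂ) →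
         (∀ k → vs k ∈ P) → Σⱽ vs ∈ P
  sum∈ P-subspace {zero}  vs vs∈ = IsSubspace.0∈ P-subspace
  sum∈ P-subspace {ℕ.suc m} vs vs∈ =
    IsSubspace.+∈ P-subspace (vs∈ zero) (sum∈ P-subspace (vs ∘ suc) (vs∈ ∘ suc))

-- Matrices

module _ {n : ℕ} where

  *ᵥ-cong : ∀ {M N : Mat n} {u v} → (∀ i → M i ≋ N i) → u ≋ v → M *ᵥ u ≋ N *ᵥ v
  *ᵥ-cong M≋N u≋v i = Σᶜ.sum-cong-≋ λ j → ℂ.*-cong (M≋N i j) (u≋v j)

  *ᵥ-congˡ : ∀ (M : Mat n) {u v} → u ≋ v → M *ᵥ u ≋ M *ᵥ v
  *ᵥ-congˡ M = *ᵥ-cong λ _ _ → ℂ.refl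

  *ᵥ-combination : ∀ (M : Mat n) {m} (a : Fin m → ℂ) (u : Fin m → Fin n → ℂ) →
                   M *ᵥ combination a u ≋ combination a (λ k → M *ᵥ u k)
  *ᵥ-combination M a u i = begin
    sum (λ j → M i j *ᶜ sum (λ k → a k *ᶜ u k j))
      ≈⟨ Σᶜ.sum-cong-≋ (λ j → Σᶜ.*-distribˡ-sum (M i j) (λ k → a k *ᶜ u k j)) ⟩
    sum (λ j → sum (λ k → M i j *ᶜ (a k *ᶜ u k j)))
      ≈⟨ Σᶜ.∑-comm (λ j k → M i j *ᶜ (a k *ᶜ u k j)) ⟩
    sum (λ k → sum (λ j → M i j *ᶜ (a k *ᶜ u k j)))
      ≈⟨ Σᶜ.sum-cong-≋ (λ k → Σᶜ.sum-cong-≋ λ j → ×ᶜ.x∙yz≈y∙xz (M i j) (a k) (u k j)) ⟩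
    sum (λ k → sum (λ j → a k *ᶜ (M i j *ᶜ u k j)))
      ≈⟨ Σᶜ.sum-cong-≋ (λ k → Σᶜ.*-distribˡ-sum (a k) (λ j → M i j *ᶜ u k j)) ⟨
    sum (λ k → a k *ᶜ sum (λ j → M i j *ᶜ u k j)) ∎
    where open ≈ᶜ-Reasoning

  *ᵥ-* : ∀ (M N : Mat n) v → (M *ᴹ N) *ᵥ v ≋ M *ᵥ (N *ᵥ v)
  *ᵥ-* M N v i = begin
    sum (λ j → sum (λ k → M i k *ᶜ N k j) *ᶜ v j)
      ≈⟨ Σᶜ.sum-cong-≋ (λ j → Σᶜ.*-distribʳ-sum (v j) (λ k → M i k *ᶜ N k j)) ⟩
    sum (λ j → sum (λ k → (M i k *ᶜ N k j) *ᶜ v j))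
      ≈⟨ Σᶜ.∑-comm (λ j k → (M i k *ᶜ N k j) *ᶜ v j) ⟩
    sum (λ k → sum (λ j → (M i k *ᶜ N k j) *ᶜ v j))
      ≈⟨ Σᶜ.sum-cong-≋ (λ k → Σᶜ.sum-cong-≋ λ j → ℂ.*-assoc (M i k) (N k j) (v j)) ⟩
    sum (λ k → sum (λ j → M i k *ᶜ (N k j *ᶜ v j)))
      ≈⟨ Σᶜ.sum-cong-≋ (λ k → Σᶜ.*-distribˡ-sum (M i k) (λ j → N k j *ᶜ v j)) ⟨
    sum (λ k → M i k *ᶜ sum (λ j → N k j *ᶜ v j)) ∎
    where open ≈ᶜ-Reasoning

  *ᵥ-+ : ∀ (M N : Mat n) v → (M +ᴹ N) *ᵥ v ≋ M *ᵥ v ⊞ N *ᵥ v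
  *ᵥ-+ M N v i = ℂ.trans
    (Σᶜ.sum-cong-≋ λ j → ℂ.distribʳ (v j) (M i j) (N i j))
    (Σᶜ.∑-distrib-+ (λ j → M i j *ᶜ v j) (λ j → N i j *ᶜ v j))

  *ᵥ-· : ∀ c (M : Mat n) v → (λ i → c · M i) *ᵥ v ≋ c · (M *ᵥ v)
  *ᵥ-· c M v i = ℂ.trans
    (Σᶜ.sum-cong-≋ λ j → ℂ.*-assoc c (M i j) (v j))
    (ℂ.sym (Σᶜ.*-distribˡ-sum c (λ j → M i j *ᶜ v j)))

  1ᴹ-*ᵥ : ∀ v → 1ᴹ {n} *ᵥ v ≋ v
  1ᴹ-*ᵥ v i = sum-δˡ v i

-- Diagonalisation over ℤ up to a common denominator N

module _ {n : ℕ} where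

  -- The rows of R are a basis of ℂⁿ, and the rows of L divided by N are its dual basis:
  -- `resolution` and `biorthogonality` say that the two matrices are inverse to each other up to
  -- the factor N.
  record Dual (R L : Fin n → Fin n → ℤ) : Set where
    field
      N               : ℤ
      N≢0             : N ≢ 0ℤ
      resolution      : ∀ a b → sumᶻ (λ k → R k a ℤ.* L k b) ≡ N ℤ.* δᶻ a b
      biorthogonality : ∀ j k → sumᶻ (λ a → L j a ℤ.* R k a) ≡ N ℤ.* δᶻ j k

    N⁻¹ : ℂ
    N⁻¹ = proj₁ (fromℤ-invertible N≢0)

    vectors : Fin n → Fin n → ℂ
    vectors k a = fromℤ (R k a)

    coefficient : Fin n → (Fin n → ℂ) → ℂ
    coefficient k v = sum (λ b → fromℤ (L k b) *ᶜ v b)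

    N-δ : ∀ (i j : Fin n) {x} → x ≡ N ℤ.* δᶻ i j → fromℤ x ≈ᶜ fromℤ N *ᶜ 1ᴹ i j
    N-δ i j refl = ℂ.trans (fromℤ-* N (δᶻ i j)) (ℂ.*-congˡ (fromℤ-δ i j))

    coefficient-cong : ∀ k {u v} → u ≋ v → coefficient k u ≈ᶜ coefficient k v
    coefficient-cong k u≋v = Σᶜ.sum-cong-≋ λ b → ℂ.*-congˡ (u≋v b)

    expansion : ∀ v → v ≋ combination (λ k → N⁻¹ *ᶜ coefficient k v) vectors
    expansion v a = ℂ.sym (begin
      sum (λ k → (N⁻¹ *ᶜ coefficient k v) *ᶜ fromℤ (R k a))
        ≈⟨ Σᶜ.sum-cong-≋ (λ k → ℂ.*-assoc N⁻¹ (coefficient k v) (fromℤ (R k a))) ⟩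
      sum (λ k → N⁻¹ *ᶜ (coefficient k v *ᶜ fromℤ (R k a)))
        ≈⟨ Σᶜ.*-distribˡ-sum N⁻¹ (λ k → coefficient k v *ᶜ fromℤ (R k a)) ⟨
      N⁻¹ *ᶜ sum (λ k → coefficient k v *ᶜ fromℤ (R k a))
        ≈⟨ ℂ.*-congˡ (Σᶜ.sum-cong-≋ λ k →
             ℂ.trans (ℂ.*-comm (coefficient k v) (fromℤ (R k a)))
                      (Σᶜ.*-distribˡ-sum (fromℤ (R k a)) (λ b → fromℤ (L k b) *ᶜ v b))) ⟩
      N⁻¹ *ᶜ sum (λ k → sum (λ b → fromℤ (R k a) *ᶜ (fromℤ (L k b) *ᶜ v b)))
        ≈⟨ ℂ.*-congˡ (Σᶜ.∑-comm λ k b → fromℤ (R k a) *ᶜ (fromℤ (L k b) *ᶜ v b)) ⟩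
      N⁻¹ *ᶜ sum (λ b → sum (λ k → fromℤ (R k a) *ᶜ (fromℤ (L k b) *ᶜ v b)))
        ≈⟨ ℂ.*-congˡ (Σᶜ.sum-cong-≋ λ b → begin
             sum (λ k → fromℤ (R k a) *ᶜ (fromℤ (L k b) *ᶜ v b))
               ≈⟨ Σᶜ.sum-cong-≋ (λ k → ℂ.sym (ℂ.*-assoc (fromℤ (R k a)) (fromℤ (L k b)) (v b))) ⟩
             sum (λ k → (fromℤ (R k a) *ᶜ fromℤ (L k b)) *ᶜ v b)
               ≈⟨ Σᶜ.*-distribʳ-sum (v b) (λ k → fromℤ (R k a) *ᶜ fromℤ (L k b)) ⟨
             sum (λ k → fromℤ (R k a) *ᶜ fromℤ (L k b)) *ᶜ v b
               ≈⟨ ℂ.*-congʳ (ℂ.trans (fromℤ-sum-* (λ k → R k a) (λ k → L k b))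
                                     (N-δ a b (resolution a b))) ⟩
             (fromℤ N *ᶜ 1ᴹ a b) *ᶜ v b
               ≈⟨ ℂ.*-assoc (fromℤ N) (1ᴹ a b) (v b) ⟩
             fromℤ N *ᶜ (1ᴹ a b *ᶜ v b) ∎) ⟩
      N⁻¹ *ᶜ sum (λ b → fromℤ N *ᶜ (1ᴹ a b *ᶜ v b))
        ≈⟨ ℂ.*-congˡ (Σᶜ.*-distribˡ-sum (fromℤ N) (λ b → 1ᴹ a b *ᶜ v b)) ⟨
      N⁻¹ *ᶜ (fromℤ N *ᶜ sum (λ b → 1ᴹ a b *ᶜ v b))
        ≈⟨ ℂ.*-assoc N⁻¹ (fromℤ N) _ ⟨
      (N⁻¹ *ᶜ fromℤ N) *ᶜ sum (λ b → 1ᴹ a b *ᶜ v b)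
        ≈⟨ ℂ.*-cong (proj₂ (fromℤ-invertible N≢0)) (sum-δˡ v a) ⟩
      1ᶜ *ᶜ v a
        ≈⟨ ℂ.*-identityˡ (v a) ⟩
      v a ∎)
      where open ≈ᶜ-Reasoning

    coefficient-combination : ∀ {m} (e : Fin m → Fin n) (a : Fin m → ℂ) j →
      coefficient j (combination a (vectors ∘ e)) ≈ᶜ sum (λ i → a i *ᶜ (fromℤ N *ᶜ 1ᴹ j (e i)))
    coefficient-combination e a j = ℂ.trans
      (*ᵥ-combination (λ j b → fromℤ (L j b)) a (vectors ∘ e) j)
      (Σᶜ.sum-cong-≋ λ i → ℂ.*-congˡ
        (ℂ.trans (fromℤ-sum-* (L j) (R (e i))) (N-δ j (e i) (biorthogonality j (e i)))))

    vectors-independent : ∀ {m} (e : Fin m → Fin n) → (∀ {i j} → e i ≡ e j → i ≡ j) →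
                          LinearlyIndependent (vectors ∘ e)
    vectors-independent e e-injective a comb≋𝟎 k = invertible-cancel (fromℤ-invertible N≢0) (begin
      fromℤ N *ᶜ a k
        ≈⟨ ℂ.*-comm (fromℤ N) (a k) ⟩
      a k *ᶜ fromℤ N
        ≈⟨ ℂ.*-congˡ (ℂ.*-identityʳ (fromℤ N)) ⟨
      a k *ᶜ (fromℤ N *ᶜ 1ᶜ)
        ≈⟨ ℂ.*-congˡ (ℂ.*-congˡ (1ᴹ-diagonal (e k))) ⟨
      a k *ᶜ (fromℤ N *ᶜ 1ᴹ (e k) (e k))
        ≈⟨ sum-single k (λ i i≢k → ℂ.trans
             (ℂ.*-congˡ (ℂ.trans (ℂ.*-congˡ (1ᴹ-off-diagonal (i≢k ∘ sym ∘ e-injective)))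
                                   (ℂ.zeroʳ (fromℤ N))))
             (ℂ.zeroʳ (a i))) ⟨
      sum (λ i → a i *ᶜ (fromℤ N *ᶜ 1ᴹ (e k) (e i)))
        ≈⟨ coefficient-combination e a (e k) ⟨
      coefficient (e k) (combination a (vectors ∘ e))
        ≈⟨ coefficient-cong (e k) comb≋𝟎 ⟩
      coefficient (e k) 𝟎
        ≈⟨ sum≈0 (λ b → ℂ.zeroʳ (fromℤ (L (e k) b))) ⟩
      0ᶜ ∎)
      where open ≈ᶜ-Reasoning

    vectors≉𝟎 : ∀ k → ¬ (vectors k ≋ 𝟎)
    -- Independence of the one-member family, applied to the coefficient 1.
    vectors≉𝟎 k Rk≋𝟎 = 1≉0 (vectors-independent {1} (λ _ → k) (λ {i} {j} _ → fin1 i j) (λ _ → 1ᶜ)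
      (λ i → ℂ.trans (ℂ.+-identityʳ _) (ℂ.trans (ℂ.*-identityˡ _) (Rk≋𝟎 i))) zero)
      where
      fin1 : (i j : Fin 1) → i ≡ j
      fin1 zero zero = refl

  -- Right eigenvectors supply members of the eigenspaces; left eigenvectors supply the coordinate
  -- functionals, which bound the eigenspaces from above.
  record Diagonalised (M : Mat n) (eigenvalue : Fin n → ℤ) : Set where
    field
      matrix      : Fin n → Fin n → ℤ
      matrix≈     : ∀ a → M a ≋ fromℤ ∘ matrix a
      R L         : Fin n → Fin n → ℤ
      dual        : Dual R L
      left-eigen  : ∀ k b → sumᶻ (λ a → L k a ℤ.* matrix a b) ≡ eigenvalue k ℤ.* L k b
      right-eigen : ∀ k a → sumᶻ (λ b → matrix a b ℤ.* R k b) ≡ eigenvalue k ℤ.* R k a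
    open Dual dual

    vectors∈eigenspace : ∀ k → vectors k ∈ Eigenspace M (fromℤ (eigenvalue k))
    vectors∈eigenspace k a = ℂ.trans
      (*ᵥ-cong {v = vectors k} matrix≈ ≋-refl a)
      (ℂ.trans (fromℤ-sum-* (matrix a) (R k))
        (ℂ.trans (ℂ.reflexive (cong fromℤ (right-eigen k a))) (fromℤ-* (eigenvalue k) (R k a))))

    coefficient-* : ∀ k v → coefficient k (M *ᵥ v) ≈ᶜ fromℤ (eigenvalue k) *ᶜ coefficient k v
    coefficient-* k v = begin
      coefficient k (M *ᵥ v)
        ≈⟨ coefficient-cong k (*ᵥ-cong matrix≈ (≋-refl {u = v})) ⟩
      coefficient k ((λ a b → fromℤ (matrix a b)) *ᵥ v)
        ≈⟨ *ᵥ-* (λ j a → fromℤ (L j a)) (λ a b → fromℤ (matrix a b)) v k ⟨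
      sum (λ b → sum (λ a → fromℤ (L k a) *ᶜ fromℤ (matrix a b)) *ᶜ v b)
        ≈⟨ Σᶜ.sum-cong-≋ (λ b → ℂ.*-congʳ (ℂ.trans
             (fromℤ-sum-* (L k) (λ a → matrix a b))
             (ℂ.trans (ℂ.reflexive (cong fromℤ (left-eigen k b)))
                       (fromℤ-* (eigenvalue k) (L k b))))) ⟩
      sum (λ b → (fromℤ (eigenvalue k) *ᶜ fromℤ (L k b)) *ᶜ v b)
        ≈⟨ *ᵥ-· (fromℤ (eigenvalue k)) (λ j a → fromℤ (L j a)) v k ⟩
      fromℤ (eigenvalue k) *ᶜ coefficient k v ∎
      where open ≈ᶜ-Reasoning

    -- Evaluating the k-th functional on M v in two ways, with L k a left eigenvector and v an
    -- eigenvector, gives (λₖ - θ) c = 0, and the nonzero factor cancels.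
    coefficient≈0 : ∀ {θ v} → v ∈ Eigenspace M θ → ∀ k → ¬ (fromℤ (eigenvalue k) ≈ᶜ θ) →
                    coefficient k v ≈ᶜ 0ᶜ
    coefficient≈0 {θ} {v} Mv≋θv k λk≉θ = ≉0-cancel {fromℤ (eigenvalue k) +ᶜ -ᶜ θ}
      (λk≉θ ∘ GroupProperties.x∙y⁻¹≈ε⇒x≈y ℂ.+-group _ _) (begin
        (fromℤ (eigenvalue k) +ᶜ -ᶜ θ) *ᶜ c
          ≈⟨ ℂ.distribʳ c (fromℤ (eigenvalue k)) (-ᶜ θ) ⟩
        fromℤ (eigenvalue k) *ᶜ c +ᶜ -ᶜ θ *ᶜ c
          ≈⟨ ℂ.+-congʳ (coefficient-* k v) ⟨
        coefficient k (M *ᵥ v) +ᶜ -ᶜ θ *ᶜ c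
          ≈⟨ ℂ.+-congʳ (coefficient-cong k Mv≋θv) ⟩
        coefficient k (θ · v) +ᶜ -ᶜ θ *ᶜ c
          ≈⟨ ℂ.+-cong (coefficient-· θ) (ℂ.sym (RingProperties.-‿distribˡ-* ℂ.ring θ c)) ⟩
        θ *ᶜ c +ᶜ -ᶜ (θ *ᶜ c)
          ≈⟨ ℂ.-‿inverseʳ (θ *ᶜ c) ⟩
        0ᶜ ∎)
      where
      open ≈ᶜ-Reasoning
      c : ℂ
      c = coefficient k v
      coefficient-· : ∀ θ → coefficient k (θ · v) ≈ᶜ θ *ᶜ c
      coefficient-· θ = ℂ.trans
        (Σᶜ.sum-cong-≋ λ b → ×ᶜ.x∙yz≈y∙xz (fromℤ (L k b)) θ (v b))
        (ℂ.sym (Σᶜ.*-distribˡ-sum θ (λ b → fromℤ (L k b) *ᶜ v b)))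

    -- The map e enumerates the indices with eigenvalue q. The covering hypothesis is phrased as a
    -- sum equal to 1 so that this sum can be inserted as a factor: it turns the expansion over all
    -- k into one over i, while terms with another eigenvalue vanish.
    eigenspace-dimension : ∀ {m} q (e : Fin m → Fin n) → (∀ {i j} → e i ≡ e j → i ≡ j) →
      (∀ i → eigenvalue (e i) ≡ q) →
      (∀ k → eigenvalue k ≡ q → sumᶻ (λ i → δᶻ (e i) k) ≡ 1ℤ) →
      HasDim (Eigenspace M (fromℤ q)) m
    eigenspace-dimension {m} q e e-injective e-eigenvalue e-covers =
      vectors ∘ e , (member , spans) , vectors-independent e e-injective
      where
      open ≈ᶜ-Reasoning
      member : ∀ i → vectors (e i) ∈ Eigenspace M (fromℤ q)
      member i = subst (λ t → vectors (e i) ∈ Eigenspace M (fromℤ t)) (e-eigenvalue i)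
                       (vectors∈eigenspace (e i))

      spans : ∀ v → v ∈ Eigenspace M (fromℤ q) → ∃ λ a → v ≋ combination a (vectors ∘ e)
      spans v Mv≋qv = (λ i → c (e i)) , λ a → begin
        v a
          ≈⟨ expansion v a ⟩
        sum (λ k → f a k)
          ≈⟨ Σᶜ.sum-cong-≋ (λ k → covered a k) ⟩
        sum (λ k → sum (λ i → 1ᴹ (e i) k *ᶜ f a k))
          ≈⟨ Σᶜ.∑-comm (λ k i → 1ᴹ (e i) k *ᶜ f a k) ⟩
        sum (λ i → sum (λ k → 1ᴹ (e i) k *ᶜ f a k))
          ≈⟨ Σᶜ.sum-cong-≋ (λ i → sum-δˡ (f a) (e i)) ⟩
        sum (λ i → f a (e i)) ∎
        where
        c : Fin n → ℂ
        c k = N⁻¹ *ᶜ coefficient k v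
        f : Fin n → Fin n → ℂ
        f a k = c k *ᶜ vectors k a
        covered-∈ : ∀ a k → eigenvalue k ≡ q → f a k ≈ᶜ sum (λ i → 1ᴹ (e i) k *ᶜ f a k)
        covered-∈ a k λk≡q = begin
          f a k            ≈⟨ ℂ.*-identityˡ (f a k) ⟨
          1ᶜ *ᶜ f a k      ≈⟨ ℂ.*-congʳ (ℂ.reflexive (cong fromℤ (e-covers k λk≡q))) ⟨
          fromℤ (sumᶻ (λ i → δᶻ (e i) k)) *ᶜ f a k
            ≈⟨ ℂ.*-congʳ (ℂ.trans (fromℤ-sum (λ i → δᶻ (e i) k))
                                    (Σᶜ.sum-cong-≋ λ i → fromℤ-δ (e i) k)) ⟩
          sum (λ i → 1ᴹ (e i) k) *ᶜ f a k
            ≈⟨ Σᶜ.*-distribʳ-sum (f a k) (λ i → 1ᴹ (e i) k) ⟩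
          sum (λ i → 1ᴹ (e i) k *ᶜ f a k) ∎
        covered-∉ : ∀ a k → eigenvalue k ≢ q → f a k ≈ᶜ sum (λ i → 1ᴹ (e i) k *ᶜ f a k)
        covered-∉ a k λk≢q = ℂ.trans f≈0
          (ℂ.sym (sum≈0 λ i → ℂ.trans (ℂ.*-congˡ f≈0) (ℂ.zeroʳ (1ᴹ (e i) k))))
          where
          f≈0 : f a k ≈ᶜ 0ᶜ
          f≈0 = ℂ.trans
            (ℂ.*-congʳ (ℂ.trans (ℂ.*-congˡ (coefficient≈0 {v = v} Mv≋qv k (λk≢q ∘ fromℤ-injective)))
                                  (ℂ.zeroʳ N⁻¹)))
            (ℂ.zeroˡ (vectors k a))
        covered : ∀ a k → f a k ≈ᶜ sum (λ i → 1ᴹ (e i) k *ᶜ f a k)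
        covered a k = [ covered-∈ a k , covered-∉ a k ]′ (toSum (eigenvalue k ℤ.≟ q))

    hasEigenvalues : ∀ (qs : List ℤ) → AllPairs _≢_ qs → (∀ k → eigenvalue k ∈ˡ qs) →
                     All (λ q → ∃ λ k → eigenvalue k ≡ q) qs →
                     HasEigenvalues M (List.map fromℤ qs)
    hasEigenvalues qs distinct sound complete θ = mk⇔ to (from complete)
      where
      -- A disjunction of stable statements need not be stable; one has to know which disjunct to
      -- prove. Cotransitivity against each later entry shows that θ differs either from the head q
      -- or from every later entry, and this selects the disjunct.
      Any-stable : ∀ qs → AllPairs _≢_ qs → ¬ ¬ Any (θ ≈ᶜ_) (List.map fromℤ qs) →
                   Any (θ ≈ᶜ_) (List.map fromℤ qs)
      Any-stable List.[] _ ¬¬any = contradiction (λ ()) ¬¬any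
      Any-stable (q List.∷ qs) (q≢qs AllPairs.∷ distinct) ¬¬any with separate qs q≢qs
        where
        separate : ∀ qs → All (q ≢_) qs →
                   ¬ (θ ≈ᶜ fromℤ q) ⊎ ¬ Any (θ ≈ᶜ_) (List.map fromℤ qs)
        separate List.[] All.[] = inj₂ λ ()
        separate (r List.∷ qs) (q≢r All.∷ q≢qs)
          with fromℤ-≉-cotransitive θ q≢r | separate qs q≢qs
        ... | inj₁ θ≉q | _         = inj₁ θ≉q
        ... | inj₂ θ≉r | inj₁ θ≉q  = inj₁ θ≉q
        ... | inj₂ θ≉r | inj₂ ¬any = inj₂ λ { (here θ≈r) → θ≉r θ≈r ; (there any) → ¬any any }
      ... | inj₁ θ≉q  = there (Any-stable qs distinct λ ¬any →
        ¬¬any λ { (here θ≈q) → θ≉q θ≈q ; (there any) → ¬any any })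
      ... | inj₂ ¬any = here (≈ᶜ-stable λ θ≉q →
        ¬¬any λ { (here θ≈q) → θ≉q θ≈q ; (there any) → ¬any any })

      to : Nonzero (Eigenspace M θ) → Any (θ ≈ᶜ_) (List.map fromℤ qs)
      -- If θ were none of the listed values, every coordinate of an eigenvector would vanish.
      to nonzero = Any-stable qs distinct λ ¬any → nonzero λ v Mv≋θv → ≋-trans (expansion v) λ a →
        sum≈0 λ k → ℂ.trans
          (ℂ.*-congʳ (ℂ.trans
            (ℂ.*-congˡ (coefficient≈0 {v = v} Mv≋θv k λ λk≈θ → ¬any (Any.map⁺
              (Any.map (λ λk≡q → ℂ.trans (ℂ.sym λk≈θ) (ℂ.reflexive (cong fromℤ λk≡q))) (sound k)))))
            (ℂ.zeroʳ N⁻¹)))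
          (ℂ.zeroˡ (vectors k a))

      from : ∀ {qs} → All (λ q → ∃ λ k → eigenvalue k ≡ q) qs →
             Any (θ ≈ᶜ_) (List.map fromℤ qs) → Nonzero (Eigenspace M θ)
      from ((k , refl) All.∷ _) (here θ≈λk) zero-only = vectors≉𝟎 k (zero-only (vectors k) λ a →
        ℂ.trans (vectors∈eigenspace k a) (ℂ.*-congʳ (ℂ.sym θ≈λk)))
      from (_ All.∷ complete) (there any) = from complete any

-- Enumerating finite subsets

does⇒ : ∀ {A : Set} (a? : Dec A) → does a? ≡ true → A
does⇒ (yes a) _ = a

private
  variable
    n m : ℕ

∣-∣-remove : ∀ {p : Subset n} {x} → x ∈ˢ p → ∣ p ∣ ≡ suc ∣ p - x ∣
∣-∣-remove {p = _ ∷ p} Vec.here = cong (λ q → suc ∣ q ∣) (sym (Subset.p─⊥≡p p))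
∣-∣-remove {p = true  ∷ p} (Vec.there x∈p) = cong suc (∣-∣-remove x∈p)
∣-∣-remove {p = false ∷ p} (Vec.there x∈p) = ∣-∣-remove x∈p

x∉p-x : ∀ {p : Subset n} {x} → x ∉ˢ (p - x)
x∉p-x {p = _ ∷ p} {suc x} (Vec.there x∈) = x∉p-x x∈

∷-injective : ∀ {A : Set} {a : A} {f : Fin m → A} → (∀ i → a ≢ f i) →
              Injective _≡_ _≡_ f → Injective _≡_ _≡_ (a ∷ᶠ f)
∷-injective a∉f f-inj {zero}  {zero}  _  = refl
∷-injective a∉f f-inj {zero}  {suc j} eq = contradiction eq (a∉f j)
∷-injective a∉f f-inj {suc i} {zero}  eq = contradiction (sym eq) (a∉f i)
∷-injective a∉f f-inj {suc i} {suc j} eq = cong suc (f-inj eq)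

abstract
  enumerate : ∀ m {p : Subset n} → ∣ p ∣ ≡ m →
              ∃ λ (f : Fin m → Fin n) → Injective _≡_ _≡_ f × (∀ i → f i ∈ˢ p)
  enumerate zero    _ = []ᶠ , (λ { {()} }) , λ ()
  enumerate {n} (suc m) {p} ∣p∣≡1+m with Subset.nonempty? p
  ... | no empty = contradiction
    (trans (sym (trans (cong ∣_∣ (Subset.Empty-unique empty)) (Subset.∣⊥∣≡0 n))) ∣p∣≡1+m) λ ()
  ... | yes (x , x∈p) with enumerate m (ℕ.suc-injective (trans (sym (∣-∣-remove x∈p)) ∣p∣≡1+m))
  ...   | f , f-inj , f∈ =
    x ∷ᶠ f ,
    ∷-injective (λ i x≡fi → x∉p-x (subst (_∈ˢ p - x) (sym x≡fi) (f∈ i))) f-inj ,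
    λ { zero → x∈p ; (suc i) → Subset.p─q⊆p p _ (f∈ i) }

abstract
  -- Induction on m: if x is not `f zero`, delete `f zero` from p; the remaining values of f lie in
  -- what is left, and so does x.
  exhausts : ∀ {p : Subset n} (f : Fin m → Fin n) → Injective _≡_ _≡_ f → (∀ i → f i ∈ˢ p) →
             ∣ p ∣ ≡ m → ∀ {x} → x ∈ˢ p → ∃ λ i → f i ≡ x
  exhausts {m = zero} f _ _ ∣p∣≡0 x∈p = contradiction (trans (sym (∣-∣-remove x∈p)) ∣p∣≡0) λ ()
  exhausts {m = suc m} f f-inj f∈ ∣p∣≡1+m {x} x∈p with x Fin.≟ f zero
  ... | yes x≡f0 = zero , sym x≡f0
  ... | no  x≢f0 with exhausts (f ∘ suc) (Fin.suc-injective ∘ f-inj)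
                        (λ i → Subset.x∈p∧x≢y⇒x∈p-y (f∈ (suc i))
                               λ eq → contradiction (f-inj eq) λ ())
                        (ℕ.suc-injective (trans (sym (∣-∣-remove (f∈ zero))) ∣p∣≡1+m))
                        (Subset.x∈p∧x≢y⇒x∈p-y x∈p x≢f0)
  ...   | i , eq = suc i , eq

abstract
  too-many : ∀ {p : Subset n} (f : Fin (suc m) → Fin n) → Injective _≡_ _≡_ f → (∀ i → f i ∈ˢ p) →
             ¬ (∣ p ∣ ≡ m)
  too-many f f-inj f∈ ∣p∣≡m
    with exhausts (f ∘ suc) (Fin.suc-injective ∘ f-inj) (f∈ ∘ suc) ∣p∣≡m (f∈ zero)
  ... | i , eq = contradiction (f-inj eq) λ ()

abstract
  injective⇒surjective : (f : Fin n → Fin n) → Injective _≡_ _≡_ f → ∀ y → ∃ λ x → f x ≡ y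
  injective⇒surjective {n} f f-inj y =
    exhausts {p = ⊤} f f-inj (λ _ → Subset.∈⊤) (Subset.∣⊤∣≡n n) Subset.∈⊤

-- Path-length distance

least-satisfies : ∀ {P : ℕ → Set} (P? : ∀ i → Dec (P i)) k → P k → P (least P? k)
least-satisfies P? zero    Pk = Pk
least-satisfies P? (suc k) Pk with P? zero
... | yes P0 = P0
... | no  _  = least-satisfies (P? ∘ suc) k Pk

least-minimal : ∀ {P : ℕ → Set} (P? : ∀ i → Dec (P i)) k → ∀ {i} → P i → least P? k ≤ i
least-minimal P? zero    Pi = z≤n
least-minimal P? (suc k) Pi with P? zero
... | yes _ = z≤n
least-minimal P? (suc k) {zero}  Pi | no ¬P0 = contradiction Pi ¬P0
least-minimal P? (suc k) {suc i} Pi | no _   = s≤s (least-minimal (P? ∘ suc) k Pi)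

module Distance {n} (Γ : Graph n) where
  open Graph Γ

  private
    dΓ : Fin n → Fin n → ℕ
    dΓ = d Γ

  shortest-walk : ∀ y z → Walk _~_ (dΓ y z) y z
  shortest-walk y z =
    least-satisfies (λ k → walk? _~_ _~?_ k y z) (proj₁ (connected y z)) (proj₂ (connected y z))

  d-minimal : ∀ {y z k} → Walk _~_ k y z → dΓ y z ≤ k
  d-minimal {y} {z} = least-minimal (λ k → walk? _~_ _~?_ k y z) (proj₁ (connected y z))

  walk-snoc : ∀ k {y z w} → Walk _~_ k y z → z ~ w → Walk _~_ (suc k) y w
  walk-snoc zero    refl        z~w = _ , z~w , refl
  walk-snoc (suc k) (v , y~v , walk) z~w = v , y~v , walk-snoc k walk z~w

  walk-reverse : ∀ k {y z} → Walk _~_ k y z → Walk _~_ k z y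
  walk-reverse zero    refl             = refl
  walk-reverse (suc k) (v , y~v , walk) = walk-snoc k (walk-reverse k walk) (~-sym y~v)

  d-sym : ∀ y z → dΓ y z ≡ dΓ z y
  d-sym y z = ℕ.≤-antisym (d-minimal (walk-reverse _ (shortest-walk z y)))
                          (d-minimal (walk-reverse _ (shortest-walk y z)))

  d-refl : ∀ y → dΓ y y ≡ 0
  d-refl y = ℕ.n≤0⇒n≡0 (d-minimal refl)

  d≡0⇒≡ : ∀ {y z} → dΓ y z ≡ 0 → y ≡ z
  d≡0⇒≡ {y} {z} d≡0 = subst (λ k → Walk _~_ k y z) d≡0 (shortest-walk y z)

  d≡1⇒~ : ∀ {y z} → dΓ y z ≡ 1 → y ~ z
  d≡1⇒~ {y} {z} d≡1 with subst (λ k → Walk _~_ k y z) d≡1 (shortest-walk y z)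
  ... | _ , y~w , refl = y~w

  ~⇒d≡1 : ∀ {y z} → y ~ z → dΓ y z ≡ 1
  ~⇒d≡1 {y} {z} y~z = ℕ.≤-antisym (d-minimal (z , y~z , refl))
    (ℕ.n≢0⇒n>0 λ d≡0 → ~-irrefl y (subst (y ~_) (sym (d≡0⇒≡ d≡0)) y~z))

  d≡2 : ∀ {y z w} → y ~ z → z ~ w → y ≢ w → ¬ (y ~ w) → dΓ y w ≡ 2
  d≡2 {y} {z} {w} y~z z~w y≢w y≁w with dΓ y w in eq | d-minimal (z , y~z , w , z~w , refl)
  ... | 0 | _ = contradiction (d≡0⇒≡ eq) y≢w
  ... | 1 | _ = contradiction (d≡1⇒~ eq) y≁w
  ... | 2 | _ = refl
  ... | suc (suc (suc _)) | s≤s (s≤s ())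

  ∈sphere : ∀ {i y z} → dΓ y z ≡ i → z ∈ˢ sphere Γ i y
  ∈sphere {i} {y} {z} d≡i = Vec.lookup⇒[]= z _
    (trans (Vec.lookup∘tabulate (λ w → does (dΓ y w ℕ.≟ i)) z) (dec-true (dΓ y z ℕ.≟ i) d≡i))

  ∈sphere⁻¹ : ∀ {i y z} → z ∈ˢ sphere Γ i y → dΓ y z ≡ i
  ∈sphere⁻¹ {i} {y} {z} z∈ = does⇒ (dΓ y z ℕ.≟ i)
    (trans (sym (Vec.lookup∘tabulate (λ w → does (dΓ y w ℕ.≟ i)) z)) (Vec.[]=⇒lookup z∈))
  ∈sphere∩ : ∀ {i j y z w} → dΓ y w ≡ i → dΓ z w ≡ j → w ∈ˢ (sphere Γ i y ∩ sphere Γ j z)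
  ∈sphere∩ p q = Subset.x∈p∩q⁺ (∈sphere p , ∈sphere q)

  ∈sphere∩⁻¹ : ∀ {i j y z w} → w ∈ˢ (sphere Γ i y ∩ sphere Γ j z) → dΓ y w ≡ i × dΓ z w ≡ j
  ∈sphere∩⁻¹ {i} {j} {y} {z} w∈ with Subset.x∈p∩q⁻ (sphere Γ i y) (sphere Γ j z) w∈
  ... | p , q = ∈sphere⁻¹ p , ∈sphere⁻¹ q

-- The vertices of the cube are labelled 0 (the base vertex), 1 + i and 4 + i (i < 3), and 7,
-- on levels 0, 1, 2 and 3; 1 + i is adjacent to 4 + j exactly when i ≠ j.

yᴸ zᴸ : Fin 3 → Fin 8
yᴸ = lookup (1F ∷ 2F ∷ 3F ∷ [])
zᴸ = lookup (4F ∷ 5F ∷ 6F ∷ [])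

neighbour : Fin 8 → Fin 3 → Fin 8
neighbour a i = lookup (lookup
  ( (1F ∷ 2F ∷ 3F ∷ [])
  ∷ (0F ∷ 5F ∷ 6F ∷ []) ∷ (0F ∷ 4F ∷ 6F ∷ []) ∷ (0F ∷ 4F ∷ 5F ∷ [])
  ∷ (7F ∷ 2F ∷ 3F ∷ []) ∷ (7F ∷ 1F ∷ 3F ∷ []) ∷ (7F ∷ 1F ∷ 2F ∷ [])
  ∷ (4F ∷ 5F ∷ 6F ∷ [])
  ∷ []) a) i

neighbour? : ∀ a b → Dec (∃ λ i → neighbour a i ≡ b)
neighbour? a b = Fin.any? λ i → neighbour a i Fin.≟ b

abstract
  neighbour-injective : ∀ a i j → neighbour a i ≡ neighbour a j → i ≡ j
  neighbour-injective = from-yes (Fin.all? λ a → Fin.all? λ i → Fin.all? λ j →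
    (neighbour a i Fin.≟ neighbour a j) →-dec (i Fin.≟ j))

level : Fin 8 → ℕ
level = lookup (0 ∷ 1 ∷ 1 ∷ 1 ∷ 2 ∷ 2 ∷ 2 ∷ 3 ∷ [])

-- An isomorphism with the cube that sends x to label 0 and respects the given order of its
-- neighbours; together with the diameter it is all that later arguments know of Γ. Adjacency is an
-- equality of Booleans so that it rewrites the entries of A.
record CubeLabelling (Γ : Graph 8) (x : Fin 8) (y : Fin 3 → Fin 8) : Set where
  open Graph Γ
  field
    vertex       : Fin 8 → Fin 8
    label        : Fin 8 → Fin 8
    vertex-label : ∀ v → vertex (label v) ≡ v
    label-vertex : ∀ a → label (vertex a) ≡ a
    vertex-~     : ∀ a b → does (vertex a ~? vertex b) ≡ does (neighbour? a b)
    vertex-d     : ∀ a → d Γ x (vertex a) ≡ level a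
    vertex-y     : ∀ i → vertex (yᴸ i) ≡ y i

-- The intersection array forces the cube

module _ (Γ : Graph 8) (dr : DistanceRegular Γ)
         (ia : HasIntersectionArray Γ dr (3 ∷ 2 ∷ 1 ∷ []) (1 ∷ 2 ∷ 3 ∷ [])) where
  open Graph Γ
  open DistanceRegular dr
  open Distance Γ

  private
    dΓ : Fin 8 → Fin 8 → ℕ
    dΓ = d Γ
    S : ℕ → Fin 8 → Subset 8
    S = sphere Γ

    ≤D : ∀ {i} → i ≤ 3 → i ≤ diameter Γ
    ≤D = subst (_ ≤_) (sym (proj₁ ia))

    number : ∀ {h i j} → h ≤ 3 → i ≤ 3 → j ≤ 3 → ∀ {k} → k ≡ p h i j →
             ∀ {y z} → dΓ y z ≡ h → ∣ S i y ∩ S j z ∣ ≡ k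
    number h≤3 i≤3 j≤3 k≡p d≡h = trans (regular (≤D h≤3) (≤D i≤3) (≤D j≤3) _ _ d≡h) (sym k≡p)

    ≤3 : ∀ (i : Fin 4) → Fin.toℕ i ≤ 3
    ≤3 = Fin.toℕ≤pred[n]

  degree : ∀ y → ∣ S 1 y ∣ ≡ 3
  degree y = trans (cong ∣_∣ (sym (Subset.∩-idem (S 1 y))))
                   (number (≤3 0F) (≤3 1F) (≤3 1F) (proj₁ (proj₂ ia) 0F) (d-refl y))

  b₁ : ∀ {y z} → dΓ y z ≡ 1 → ∣ S 1 y ∩ S 2 z ∣ ≡ 2
  b₁ = number (≤3 1F) (≤3 1F) (≤3 2F) (proj₁ (proj₂ ia) 1F)

  b₂ : ∀ {y z} → dΓ y z ≡ 2 → ∣ S 1 y ∩ S 3 z ∣ ≡ 1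
  b₂ = number (≤3 2F) (≤3 1F) (≤3 3F) (proj₁ (proj₂ ia) 2F)

  c₂ : ∀ {y z} → dΓ y z ≡ 2 → ∣ S 1 y ∩ S 1 z ∣ ≡ 2
  c₂ = number (≤3 2F) (≤3 1F) (≤3 1F) (proj₂ (proj₂ ia) 1F)

  -- This is a₁ = b₀ - b₁ - c₁ = 3 - 2 - 1 = 0. In a triangle, y would have the neighbours x and z,
  -- at distances 0 and 1 from x, besides its b₁ = 2 neighbours at distance 2 from x: four in all,
  -- against degree 3.
  triangle-free : ∀ {x y z} → x ~ y → y ~ z → ¬ (x ~ z)
  triangle-free {x} {y} {z} x~y y~z x~z with enumerate 2 (b₁ (trans (d-sym y x) (~⇒d≡1 x~y)))
  ... | u , u-inj , u∈ = too-many (x ∷ᶠ z ∷ᶠ u)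
    (∷-injective {f = z ∷ᶠ u}
      (λ { zero refl → ~-irrefl x x~z
         ; (suc i) refl → distinct (trans (sym (d-refl x)) (proj₂ (∈sphere∩⁻¹ (u∈ i)))) λ () })
      (∷-injective
        (λ { i refl → distinct (trans (sym (~⇒d≡1 x~z)) (proj₂ (∈sphere∩⁻¹ (u∈ i)))) λ () })
        u-inj))
    (λ { zero → ∈sphere (~⇒d≡1 (~-sym x~y)) ; (suc zero) → ∈sphere (~⇒d≡1 y~z)
       ; (suc (suc i)) → ∈sphere (proj₁ (∈sphere∩⁻¹ (u∈ i))) })
    (degree y)
    where
    distinct : ∀ {a b : ℕ} {C : Set} → a ≡ b → a ≢ b → C
    distinct eq neq = contradiction eq neq

  neighbours : ∀ x → ∃ λ (y : Fin 3 → Fin 8) → Injective _≡_ _≡_ y × (∀ i → dΓ x (y i) ≡ 1)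
  neighbours x with enumerate 3 (degree x)
  ... | y , y-inj , y∈ = y , y-inj , λ i → ∈sphere⁻¹ (y∈ i)

  module _ (x : Fin 8) (y : Fin 3 → Fin 8) (y-inj : Injective _≡_ _≡_ y)
           (d-y : ∀ i → dΓ x (y i) ≡ 1) where

    private
      o₁ o₂ : Fin 3 → Fin 3
      o₁ = lookup (1F ∷ 0F ∷ 0F ∷ [])
      o₂ = lookup (2F ∷ 2F ∷ 1F ∷ [])

      abstract
        o₁≢o₂ : ∀ i → o₁ i ≢ o₂ i
        o₁≢o₂ = from-yes (Fin.all? λ i → ¬? (o₁ i Fin.≟ o₂ i))

      abstract
        others : ∀ i j → j ≢ i → j ≡ o₁ i ⊎ j ≡ o₂ i
        others = from-yes (Fin.all? λ i → Fin.all? λ j →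
          ¬? (j Fin.≟ i) →-dec ((j Fin.≟ o₁ i) ⊎-dec (j Fin.≟ o₂ i)))

      x~y : ∀ i → x ~ y i
      x~y i = d≡1⇒~ (d-y i)

      -- As c₂ = 2, y j and y k have exactly one common neighbour besides x.
      abstract
        opposite : ∀ j k → j ≢ k → ∃ λ z → z ≢ x × y j ~ z × y k ~ z
        opposite j k j≢k with enumerate 2 (c₂ (d≡2 (~-sym (x~y j)) (x~y k) (j≢k ∘ y-inj)
                                λ yj~yk → triangle-free (x~y j) yj~yk (x~y k)))
        ... | u , u-inj , u∈ with u 0F Fin.≟ x
        ...   | no  u0≢x = u 0F , u0≢x , d≡1⇒~ (proj₁ (∈sphere∩⁻¹ (u∈ 0F))) ,
                           d≡1⇒~ (proj₂ (∈sphere∩⁻¹ (u∈ 0F)))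
        ...   | yes u0≡x = u 1F , (λ u1≡x → contradiction (u-inj (trans u0≡x (sym u1≡x))) λ ()) ,
                           d≡1⇒~ (proj₁ (∈sphere∩⁻¹ (u∈ 1F))) , d≡1⇒~ (proj₂ (∈sphere∩⁻¹ (u∈ 1F)))

      z : Fin 3 → Fin 8
      z i = proj₁ (opposite (o₁ i) (o₂ i) (o₁≢o₂ i))

      y~z : ∀ i j → j ≢ i → y j ~ z i
      y~z i j j≢i with others i j j≢i
      ... | inj₁ refl = proj₁ (proj₂ (proj₂ (opposite (o₁ i) (o₂ i) (o₁≢o₂ i))))
      ... | inj₂ refl = proj₂ (proj₂ (proj₂ (opposite (o₁ i) (o₂ i) (o₁≢o₂ i))))

      d-z : ∀ i → dΓ x (z i) ≡ 2
      d-z i = d≡2 (x~y (o₁ i)) y~zi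
        (proj₁ (proj₂ (opposite (o₁ i) (o₂ i) (o₁≢o₂ i))) ∘ sym)
        (triangle-free (x~y (o₁ i)) y~zi)
        where
        y~zi : y (o₁ i) ~ z i
        y~zi = proj₁ (proj₂ (proj₂ (opposite (o₁ i) (o₂ i) (o₁≢o₂ i))))

      -- If two of them coincided, all three `y k` would be common neighbours of x and `z i`,
      -- against c₂ = 2.
      z-inj : Injective _≡_ _≡_ z
      z-inj {i} {j} zi≡zj with i Fin.≟ j
      ... | yes i≡j = i≡j
      ... | no  i≢j = contradiction (c₂ (d-z i))
        (too-many y y-inj λ k → ∈sphere∩ (d-y k) (trans (d-sym (z i) (y k)) (~⇒d≡1 (all~ k))))
        where
        all~ : ∀ k → y k ~ z i
        all~ k with k Fin.≟ i
        ... | no  k≢i  = y~z i k k≢i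
        ... | yes refl = subst (y k ~_) (sym zi≡zj) (y~z j k i≢j)

      abstract
        antipode : ∀ i → ∃ λ w → z i ~ w × dΓ x w ≡ 3
        antipode i =
          let u , _ , u∈ = enumerate 1 (b₂ (trans (d-sym (z i) x) (d-z i)))
          in u 0F , d≡1⇒~ (proj₁ (∈sphere∩⁻¹ (u∈ 0F))) , proj₂ (∈sphere∩⁻¹ (u∈ 0F))

      P : Fin 8 → Fin 8
      P = lookup (x ∷ y 0F ∷ y 1F ∷ y 2F ∷ z 0F ∷ z 1F ∷ z 2F ∷ proj₁ (antipode 0F) ∷ [])

      d-P : ∀ a → dΓ x (P a) ≡ level a
      d-P 0F = d-refl x
      d-P 1F = d-y 0F
      d-P 2F = d-y 1F
      d-P 3F = d-y 2F
      d-P 4F = d-z 0F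
      d-P 5F = d-z 1F
      d-P 6F = d-z 2F
      d-P 7F = proj₂ (proj₂ (antipode 0F))

      P-y : ∀ i → P (yᴸ i) ≡ y i
      P-y 0F = refl
      P-y 1F = refl
      P-y 2F = refl

      P-z : ∀ i → P (zᴸ i) ≡ z i
      P-z 0F = refl
      P-z 1F = refl
      P-z 2F = refl

      abstract
        same-level : ∀ a b → level a ≡ level b →
                     a ≡ b ⊎ (∃ λ i → ∃ λ j → a ≡ yᴸ i × b ≡ yᴸ j) ⊎
                     (∃ λ i → ∃ λ j → a ≡ zᴸ i × b ≡ zᴸ j)
        same-level = from-yes (Fin.all? λ a → Fin.all? λ b → (level a ℕ.≟ level b) →-dec
          ((a Fin.≟ b) ⊎-dec
           (Fin.any? λ i → Fin.any? λ j → (a Fin.≟ yᴸ i) ×-dec (b Fin.≟ yᴸ j)) ⊎-dec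
           (Fin.any? λ i → Fin.any? λ j → (a Fin.≟ zᴸ i) ×-dec (b Fin.≟ zᴸ j))))

      P-inj : Injective _≡_ _≡_ P
      P-inj {a} {b} Pa≡Pb
        with same-level a b (trans (sym (d-P a)) (trans (cong (dΓ x) Pa≡Pb) (d-P b)))
      ... | inj₁ a≡b = a≡b
      ... | inj₂ (inj₁ (i , j , refl , refl)) =
        cong yᴸ (y-inj {i} {j} (trans (sym (P-y i)) (trans Pa≡Pb (P-y j))))
      ... | inj₂ (inj₂ (i , j , refl , refl)) =
        cong zᴸ (z-inj {i} {j} (trans (sym (P-z i)) (trans Pa≡Pb (P-z j))))

      P-surj : ∀ v → ∃ λ a → P a ≡ v
      P-surj = injective⇒surjective P P-inj

      abstract
        level-3 : ∀ a → level a ≡ 3 → a ≡ 7F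
        level-3 = from-yes (Fin.all? λ a → (level a ℕ.≟ 3) →-dec (a Fin.≟ 7F))

      -- Since b₂ = 1, every `z i` has a neighbour at distance 3 from x. `P` already reaches all
      -- eight vertices and only label 7 has level 3, so that neighbour is the same for all i.
      z~w : ∀ i → z i ~ P 7F
      z~w i with antipode i
      ... | w , zi~w , d-w with P-surj w
      ...   | a , refl with level-3 a (trans (sym (d-P a)) d-w)
      ...     | refl = zi~w

      edge : ∀ a i → P a ~ P (neighbour a i)
      edge 0F 0F = x~y 0F
      edge 0F 1F = x~y 1F
      edge 0F 2F = x~y 2F
      edge 1F 0F = ~-sym (x~y 0F)
      edge 1F 1F = y~z 1F 0F λ ()
      edge 1F 2F = y~z 2F 0F λ ()
      edge 2F 0F = ~-sym (x~y 1F)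
      edge 2F 1F = y~z 0F 1F λ ()
      edge 2F 2F = y~z 2F 1F λ ()
      edge 3F 0F = ~-sym (x~y 2F)
      edge 3F 1F = y~z 0F 2F λ ()
      edge 3F 2F = y~z 1F 2F λ ()
      edge 4F 0F = z~w 0F
      edge 4F 1F = ~-sym (y~z 0F 1F λ ())
      edge 4F 2F = ~-sym (y~z 0F 2F λ ())
      edge 5F 0F = z~w 1F
      edge 5F 1F = ~-sym (y~z 1F 0F λ ())
      edge 5F 2F = ~-sym (y~z 1F 2F λ ())
      edge 6F 0F = z~w 2F
      edge 6F 1F = ~-sym (y~z 2F 0F λ ())
      edge 6F 2F = ~-sym (y~z 2F 1F λ ())
      edge 7F 0F = ~-sym (z~w 0F)
      edge 7F 1F = ~-sym (z~w 1F)
      edge 7F 2F = ~-sym (z~w 2F)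

      P-~ : ∀ a b (neighbour?ab : Dec (∃ λ i → neighbour a i ≡ b)) →
            does (P a ~? P b) ≡ does neighbour?ab
      P-~ a _ (yes (i , refl)) = dec-true (P a ~? P (neighbour a i)) (edge a i)
      -- The three known neighbours of `P a` exhaust its sphere of radius 1, so there is no room for
      -- another edge.
      P-~ a b (no ¬neighbour) = dec-false (P a ~? P b) λ Pa~Pb →
        let i , eq = exhausts (P ∘ neighbour a) (λ {i} {j} → neighbour-injective a i j ∘ P-inj)
                       (λ i → ∈sphere (~⇒d≡1 (edge a i))) (degree (P a)) (∈sphere (~⇒d≡1 Pa~Pb))
        in ¬neighbour (i , P-inj eq)

    cubeLabelling : CubeLabelling Γ x y
    cubeLabelling = record
      { vertex       = P
      ; label        = λ v → proj₁ (P-surj v)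
      ; vertex-label = λ v → proj₂ (P-surj v)
      ; label-vertex = λ a → P-inj (proj₂ (P-surj (P a)))
      ; vertex-~     = λ a b → P-~ a b (neighbour? a b)
      ; vertex-d     = d-P
      ; vertex-y     = P-y
      }

-- Hermitian inner product

conj-cong : ∀ {z w} → z ≈ᶜ w → conj z ≈ᶜ conj w
conj-cong (p , q) = p , ℝ-ring.-‿cong q

conj-+ : ∀ z w → conj (z +ᶜ w) ≈ᶜ conj z +ᶜ conj w
conj-+ (a , b) (c , d) = ℝ-ring.refl ,
  pointwise λ n → solveℚ 2 (λ b d → :- (b :+ d) := :- b :+ :- d) refl (seq b n) (seq d n)

conj-* : ∀ z w → conj (z *ᶜ w) ≈ᶜ conj z *ᶜ conj w
conj-* (a , b) (c , d) =
  (pointwise λ n → solveℚ 4 (λ a b c d →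
    a :* c :+ :- (b :* d) := a :* c :+ :- ((:- b) :* (:- d))) refl
    (seq a n) (seq b n) (seq c n) (seq d n)) ,
  (pointwise λ n → solveℚ 4 (λ a b c d →
    :- (a :* d :+ b :* c) := a :* (:- d) :+ (:- b) :* c) refl
    (seq a n) (seq b n) (seq c n) (seq d n))

conj-fromℤ : ∀ z → conj (fromℤ z) ≈ᶜ fromℤ z
conj-fromℤ z = ℝ-ring.refl , pointwise λ _ → refl

conj-sum : ∀ {n} (f : Fin n → ℂ) → conj (sum f) ≈ᶜ sum (conj ∘ f)
conj-sum {zero}  f = conj-fromℤ (ℤ.+ 0)
conj-sum {ℕ.suc n} f = ℂ.trans (conj-+ (f zero) (sum (f ∘ suc))) (ℂ.+-congˡ (conj-sum (f ∘ suc)))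

⟨⟩-cong : ∀ {n} {u u′ v v′ : Fin n → ℂ} → u ≋ u′ → v ≋ v′ → ⟨ u , v ⟩ ≈ᶜ ⟨ u′ , v′ ⟩
⟨⟩-cong u≋ v≋ = Σᶜ.sum-cong-≋ λ i → ℂ.*-cong (u≋ i) (conj-cong (v≋ i))

⟨⟩-sym : ∀ {n} (u v : Fin n → ℂ) → ⟨ u , v ⟩ ≈ᶜ conj (⟨ v , u ⟩)
⟨⟩-sym u v = ℂ.sym (ℂ.trans (conj-sum (λ i → v i *ᶜ conj (u i))) (Σᶜ.sum-cong-≋ λ i →
  ℂ.trans (conj-* (v i) (conj (u i)))
    (ℂ.trans (ℂ.*-congˡ (conj-conj (u i))) (ℂ.*-comm (conj (v i)) (u i)))))
  where
  conj-conj : ∀ z → conj (conj z) ≈ᶜ z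
  conj-conj (a , b) = ℝ-ring.refl , pointwise λ n → solveℚ 1 (λ b → :- :- b := b) refl (seq b n)

span-orthogonal : ∀ {n m} (u : Fin m → Fin n → ℂ) w → (∀ k → ⟨ u k , w ⟩ ≈ᶜ 0ᶜ) →
                  ∀ {v} → v ∈ span u → ⟨ v , w ⟩ ≈ᶜ 0ᶜ
span-orthogonal {n} {m} u w u⊥w {v} (a , v≋) = begin
  sum (λ y → v y *ᶜ conj (w y))
    ≈⟨ Σᶜ.sum-cong-≋ (λ y → ℂ.trans (ℂ.*-congʳ (v≋ y))
         (ℂ.*-comm (combination a u y) (conj (w y)))) ⟩
  sum (λ y → conj (w y) *ᶜ combination a u y)
    ≈⟨ functional w a ⟩
  sum (λ k → a k *ᶜ sum (λ y → conj (w y) *ᶜ u k y))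
    ≈⟨ sum≈0 (λ k → ℂ.trans
         (ℂ.*-congˡ (ℂ.trans (Σᶜ.sum-cong-≋ λ y → ℂ.*-comm (conj (w y)) (u k y)) (u⊥w k)))
         (ℂ.zeroʳ (a k))) ⟩
  0ᶜ ∎
  where
  open ≈ᶜ-Reasoning
  functional : ∀ w a → sum (λ y → conj (w y) *ᶜ combination a u y) ≈ᶜ
                       sum (λ k → a k *ᶜ sum (λ y → conj (w y) *ᶜ u k y))
  functional w a = ℂ.trans
    (Σᶜ.sum-cong-≋ λ y → Σᶜ.*-distribˡ-sum (conj (w y)) (λ k → a k *ᶜ u k y))
    (ℂ.trans (Σᶜ.∑-comm λ y k → conj (w y) *ᶜ (a k *ᶜ u k y))
      (Σᶜ.sum-cong-≋ λ k → ℂ.trans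
        (Σᶜ.sum-cong-≋ λ y → ×ᶜ.x∙yz≈y∙xz (conj (w y)) (a k) (u k y))
        (ℂ.sym (Σᶜ.*-distribˡ-sum (a k) (λ y → conj (w y) *ᶜ u k y)))))

-- Linearity in the first argument is applied twice; conjugate symmetry exchanges the arguments in
-- between.
spans-orthogonal : ∀ {n l m} (u : Fin l → Fin n → ℂ) (u′ : Fin m → Fin n → ℂ) →
                   (∀ j k → ⟨ u j , u′ k ⟩ ≈ᶜ 0ᶜ) →
                   ∀ {v w} → v ∈ span u → w ∈ span u′ → ⟨ v , w ⟩ ≈ᶜ 0ᶜ
spans-orthogonal u u′ u⊥u′ {v} {w} v∈ w∈ = span-orthogonal u w (λ j →
  ℂ.trans (⟨⟩-sym (u j) w) (conj≈0 (span-orthogonal u′ (u j) (λ k →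
    ℂ.trans (⟨⟩-sym (u′ k) (u j)) (conj≈0 (u⊥u′ j k))) w∈))) v∈
  where
  conj≈0 : ∀ {z} → z ≈ᶜ 0ᶜ → conj z ≈ᶜ 0ᶜ
  conj≈0 z≈0 = ℂ.trans (conj-cong z≈0) (conj-fromℤ (ℤ.+ 0))

-- Modules with a basis of pure vectors, one on each level r, …, r + m

module ThinModules {n : ℕ} (Γ : Graph n) (x : Fin n) where
  open Terwilliger Γ x

  e*-on : ∀ {i y} → d Γ x y ≡ i → e* i y ≈ᶜ 1ᶜ
  e*-on {i} {y} d≡i =
    ℂ.reflexive (cong (λ b → if b then 1ᶜ else 0ᶜ) (dec-true (d Γ x y ℕ.≟ i) d≡i))

  e*-off : ∀ {i y} → d Γ x y ≢ i → e* i y ≈ᶜ 0ᶜ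
  e*-off {i} {y} d≢i =
    ℂ.reflexive (cong (λ b → if b then 1ᶜ else 0ᶜ) (dec-false (d Γ x y ℕ.≟ i) d≢i))

  E*-entry : ∀ i y z → E* i y z ≈ᶜ e* i y *ᶜ 1ᴹ y z
  E*-entry i y z = entry (y Fin.≟ z)
    where
    entry : ∀ {A : Set} (A? : Dec A) →
            (if does A? then e* i y else 0ᶜ) ≈ᶜ e* i y *ᶜ (if does A? then 1ᶜ else 0ᶜ)
    entry (yes _) = ℂ.sym (ℂ.*-identityʳ (e* i y))
    entry (no  _) = ℂ.sym (ℂ.zeroʳ (e* i y))

  E*-*ᵥ : ∀ i v y → (E* i *ᵥ v) y ≈ᶜ e* i y *ᶜ v y
  E*-*ᵥ i v y = begin
    sum (λ z → E* i y z *ᶜ v z)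
      ≈⟨ Σᶜ.sum-cong-≋ (λ z → ℂ.trans (ℂ.*-congʳ (E*-entry i y z))
                                       (ℂ.*-assoc (e* i y) (1ᴹ y z) (v z))) ⟩
    sum (λ z → e* i y *ᶜ (1ᴹ y z *ᶜ v z))   ≈⟨ Σᶜ.*-distribˡ-sum (e* i y) (λ z → 1ᴹ y z *ᶜ v z) ⟨
    e* i y *ᶜ sum (λ z → 1ᴹ y z *ᶜ v z)     ≈⟨ ℂ.*-congˡ (sum-δˡ v y) ⟩
    e* i y *ᶜ v y ∎
    where open ≈ᶜ-Reasoning

  E*-on : ∀ {i y} v → d Γ x y ≡ i → (E* i *ᵥ v) y ≈ᶜ v y
  E*-on {i} {y} v d≡i = ℂ.trans (E*-*ᵥ i v y)
    (ℂ.trans (ℂ.*-congʳ (e*-on d≡i)) (ℂ.*-identityˡ (v y)))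

  E*-off : ∀ {i y} v → d Γ x y ≢ i → (E* i *ᵥ v) y ≈ᶜ 0ᶜ
  E*-off {i} {y} v d≢i = ℂ.trans (E*-*ᵥ i v y)
    (ℂ.trans (ℂ.*-congʳ (e*-off d≢i)) (ℂ.zeroˡ (v y)))

  SupportedOn : V → ℕ → Set
  SupportedOn v i = ∀ y → d Γ x y ≢ i → v y ≈ᶜ 0ᶜ

  E*-fixes : ∀ {i v} → SupportedOn v i → E* i *ᵥ v ≋ v
  E*-fixes {i} {v} supp y =
    [ E*-on v , (λ d≢i → ℂ.trans (E*-off v d≢i) (ℂ.sym (supp y d≢i))) ]′ (toSum (d Γ x y ℕ.≟ i))

  E*-kills : ∀ {i j v} → SupportedOn v j → i ≢ j → E* i *ᵥ v ≋ 𝟎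
  E*-kills {i} {j} {v} supp i≢j y =
    [ (λ d≡i → ℂ.trans (E*-on v d≡i) (supp y λ d≡j → i≢j (trans (sym d≡i) d≡j))) , E*-off v ]′
    (toSum (d Γ x y ℕ.≟ i))

  -- The matrix by which an element of T acts on every thin basis with parameters r and 𝔹.
  rep : ∀ {m} (r : ℕ) (𝔹 : Mat (ℕ.suc m)) {M} → M ∈ T → Mat (ℕ.suc m)
  rep r 𝔹 A∈          = 𝔹
  -- `E* i` fixes the basis vector on level i, if there is one, and kills the others: a diagonal
  -- idempotent.
  rep r 𝔹 (E*∈ {i} _) j k = if does (r ℕ.+ toℕ j ℕ.≟ i) then 1ᴹ j k else 0ᶜ
  rep r 𝔹 1∈          = 1ᴹ
  rep r 𝔹 (+∈ p q)    = rep r 𝔹 p +ᴹ rep r 𝔹 q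
  rep r 𝔹 (*∈ p q)    = rep r 𝔹 p *ᴹ rep r 𝔹 q
  rep r 𝔹 (·∈ a p) j  = a · rep r 𝔹 p j
  rep r 𝔹 (resp _ p)  = rep r 𝔹 p

  -- `nonvanishing` gives a vertex with an invertible entry instead of a mere negation. Only `u k`
  -- contributes at a vertex of level r + k, so the k-th coordinate of an element is read off there
  -- by one division.
  record ThinBasis (r : ℕ) {m : ℕ} (𝔹 : Mat (ℕ.suc m)) : Set where
    field
      u          : Fin (ℕ.suc m) → V
      supported  : ∀ k → SupportedOn (u k) (r ℕ.+ toℕ k)
      nonvanishing : ∀ k → ∃ λ y → d Γ x y ≡ r ℕ.+ toℕ k × Invertible (u k y)
      action     : ∀ k → A *ᵥ u k ≋ combination (λ j → 𝔹 j k) u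

    rep-correct : ∀ {M} (p : M ∈ T) a → M *ᵥ combination a u ≋ combination (rep r 𝔹 p *ᵥ a) u
    rep-correct A∈ a =
      ≋-trans (*ᵥ-combination A a u)
        (≋-trans (combination-cong {a = a} ≋-refl action) (combination-combination a 𝔹 u))
    rep-correct (E*∈ {i} _) a = ≋-trans (*ᵥ-combination (E* i) a u) λ y →
      Σᶜ.sum-cong-≋ λ k → term y k (r ℕ.+ toℕ k ℕ.≟ i)
      where
      term : ∀ y k (r+k≟i : Dec (r ℕ.+ toℕ k ≡ i)) →
             a k *ᶜ (E* i *ᵥ u k) y ≈ᶜ
             sum (λ j → (if does r+k≟i then 1ᴹ k j else 0ᶜ) *ᶜ a j) *ᶜ u k y
      term y k (yes refl) = ℂ.*-cong (ℂ.sym (sum-δˡ a k)) (E*-fixes {v = u k} (supported k) y)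
      term y k (no r+k≢i) = ℂ.trans
        (ℂ.trans (ℂ.*-congˡ (E*-kills {v = u k} (supported k) (r+k≢i ∘ sym) y)) (ℂ.zeroʳ (a k)))
        (ℂ.sym (ℂ.trans (ℂ.*-congʳ (sum≈0 λ j → ℂ.zeroˡ (a j))) (ℂ.zeroˡ (u k y))))
    rep-correct 1∈ a =
      ≋-trans (1ᴹ-*ᵥ (combination a u))
        (combination-congˡ u (≋-sym (1ᴹ-*ᵥ a)))
    rep-correct (+∈ {M} {N} p q) a = ≋-trans (*ᵥ-+ M N (combination a u))
      (≋-trans (λ y → ℂ.+-cong (rep-correct p a y) (rep-correct q a y))
        (≋-trans (≋-sym (combination-+ (rep r 𝔹 p *ᵥ a) (rep r 𝔹 q *ᵥ a) u))
          (combination-congˡ u (≋-sym (*ᵥ-+ (rep r 𝔹 p) (rep r 𝔹 q) a)))))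
    rep-correct (*∈ {M} {N} p q) a = ≋-trans (*ᵥ-* M N (combination a u))
      (≋-trans (*ᵥ-congˡ M (rep-correct q a))
        (≋-trans (rep-correct p (rep r 𝔹 q *ᵥ a))
          (combination-congˡ u (≋-sym (*ᵥ-* (rep r 𝔹 p) (rep r 𝔹 q) a)))))
    rep-correct (·∈ c {M} p) a = ≋-trans (*ᵥ-· c M (combination a u))
      (≋-trans (λ y → ℂ.*-congˡ (rep-correct p a y))
        (≋-trans (≋-sym (combination-· c (rep r 𝔹 p *ᵥ a) u))
          (combination-congˡ u (≋-sym (*ᵥ-· c (rep r 𝔹 p) a)))))
    rep-correct (resp {M} {N} M≋N p) a =
      ≋-trans (*ᵥ-cong (λ y → ≋-sym (M≋N y)) (≋-refl {u = combination a u})) (rep-correct p a)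

    toModule : TModule
    toModule = record
      { Carrier    = span u
      ; isSubspace = span-isSubspace u
      ; invariant  = λ {B} p (a , v≋) → rep r 𝔹 p *ᵥ a , ≋-trans (*ᵥ-congˡ B v≋) (rep-correct p a)
      }

    combination-at : ∀ a k y → d Γ x y ≡ r ℕ.+ toℕ k → combination a u y ≈ᶜ a k *ᶜ u k y
    combination-at a k y d≡ = sum-single k λ j j≢k → ℂ.trans
      (ℂ.*-congˡ (supported j y λ d≡′ → j≢k
        (Fin.toℕ-injective (ℕ.+-cancelˡ-≡ r (toℕ j) (toℕ k) (trans (sym d≡′) d≡)))))
      (ℂ.zeroʳ (a j))

    coordinates-unique : ∀ a b → combination a u ≋ combination b u → a ≋ b
    coordinates-unique a b eq k =
      let y , d≡ , w , w*u≈1 = nonvanishing k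
          recover : ∀ c → c ≈ᶜ (c *ᶜ u k y) *ᶜ w
          recover c = ℂ.sym (ℂ.trans (ℂ.*-assoc c (u k y) w)
            (ℂ.trans (ℂ.*-congˡ (ℂ.trans (ℂ.*-comm (u k y) w) w*u≈1)) (ℂ.*-identityʳ c)))
      in ℂ.trans (recover (a k)) (ℂ.trans
           (ℂ.*-congʳ (ℂ.trans (ℂ.sym (combination-at a k y d≡))
             (ℂ.trans (eq y) (combination-at b k y d≡))))
           (ℂ.sym (recover (b k))))

    u≉𝟎 : ∀ k → ¬ (u k ≋ 𝟎)
    u≉𝟎 k u≋𝟎 = let y , _ , inv = nonvanishing k in invertible⇒≉0 inv (u≋𝟎 y)

    isBasis : IsBasis (span u) u
    isBasis = (generator∈span u , λ v v∈ → v∈) ,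
              λ a comb≋𝟎 → coordinates-unique a 𝟎 (≋-trans comb≋𝟎 (≋-sym (combination-𝟎 u)))

    isPureBasis : IsPureBasis toModule u
    isPureBasis = isBasis , (λ k → r ℕ.+ toℕ k) ,
      (λ k → u≉𝟎 k , u k , _ , ≋-sym (E*-fixes {v = u k} (supported k))) , ℕ.+-monoʳ-≤ r

    layer : ∀ a k → E* (r ℕ.+ toℕ k) *ᵥ combination a u ≋ a k · u k
    layer a k y = [ on , off ]′ (toSum (d Γ x y ℕ.≟ r ℕ.+ toℕ k))
      where
      on : d Γ x y ≡ r ℕ.+ toℕ k → (E* (r ℕ.+ toℕ k) *ᵥ combination a u) y ≈ᶜ a k *ᶜ u k y
      on d≡ = ℂ.trans (E*-on (combination a u) d≡) (combination-at a k y d≡)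
      off : d Γ x y ≢ r ℕ.+ toℕ k → (E* (r ℕ.+ toℕ k) *ᵥ combination a u) y ≈ᶜ a k *ᶜ u k y
      off d≢ = ℂ.trans (E*-off (combination a u) d≢)
        (ℂ.sym (ℂ.trans (ℂ.*-congˡ (supported k y d≢)) (ℂ.zeroʳ (a k))))

    layer-basis : ∀ k → IsBasis (E* (r ℕ.+ toℕ k) ⟨ span u ⟩) (u k ∷ᶠ []ᶠ)
    layer-basis k =
      ( (λ { zero → u k , generator∈span u k , ≋-sym (E*-fixes {v = u k} (supported k)) })
      , λ v (w , (a , w≋) , v≋) → (λ _ → a k) ,
          ≋-trans v≋ (≋-trans (*ᵥ-congˡ (E* (r ℕ.+ toℕ k)) w≋)
            (≋-trans (layer a k) λ y → ℂ.sym (ℂ.+-identityʳ (a k *ᶜ u k y)))) ) ,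
      λ { a comb≋𝟎 zero → let y , _ , w , w*u≈1 = nonvanishing k in
            invertible-cancel (w , w*u≈1) (ℂ.trans (ℂ.*-comm (u k y) (a zero))
              (ℂ.trans (ℂ.sym (ℂ.+-identityʳ (a zero *ᶜ u k y))) (comb≋𝟎 y))) }

    layer-nonzero : ∀ k → Nonzero (E* (r ℕ.+ toℕ k) ⟨ span u ⟩)
    layer-nonzero k all≋𝟎 = u≉𝟎 k (all≋𝟎 (u k)
      (u k , generator∈span u k , ≋-sym (E*-fixes {v = u k} (supported k))))

    layer-zero : ∀ i → (∀ k → i ≢ r ℕ.+ toℕ k) → ¬ Nonzero (E* i ⟨ span u ⟩)
    layer-zero i i≢ nonzero = nonzero λ v (w , (a , w≋) , v≋) →
      ≋-trans v≋ (≋-trans (*ᵥ-congˡ (E* i) w≋) (≋-trans (*ᵥ-combination (E* i) a u)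
        λ y → sum≈0 λ k → ℂ.trans (ℂ.*-congˡ (E*-kills {v = u k} (supported k) (i≢ k) y))
                                   (ℂ.zeroʳ (a k))))

    layer? : ∀ i → Dec (∃ λ k → i ≡ r ℕ.+ toℕ k)
    layer? i = Fin.any? λ k → i ℕ.≟ r ℕ.+ toℕ k

    nonzero⇒layer : ∀ i → Nonzero (E* i ⟨ span u ⟩) → ∃ λ k → i ≡ r ℕ.+ toℕ k
    nonzero⇒layer i nonzero =
      [ (λ layer → layer)
      , (λ ¬layer → contradiction nonzero (layer-zero i λ k i≡ → ¬layer (k , i≡))) ]′
      (toSum (layer? i))

    hasEndpoint : r ≤ D → HasEndpoint toModule r
    hasEndpoint r≤D =
      r≤D ,
      subst (λ i → Nonzero (E* i ⟨ span u ⟩)) (ℕ.+-identityʳ r) (layer-nonzero zero) ,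
      λ i _ nonzero → let k , i≡ = nonzero⇒layer i nonzero in
        subst (r ≤_) (sym i≡) (ℕ.m≤m+n r (toℕ k))

    -- The count of occupied levels is a hypothesis because it evaluates only after D has been
    -- replaced by a numeral.
    hasDiameter : ∣ tabulate {n = ℕ.suc D} (λ i → does (layer? (toℕ i))) ∣ ≡ ℕ.suc m →
                  HasDiameter toModule m
    hasDiameter card = _ , (λ i → mk⇔
      (λ i∈ → let k , i≡ = does⇒ (layer? (toℕ i))
                    (trans (sym (Vec.lookup∘tabulate (λ i → does (layer? (toℕ i))) i))
                           (Vec.[]=⇒lookup i∈))
              in subst (λ i → Nonzero (E* i ⟨ span u ⟩)) (sym i≡) (layer-nonzero k))
      (λ nonzero → Vec.lookup⇒[]= i _
        (trans (Vec.lookup∘tabulate (λ i → does (layer? (toℕ i))) i)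
               (dec-true (layer? (toℕ i)) (nonzero⇒layer (toℕ i) nonzero))))) , card
    -- A nonzero submodule contains some u k, hence by the action of A all of them.
    irreducible : r ℕ.+ m ≤ D →
                  (∀ i → Invertible (𝔹 (suc i) (Fin.inject₁ i))) →
                  (∀ i → Invertible (𝔹 (Fin.inject₁ i) (suc i))) →
                  Irreducible toModule
    irreducible r+m≤D up down =
      (λ all≋𝟎 → u≉𝟎 zero (all≋𝟎 (u zero) (generator∈span u zero))) ,
      λ (W′ , W′⊆W , W⊈W′ , nonzero) → nonzero λ v v∈W′ →
        let a , v≋ = W′⊆W v∈W′ in
        ≋-trans v≋ λ y → sum≈0 λ k → ℂ.trans
          -- Vanishing of `a k` is a stable goal, so an inverse of it may be assumed; with it the
          -- submodule would be all of the module.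
          (ℂ.*-congʳ (≈ᶜ-stable λ ak≉0 → ≉0⇒¬¬invertible ak≉0 λ inv →
            W⊈W′ λ {w} w∈ → contains-span W′
              (contains-all W′ k (extract W′ a k inv (TModule.resp W′ v≋ v∈W′))) w∈))
          (ℂ.zeroˡ (u k y))
      where
      extract : ∀ W a k → Invertible (a k) → combination a u ∈ ∥ W ∥ → u k ∈ ∥ W ∥
      extract W a k (c , c*ak≈1) comb∈ = TModule.resp W
        (λ y → ℂ.trans (ℂ.sym (ℂ.*-assoc c (a k) (u k y)))
                        (ℂ.trans (ℂ.*-congʳ c*ak≈1) (ℂ.*-identityˡ (u k y))))
        (TModule.·∈ W c (TModule.resp W (layer a k)
          (TModule.invariant W (E*∈ (ℕ.≤-trans (ℕ.+-monoʳ-≤ r (Fin.toℕ≤pred[n] k)) r+m≤D)) comb∈)))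

      move : ∀ W j k → Invertible (𝔹 k j) → u j ∈ ∥ W ∥ → u k ∈ ∥ W ∥
      move W j k inv uj∈ = extract W (λ i → 𝔹 i j) k inv
        (TModule.resp W (action j) (TModule.invariant W A∈ uj∈))

      -- The superdiagonal entries lead from level k down to the first vector, the subdiagonal
      -- entries from there up to all the others.
      contains-all : ∀ W k → u k ∈ ∥ W ∥ → ∀ j → u j ∈ ∥ W ∥
      contains-all W k uk∈ = Fin.<-weakInduction (λ j → u j ∈ ∥ W ∥)
        (Fin.<-weakInduction (λ k → u k ∈ ∥ W ∥ → u zero ∈ ∥ W ∥) (λ u0∈ → u0∈)
          (λ i ih → ih ∘ move W (suc i) (Fin.inject₁ i) (down i)) k uk∈)
        (λ i → move W (Fin.inject₁ i) (suc i) (up i))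

      contains-span : ∀ W → (∀ j → u j ∈ ∥ W ∥) → span u ⊆ ∥ W ∥
      contains-span W u∈ (a , v≋) = TModule.resp W (≋-sym v≋)
        (sum∈ (TModule.isSubspace W) (λ k → a k · u k) λ k → TModule.·∈ W (a k) (u∈ k))

  module _ {r m} {𝔹 : Mat (ℕ.suc m)} (B₁ B₂ : ThinBasis r 𝔹) where
    private
      module B₁ = ThinBasis B₁
      module B₂ = ThinBasis B₂

    thin-≅ : B₁.toModule ≅ B₂.toModule
    thin-≅ = record
      { φ          = λ _ (a , _) → combination a B₂.u
      ; φ∈         = λ (a , _) → a , ≋-refl
      ; φ-cong     = λ (a , u≋) (b , v≋) u≋v → combination-congˡ B₂.u
                       (B₁.coordinates-unique a b (≋-trans (≋-sym u≋) (≋-trans u≋v v≋)))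
      ; φ-+        = λ (a , _) (b , _) → combination-+ a b B₂.u
      ; φ-·        = λ c (a , _) → combination-· c a B₂.u
      ; injective  = λ (a , u≋) (b , v≋) φu≋φv → ≋-trans u≋ (≋-trans
                       (combination-congˡ B₁.u (B₂.coordinates-unique a b φu≋φv))
                       (≋-sym v≋))
      ; surjective = λ (a , w≋) → combination a B₁.u , (a , ≋-refl) , ≋-sym w≋
      ; commutes   = λ B∈T (a , _) → ≋-sym (B₂.rep-correct B∈T a)
      }

  module _ {W W′ : TModule} (iso : W ≅ W′) where
    open _≅_ iso
    private
      φ-𝟎 : φ 𝟎 (TModule.0∈ W) ≋ 𝟎
      φ-𝟎 = ≋-trans
        (φ-cong (TModule.0∈ W) (TModule.·∈ W 0ᶜ (TModule.0∈ W)) λ _ → ℂ.sym (ℂ.zeroˡ 0ᶜ))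
        (≋-trans (φ-· 0ᶜ (TModule.0∈ W)) λ y → ℂ.zeroˡ _)

    -- An isomorphism commutes with `E* i`, so the occupied levels are an isomorphism invariant;
    -- level 0 will separate the two types.
    ≅-layer-nonzero : ∀ {i} → i ≤ D → Nonzero (E* i ⟨ ∥ W ∥ ⟩) → Nonzero (E* i ⟨ ∥ W′ ∥ ⟩)
    ≅-layer-nonzero i≤D nonzero all≋𝟎 = nonzero λ v (w , w∈ , v≋) →
      ≋-trans v≋ (injective (TModule.invariant W (E*∈ i≤D) w∈) (TModule.0∈ W)
        (≋-trans (commutes (E*∈ i≤D) w∈)
          (≋-trans (all≋𝟎 _ (φ w w∈ , φ∈ w∈ , ≋-refl)) (≋-sym φ-𝟎))))

    ≅-layer-nonzero⁻¹ : ∀ {i} → i ≤ D → Nonzero (E* i ⟨ ∥ W′ ∥ ⟩) → Nonzero (E* i ⟨ ∥ W ∥ ⟩)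
    ≅-layer-nonzero⁻¹ {i} i≤D nonzero all≋𝟎 = nonzero λ v (w′ , w′∈ , v≋) →
      let w , w∈ , φw≋w′ = surjective w′∈
          E*w∈ = TModule.invariant W (E*∈ i≤D) w∈
      in ≋-trans v≋ (≋-trans (*ᵥ-congˡ (E* i) (≋-sym φw≋w′))
           (≋-trans (≋-sym (commutes (E*∈ i≤D) w∈))
             (≋-trans (φ-cong E*w∈ (TModule.0∈ W) (all≋𝟎 _ (w , w∈ , ≋-refl))) φ-𝟎)))

-- Integer tables

rows : ∀ {m n} → Vec (Vec ℤ n) m → Fin m → Fin n → ℤ
rows r i j = lookup (lookup r i) j

dual : ∀ {n} (N : ℤ) (R L : Fin n → Fin n → ℤ) → N ≢ 0ℤ →
       (∀ a b → sumᶻ (λ k → R k a ℤ.* L k b) ≡ N ℤ.* δᶻ a b) →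
       (∀ j k → sumᶻ (λ a → L j a ℤ.* R k a) ≡ N ℤ.* δᶻ j k) → Dual R L
dual N R L N≢0 res bio = record
  { N = N ; N≢0 = N≢0 ; resolution = res ; biorthogonality = bio }

rowsI : Vec (Vec ℤ 4) 4
rowsI = (+ 0 ∷ + 3 ∷ + 0 ∷ + 0 ∷ [])
      ∷ (+ 1 ∷ + 0 ∷ + 2 ∷ + 0 ∷ [])
      ∷ (+ 0 ∷ + 2 ∷ + 0 ∷ + 1 ∷ [])
      ∷ (+ 0 ∷ + 0 ∷ + 3 ∷ + 0 ∷ [])
      ∷ []

rowsII : Vec (Vec ℤ 2) 2
rowsII = (+ 0 ∷ + 1 ∷ [])
       ∷ (+ 1 ∷ + 0 ∷ [])
       ∷ []

∈ˡ-dec : ∀ (q : ℤ) qs → Dec (q ∈ˡ qs)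
∈ˡ-dec = DecMembership._∈?_ ℤ._≟_

eigenvaluesI : Fin 4 → ℤ
eigenvaluesI = lookup (+ 3 ∷ + 1 ∷ - (+ 1) ∷ - (+ 3) ∷ [])

-- The rows of `R` are the Krawtchouk polynomials of degrees 0 to 3 on the levels. The matrix is
-- self-adjoint for the weights 1, 3, 3, 1, the sizes of the levels, so weighting the right
-- eigenvectors gives left ones. Their weighted squared norms are 8, 24, 24, 8, whence N = 24 and
-- the extra factor 3 in the first and last rows of `L`.
diagonalisedI : Diagonalised (fromRows rowsI) eigenvaluesI
diagonalisedI = record
  { matrix      = rows rowsI
  ; matrix≈     = λ _ _ → ℂ.refl
  ; R           = R
  ; L           = L
  ; dual        = dual (+ 24) R L (λ ())
      (from-yes (Fin.all? λ a → Fin.all? λ b → sumᶻ (λ k → R k a ℤ.* L k b) ℤ.≟ + 24 ℤ.* δᶻ a b))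
      (from-yes (Fin.all? λ j → Fin.all? λ k → sumᶻ (λ a → L j a ℤ.* R k a) ℤ.≟ + 24 ℤ.* δᶻ j k))
  ; left-eigen  = from-yes (Fin.all? λ k → Fin.all? λ b →
      sumᶻ (λ a → L k a ℤ.* rows rowsI a b) ℤ.≟ eigenvaluesI k ℤ.* L k b)
  ; right-eigen = from-yes (Fin.all? λ k → Fin.all? λ a →
      sumᶻ (λ b → rows rowsI a b ℤ.* R k b) ℤ.≟ eigenvaluesI k ℤ.* R k a)
  }
  where
  R L : Fin 4 → Fin 4 → ℤ
  R = rows
    ( (+ 1 ∷ + 1 ∷ + 1 ∷ + 1 ∷ [])
    ∷ (+ 3 ∷ + 1 ∷ -1ℤ ∷ - (+ 3) ∷ [])
    ∷ (+ 3 ∷ -1ℤ ∷ -1ℤ ∷ + 3 ∷ [])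
    ∷ (+ 1 ∷ -1ℤ ∷ + 1 ∷ -1ℤ ∷ [])
    ∷ [])
  L = rows
    ( (+ 3 ∷ + 9 ∷ + 9 ∷ + 3 ∷ [])
    ∷ (+ 3 ∷ + 3 ∷ - (+ 3) ∷ - (+ 3) ∷ [])
    ∷ (+ 3 ∷ - (+ 3) ∷ - (+ 3) ∷ + 3 ∷ [])
    ∷ (+ 3 ∷ - (+ 9) ∷ + 9 ∷ - (+ 3) ∷ [])
    ∷ [])

eigenvaluesII : Fin 2 → ℤ
eigenvaluesII = lookup (+ 1 ∷ - (+ 1) ∷ [])

diagonalisedII : Diagonalised (fromRows rowsII) eigenvaluesII
diagonalisedII = record
  { matrix      = rows rowsII
  ; matrix≈     = λ _ _ → ℂ.refl
  ; R           = R
  ; L           = R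
  ; dual        = dual (+ 2) R R (λ ())
      (from-yes (Fin.all? λ a → Fin.all? λ b → sumᶻ (λ k → R k a ℤ.* R k b) ℤ.≟ + 2 ℤ.* δᶻ a b))
      (from-yes (Fin.all? λ j → Fin.all? λ k → sumᶻ (λ a → R j a ℤ.* R k a) ℤ.≟ + 2 ℤ.* δᶻ j k))
  ; left-eigen  = from-yes (Fin.all? λ k → Fin.all? λ b →
      sumᶻ (λ a → R k a ℤ.* rows rowsII a b) ℤ.≟ eigenvaluesII k ℤ.* R k b)
  ; right-eigen = from-yes (Fin.all? λ k → Fin.all? λ a →
      sumᶻ (λ b → rows rowsII a b ℤ.* R k b) ℤ.≟ eigenvaluesII k ℤ.* R k a)
  }
  where
  R : Fin 2 → Fin 2 → ℤ
  R = rows ((+ 1 ∷ + 1 ∷ []) ∷ (+ 1 ∷ -1ℤ ∷ []) ∷ [])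

eigenvaluesFromTable : ∀ {n} {M : Mat n} {eigenvalue} → Diagonalised M eigenvalue → ∀ qs →
  {True (AllPairs.allPairs? (λ a b → ¬? (a ℤ.≟ b)) qs)} →
  {True (Fin.all? λ k → ∈ˡ-dec (eigenvalue k) qs)} →
  {True (All.all? (λ q → Fin.any? λ k → eigenvalue k ℤ.≟ q) qs)} →
  HasEigenvalues M (List.map fromℤ qs)
eigenvaluesFromTable M-diagonalised qs {distinct} {sound} {complete} =
  Diagonalised.hasEigenvalues M-diagonalised qs
    (toWitness distinct) (toWitness sound) (toWitness complete)

-- Label a stands for a subset of a 3-set; row S of this table is the character a ↦ (-1)^|S ∩ a|.
character : Fin 8 → Fin 8 → ℤ
character = rows
  ( (1ℤ ∷ 1ℤ ∷ 1ℤ ∷ 1ℤ ∷ 1ℤ ∷ 1ℤ ∷ 1ℤ ∷ 1ℤ ∷ [])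
  ∷ (1ℤ ∷ -1ℤ ∷ 1ℤ ∷ 1ℤ ∷ 1ℤ ∷ -1ℤ ∷ -1ℤ ∷ -1ℤ ∷ [])
  ∷ (1ℤ ∷ 1ℤ ∷ -1ℤ ∷ 1ℤ ∷ -1ℤ ∷ 1ℤ ∷ -1ℤ ∷ -1ℤ ∷ [])
  ∷ (1ℤ ∷ 1ℤ ∷ 1ℤ ∷ -1ℤ ∷ -1ℤ ∷ -1ℤ ∷ 1ℤ ∷ -1ℤ ∷ [])
  ∷ (1ℤ ∷ 1ℤ ∷ -1ℤ ∷ -1ℤ ∷ 1ℤ ∷ -1ℤ ∷ -1ℤ ∷ 1ℤ ∷ [])
  ∷ (1ℤ ∷ -1ℤ ∷ 1ℤ ∷ -1ℤ ∷ -1ℤ ∷ 1ℤ ∷ -1ℤ ∷ 1ℤ ∷ [])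
  ∷ (1ℤ ∷ -1ℤ ∷ -1ℤ ∷ 1ℤ ∷ -1ℤ ∷ -1ℤ ∷ 1ℤ ∷ 1ℤ ∷ [])
  ∷ (1ℤ ∷ -1ℤ ∷ -1ℤ ∷ -1ℤ ∷ 1ℤ ∷ 1ℤ ∷ 1ℤ ∷ -1ℤ ∷ [])
  ∷ [])

-- The value for S is 3 - 2|S|: each of the three edge directions contributes -1 if it lies in S and
-- 1 otherwise.
cubeEigenvalue : Fin 8 → ℤ
cubeEigenvalue =
  lookup (+ 3 ∷ + 1 ∷ + 1 ∷ + 1 ∷ - (+ 1) ∷ - (+ 1) ∷ - (+ 1) ∷ - (+ 3) ∷ [])

adjacencyᶻ : Fin 8 → Fin 8 → ℤ
adjacencyᶻ a b = if does (neighbour? a b) then 1ℤ else 0ℤ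

-- Orthogonal bases of W₀ (rows 0-3), of W₁ₐ (rows 4, 5) and of W₁ᵦ (rows 6, 7).
moduleTable : Fin 8 → Fin 8 → ℤ
moduleTable = rows
  ( (+ 1 ∷ + 0 ∷ + 0 ∷ + 0 ∷ + 0 ∷ + 0 ∷ + 0 ∷ + 0 ∷ [])
  ∷ (+ 0 ∷ + 1 ∷ + 1 ∷ + 1 ∷ + 0 ∷ + 0 ∷ + 0 ∷ + 0 ∷ [])
  ∷ (+ 0 ∷ + 0 ∷ + 0 ∷ + 0 ∷ + 1 ∷ + 1 ∷ + 1 ∷ + 0 ∷ [])
  ∷ (+ 0 ∷ + 0 ∷ + 0 ∷ + 0 ∷ + 0 ∷ + 0 ∷ + 0 ∷ + 1 ∷ [])
  ∷ (+ 0 ∷ 1ℤ ∷ -1ℤ ∷ 0ℤ ∷ + 0 ∷ + 0 ∷ + 0 ∷ + 0 ∷ [])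
  ∷ (+ 0 ∷ + 0 ∷ + 0 ∷ + 0 ∷ -1ℤ ∷ 1ℤ ∷ 0ℤ ∷ + 0 ∷ [])
  ∷ (+ 0 ∷ 1ℤ ∷ 1ℤ ∷ - (+ 2) ∷ + 0 ∷ + 0 ∷ + 0 ∷ + 0 ∷ [])
  ∷ (+ 0 ∷ + 0 ∷ + 0 ∷ + 0 ∷ -1ℤ ∷ -1ℤ ∷ + 2 ∷ + 0 ∷ [])
  ∷ [])

-- 6 / ‖row‖²
moduleWeight : Fin 8 → ℤ
moduleWeight = lookup (+ 6 ∷ + 2 ∷ + 2 ∷ + 6 ∷ + 3 ∷ + 3 ∷ + 1 ∷ + 1 ∷ [])

sum-split : ∀ m {n} (f : Fin (m ℕ.+ n) → ℂ) → sum f ≈ᶜ sum (f ∘ (_↑ˡ n)) +ᶜ sum (f ∘ (m ↑ʳ_))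
sum-split zero    f = ℂ.sym (ℂ.+-identityˡ (sum f))
sum-split (ℕ.suc m) f =
  ℂ.trans (ℂ.+-congˡ (sum-split m (f ∘ suc))) (ℂ.sym (ℂ.+-assoc (f zero) _ _))

invertible-resp : ∀ {z w} → z ≈ᶜ w → Invertible z → Invertible w
invertible-resp z≈w (i , iz≈1) = i , ℂ.trans (ℂ.*-congˡ (ℂ.sym z≈w)) iz≈1

-- Transport of integer tables to Γ, and the spectrum of A

module Cube {Γ : Graph 8} {x : Fin 8} {y : Fin 3 → Fin 8} (labelling : CubeLabelling Γ x y) where
  open CubeLabelling labelling
  open Graph Γ
  open Terwilliger Γ x
  open ThinModules Γ x

  labels : Perm.Permutation 8 8
  labels = Perm.permutation vertex label vertex-label label-vertex

  sumᶻ-label : ∀ (f : Fin 8 → ℤ) → sumᶻ (f ∘ label) ≡ sumᶻ f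
  sumᶻ-label f = trans (Σᶻ.sum-permute (f ∘ label) labels)
                       (Σᶻ.sum-cong-≗ λ a → cong f (label-vertex a))

  δᶻ-label : ∀ v w → δᶻ (label v) (label w) ≡ δᶻ v w
  δᶻ-label v w = δ-cong (label v Fin.≟ label w) (v Fin.≟ w)
    (λ eq → trans (sym (vertex-label v)) (trans (cong vertex eq) (vertex-label w)))
    where
    δ-cong : (p : Dec (label v ≡ label w)) (q : Dec (v ≡ w)) → (label v ≡ label w → v ≡ w) →
             (if does p then 1ℤ else 0ℤ) ≡ (if does q then 1ℤ else 0ℤ)
    δ-cong (yes _) (yes _) _ = refl
    δ-cong (yes p) (no ¬q) f = contradiction (f p) ¬q
    δ-cong (no ¬p) (yes q) _ = contradiction (cong label q) ¬p
    δ-cong (no  _) (no  _) _ = refl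

  d-label : ∀ v → d Γ x v ≡ level (label v)
  d-label v = trans (cong (d Γ x) (sym (vertex-label v))) (vertex-d (label v))

  ~-label : ∀ v w → does (v ~? w) ≡ does (neighbour? (label v) (label w))
  ~-label v w = trans (cong₂ (λ v w → does (v ~? w)) (sym (vertex-label v)) (sym (vertex-label w)))
                      (vertex-~ (label v) (label w))

  A-label : ∀ v w → A v w ≈ᶜ fromℤ (adjacencyᶻ (label v) (label w))
  A-label v w = ℂ.trans
    (ℂ.reflexive (cong (λ b → if b then 1ᶜ else 0ᶜ) (~-label v w)))
    (fromℤ-if (neighbour? (label v) (label w)))

  fromTable : (Fin 8 → ℤ) → V
  fromTable t v = fromℤ (t (label v))

  labelled-dual : ∀ N (R L : Fin 8 → Fin 8 → ℤ) → N ≢ 0ℤ →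
    (∀ a b → sumᶻ (λ k → R k a ℤ.* L k b) ≡ N ℤ.* δᶻ a b) →
    (∀ j k → sumᶻ (λ a → L j a ℤ.* R k a) ≡ N ℤ.* δᶻ j k) →
    Dual (λ k → R k ∘ label) (λ k → L k ∘ label)
  labelled-dual N R L N≢0 res bio = dual N _ _ N≢0
    (λ v w → trans (res (label v) (label w)) (cong (N ℤ.*_) (δᶻ-label v w)))
    (λ j k → trans (sumᶻ-label (λ a → L j a ℤ.* R k a)) (bio j k))

  A-diagonalised : Diagonalised (adjacency Γ) cubeEigenvalue
  A-diagonalised = record
    { matrix      = λ v w → adjacencyᶻ (label v) (label w)
    ; matrix≈     = A-label
    ; R           = λ k → character k ∘ label
    ; L           = λ k → character k ∘ label
    -- Rows and columns of the character table are orthogonal with squared norm 8, so it is its own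
    -- dual up to that factor.
    ; dual        = labelled-dual (+ 8) character character (λ ()) resolution biorthogonality
    ; left-eigen  = λ k w → trans
        (sumᶻ-label λ a → character k a ℤ.* adjacencyᶻ a (label w)) (left k (label w))
    ; right-eigen = λ k v → trans
        (sumᶻ-label λ b → adjacencyᶻ (label v) b ℤ.* character k b) (right k (label v))
    }
    where
    abstract
      resolution : ∀ a b → sumᶻ (λ k → character k a ℤ.* character k b) ≡ + 8 ℤ.* δᶻ a b
      resolution = from-yes (Fin.all? λ a → Fin.all? λ b →
        sumᶻ (λ k → character k a ℤ.* character k b) ℤ.≟ + 8 ℤ.* δᶻ a b)
      biorthogonality : ∀ j k → sumᶻ (λ a → character j a ℤ.* character k a) ≡ + 8 ℤ.* δᶻ j k
      biorthogonality = from-yes (Fin.all? λ j → Fin.all? λ k →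
        sumᶻ (λ a → character j a ℤ.* character k a) ℤ.≟ + 8 ℤ.* δᶻ j k)
      left : ∀ k b →
        sumᶻ (λ a → character k a ℤ.* adjacencyᶻ a b) ≡ cubeEigenvalue k ℤ.* character k b
      left = from-yes (Fin.all? λ k → Fin.all? λ b →
        sumᶻ (λ a → character k a ℤ.* adjacencyᶻ a b) ℤ.≟ cubeEigenvalue k ℤ.* character k b)
      right : ∀ k a →
        sumᶻ (λ b → adjacencyᶻ a b ℤ.* character k b) ≡ cubeEigenvalue k ℤ.* character k a
      right = from-yes (Fin.all? λ k → Fin.all? λ a →
        sumᶻ (λ b → adjacencyᶻ a b ℤ.* character k b) ℤ.≟ cubeEigenvalue k ℤ.* character k a)

  A-spectrum : HasSpectrum (adjacency Γ)
    ( (fromℤ (+ 3) , 1) List.∷ (fromℤ (+ 1) , 3) List.∷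
      (fromℤ (- (+ 1)) , 3) List.∷ (fromℤ (- (+ 3)) , 1) List.∷ List.[])
  A-spectrum =
    AllPairs.map⁺ (AllPairs.map (_∘ fromℤ-injective)
      (from-yes (AllPairs.allPairs? (λ a b → ¬? (a ℤ.≟ b)) qs))) ,
    eigenvaluesFromTable A-diagonalised qs ,
    ( eigenspace (+ 3) (0F ∷ [])
    All.∷ eigenspace (+ 1) (1F ∷ 2F ∷ 3F ∷ [])
    All.∷ eigenspace (- (+ 1)) (4F ∷ 5F ∷ 6F ∷ [])
    All.∷ eigenspace (- (+ 3)) (7F ∷ []) All.∷ All.[])
    where
    qs : List ℤ
    qs = + 3 List.∷ + 1 List.∷ - (+ 1) List.∷ - (+ 3) List.∷ List.[]
    eigenspace : ∀ q {m} (e : Vec (Fin 8) m) →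
      {True (Fin.all? λ i → Fin.all? λ j → (lookup e i Fin.≟ lookup e j) →-dec (i Fin.≟ j))} →
      {True (Fin.all? λ i → cubeEigenvalue (lookup e i) ℤ.≟ q)} →
      {True (Fin.all? λ k → (cubeEigenvalue k ℤ.≟ q) →-dec
                            (sumᶻ (λ i → δᶻ (lookup e i) k) ℤ.≟ 1ℤ))} →
      HasDim (Eigenspace (adjacency Γ) (fromℤ q)) m
    eigenspace q e {injective} {eigenvalue} {covers} =
      Diagonalised.eigenspace-dimension A-diagonalised q (lookup e)
        (λ {i} {j} → toWitness injective i j) (toWitness eigenvalue) (toWitness covers)

  A-fromTable : ∀ {v} t → v ≋ fromTable t →
                A *ᵥ v ≋ fromTable (λ a → sumᶻ (λ b → adjacencyᶻ a b ℤ.* t b))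
  A-fromTable {v} t v≋t w = begin
    sum (λ z → A w z *ᶜ v z)
      ≈⟨ Σᶜ.sum-cong-≋ (λ z → ℂ.*-cong (A-label w z) (v≋t z)) ⟩
    sum (λ z → fromℤ (adjacencyᶻ (label w) (label z)) *ᶜ fromℤ (t (label z)))
      ≈⟨ fromℤ-sum-* (adjacencyᶻ (label w) ∘ label) (t ∘ label) ⟩
    fromℤ (sumᶻ (λ z → adjacencyᶻ (label w) (label z) ℤ.* t (label z)))
      ≡⟨ cong fromℤ (sumᶻ-label λ b → adjacencyᶻ (label w) b ℤ.* t b) ⟩
    fromℤ (sumᶻ (λ b → adjacencyᶻ (label w) b ℤ.* t b)) ∎
    where open ≈ᶜ-Reasoning

  combination-fromTable : ∀ {m} (c : Fin m → ℤ) (t : Fin m → Fin 8 → ℤ) {u} →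
    (∀ k → u k ≋ fromTable (t k)) →
    combination (fromℤ ∘ c) u ≋ fromTable (λ a → sumᶻ (λ k → c k ℤ.* t k a))
  combination-fromTable c t u≋t v =
    ℂ.trans (Σᶜ.sum-cong-≋ λ k → ℂ.*-congˡ (u≋t k v)) (fromℤ-sum-* c (λ k → t k (label v)))

  ⟨⟩-fromTable : ∀ {u v} s t → u ≋ fromTable s → v ≋ fromTable t →
                 ⟨ u , v ⟩ ≈ᶜ fromℤ (sumᶻ (λ a → s a ℤ.* t a))
  ⟨⟩-fromTable s t u≋s v≋t = ℂ.trans (⟨⟩-cong u≋s v≋t) (ℂ.trans
    (Σᶜ.sum-cong-≋ {x = λ y → fromℤ (s (label y)) *ᶜ conj (fromℤ (t (label y)))} λ y →
      ℂ.*-congˡ {fromℤ (s (label y))} (conj-fromℤ (t (label y))))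
    (ℂ.trans (fromℤ-sum-* (s ∘ label) (t ∘ label))
      (ℂ.reflexive (cong fromℤ (sumᶻ-label λ a → s a ℤ.* t a)))))

  thinBasis : ∀ r {m} (𝔹 : Vec (Vec ℤ (ℕ.suc m)) (ℕ.suc m)) (t : Fin (ℕ.suc m) → Fin 8 → ℤ) u →
    (∀ k → u k ≋ fromTable (t k)) →
    {True (Fin.all? λ k → Fin.all? λ a → ¬? (level a ℕ.≟ r ℕ.+ toℕ k) →-dec (t k a ℤ.≟ 0ℤ))} →
    {True (Fin.all? λ k → Fin.any? λ a → (level a ℕ.≟ r ℕ.+ toℕ k) ×-dec ¬? (t k a ℤ.≟ 0ℤ))} →
    {True (Fin.all? λ k → Fin.all? λ a → sumᶻ (λ b → adjacencyᶻ a b ℤ.* t k b) ℤ.≟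
                                         sumᶻ (λ j → rows 𝔹 j k ℤ.* t j a))} →
    ThinBasis r (fromRows 𝔹)
  thinBasis r 𝔹 t u u≋t {supported} {nonvanishing} {action} = record
    { u            = u
    ; supported    = λ k v d≢ → ℂ.trans (u≋t k v) (ℂ.reflexive (cong fromℤ
        (toWitness supported k (label v) (d≢ ∘ trans (d-label v)))))
    ; nonvanishing = λ k → let a , level≡ , t≢0 = toWitness nonvanishing k in
        vertex a , trans (vertex-d a) level≡ ,
        invertible-resp (ℂ.sym (ℂ.trans (u≋t k (vertex a))
                                        (ℂ.reflexive (cong (fromℤ ∘ t k) (label-vertex a)))))
                        (fromℤ-invertible t≢0)
    ; action       = λ k → ≋-trans (A-fromTable (t k) (u≋t k)) (≋-trans
        (λ v → ℂ.reflexive (cong fromℤ (toWitness action k (label v))))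
        (≋-sym (combination-fromTable (λ j → rows 𝔹 j k) t u≋t)))
    }

  e*-fromTable : ∀ i → e* i ≋ fromTable (λ a → if does (level a ℕ.≟ i) then 1ℤ else 0ℤ)
  e*-fromTable i v = ℂ.trans
    (ℂ.reflexive (cong (λ k → if does (k ℕ.≟ i) then 1ᶜ else 0ᶜ) (d-label v)))
    (fromℤ-if (level (label v) ℕ.≟ i))

  module _ (ordering : Fin 3 ↔ (∃ λ y → d Γ x y ≡ 1))
           (vertex-ordering : ∀ i → vertex (yᴸ i) ≡ proj₁ (Inverse.to ordering i)) where

    fromEssential-on : ∀ (c : Fin 3 → ℂ) i →
      fromEssential 1 ordering c (proj₁ (Inverse.to ordering i)) ≡ c i
    fromEssential-on c i with d Γ x (proj₁ (Inverse.to ordering i)) ℕ.≟ 1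
    -- The decision yields its own proof that the distance is 1; such proofs are unique, so
    -- `ordering` sends the pair back to i.
    ... | yes p = cong c (trans
      (cong (Inverse.from ordering) (cong (proj₁ (Inverse.to ordering i) ,_) (ℕ.≡-irrelevant p _)))
      (Inverse.strictlyInverseʳ ordering i))
    ... | no ¬p = contradiction (proj₂ (Inverse.to ordering i)) ¬p

    fromEssential-off : ∀ (c : Fin 3 → ℂ) v → d Γ x v ≢ 1 → fromEssential 1 ordering c v ≡ 0ᶜ
    fromEssential-off c v d≢1 with d Γ x v ℕ.≟ 1
    ... | yes d≡1 = contradiction d≡1 d≢1
    ... | no _    = refl

    fromEssential-fromTable : ∀ (c : Fin 3 → ℤ) →
      fromEssential 1 ordering (fromℤ ∘ c) ≋ fromTable (0ℤ ∷ᶠ c 0F ∷ᶠ c 1F ∷ᶠ c 2F ∷ᶠ λ _ → 0ℤ)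
    fromEssential-fromTable c v =
      ℂ.reflexive (trans (cong (fromEssential 1 ordering (fromℤ ∘ c)) (sym (vertex-label v)))
                         (entry (label v)))
      where
      on : ∀ i → fromEssential 1 ordering (fromℤ ∘ c) (vertex (yᴸ i)) ≡ fromℤ (c i)
      on i = trans (cong (fromEssential 1 ordering (fromℤ ∘ c)) (vertex-ordering i))
                   (fromEssential-on (fromℤ ∘ c) i)
      off : ∀ a → level a ≢ 1 → fromEssential 1 ordering (fromℤ ∘ c) (vertex a) ≡ 0ᶜ
      off a level≢1 = fromEssential-off (fromℤ ∘ c) (vertex a) (level≢1 ∘ trans (sym (vertex-d a)))
      entry : ∀ a → fromEssential 1 ordering (fromℤ ∘ c) (vertex a) ≡
                    fromℤ ((0ℤ ∷ᶠ c 0F ∷ᶠ c 1F ∷ᶠ c 2F ∷ᶠ λ _ → 0ℤ) a)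
      entry 0F = off 0F λ ()
      entry 1F = on 0F
      entry 2F = on 1F
      entry 3F = on 2F
      entry 4F = off 4F λ ()
      entry 5F = off 5F λ ()
      entry 6F = off 6F λ ()
      entry 7F = off 7F λ ()

-- The orthogonal decomposition and the two isomorphism types

module Decomposition {Γ : Graph 8} {x : Fin 8} {y : Fin 3 → Fin 8} (labelling : CubeLabelling Γ x y)
  (diameter≡3 : diameter Γ ≡ 3) (ordering : Fin 3 ↔ (∃ λ y → d Γ x y ≡ 1))
  (y-ordering : ∀ i → y i ≡ proj₁ (Inverse.to ordering i)) where
  open CubeLabelling labelling
  open Terwilliger Γ x
  open ThinModules Γ x
  open Cube labelling

  νₐ νᵦ : V
  νₐ = fromEssential 1 ordering (fromℤ ∘ (1ℤ ∷ᶠ -1ℤ ∷ᶠ 0ℤ ∷ᶠ []ᶠ))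
  νᵦ = fromEssential 1 ordering (fromℤ ∘ (1ℤ ∷ᶠ 1ℤ ∷ᶠ - (+ 2) ∷ᶠ []ᶠ))

  private
    vertex-ordering : ∀ i → vertex (yᴸ i) ≡ proj₁ (Inverse.to ordering i)
    vertex-ordering i = trans (vertex-y i) (y-ordering i)

    i≤D : ∀ {i} → i ≤ 3 → i ≤ D
    i≤D = subst (_ ≤_) (sym diameter≡3)

    t₀ : Fin 4 → Fin 8 → ℤ
    t₀ k = moduleTable (k ↑ˡ 4)
    tₐ tᵦ : Fin 2 → Fin 8 → ℤ
    tₐ k = moduleTable (4 ↑ʳ (k ↑ˡ 2))
    tᵦ k = moduleTable (4 ↑ʳ (2 ↑ʳ k))

    retable : ∀ {v} s t → v ≋ fromTable s → {True (Fin.all? λ a → s a ℤ.≟ t a)} → v ≋ fromTable t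
    retable s t v≋s {s≗t} w = ℂ.trans (v≋s w) (ℂ.reflexive (cong fromℤ (toWitness s≗t (label w))))

    e*≋ : ∀ i t → {True (Fin.all? λ a → (if does (level a ℕ.≟ i) then 1ℤ else 0ℤ) ℤ.≟ t a)} →
          e* i ≋ fromTable t
    e*≋ i t {eq} = retable _ t (e*-fromTable i) {eq}

    ν≋ : ∀ c t → {True (Fin.all? λ a → (0ℤ ∷ᶠ c 0F ∷ᶠ c 1F ∷ᶠ c 2F ∷ᶠ λ _ → 0ℤ) a ℤ.≟ t a)} →
         fromEssential 1 ordering (fromℤ ∘ c) ≋ fromTable t
    ν≋ c t {eq} = retable _ t (fromEssential-fromTable ordering vertex-ordering c) {eq}

    Aν≋ : ∀ {v} s t → v ≋ fromTable s →
          {True (Fin.all? λ a → sumᶻ (λ b → adjacencyᶻ a b ℤ.* s b) ℤ.≟ t a)} → A *ᵥ v ≋ fromTable t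
    Aν≋ s t v≋s {eq} = retable _ t (A-fromTable s v≋s) {eq}

    u₀ : Fin 4 → V
    u₀ = e* 0 ∷ᶠ e* 1 ∷ᶠ e* 2 ∷ᶠ e* 3 ∷ᶠ []ᶠ
    uₐ uᵦ : Fin 2 → V
    uₐ = νₐ ∷ᶠ A *ᵥ νₐ ∷ᶠ []ᶠ
    uᵦ = νᵦ ∷ᶠ A *ᵥ νᵦ ∷ᶠ []ᶠ

    u₀≋ : ∀ k → u₀ k ≋ fromTable (t₀ k)
    u₀≋ 0F = e*≋ 0 (t₀ 0F)
    u₀≋ 1F = e*≋ 1 (t₀ 1F)
    u₀≋ 2F = e*≋ 2 (t₀ 2F)
    u₀≋ 3F = e*≋ 3 (t₀ 3F)

    uₐ≋ : ∀ k → uₐ k ≋ fromTable (tₐ k)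
    uₐ≋ 0F = ν≋ (1ℤ ∷ᶠ -1ℤ ∷ᶠ 0ℤ ∷ᶠ []ᶠ) (tₐ 0F)
    uₐ≋ 1F = Aν≋ (tₐ 0F) (tₐ 1F) (uₐ≋ 0F)

    uᵦ≋ : ∀ k → uᵦ k ≋ fromTable (tᵦ k)
    uᵦ≋ 0F = ν≋ (1ℤ ∷ᶠ 1ℤ ∷ᶠ - (+ 2) ∷ᶠ []ᶠ) (tᵦ 0F)
    uᵦ≋ 1F = Aν≋ (tᵦ 0F) (tᵦ 1F) (uᵦ≋ 0F)

  B₀ : ThinBasis 0 (fromRows rowsI)
  B₀ = thinBasis 0 rowsI t₀ u₀ u₀≋

  Bₐ Bᵦ : ThinBasis 1 (fromRows rowsII)
  Bₐ = thinBasis 1 rowsII tₐ uₐ uₐ≋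
  Bᵦ = thinBasis 1 rowsII tᵦ uᵦ uᵦ≋

  W₀ W₁ₐ W₁ᵦ : TModule
  W₀  = ThinBasis.toModule B₀
  W₁ₐ = ThinBasis.toModule Bₐ
  W₁ᵦ = ThinBasis.toModule Bᵦ

  W : Fin 3 → TModule
  W = W₀ ∷ᶠ W₁ₐ ∷ᶠ W₁ᵦ ∷ᶠ []ᶠ

  moduleType : Fin 3 → ModuleType
  moduleType = typeI ∷ᶠ typeII ∷ᶠ typeII ∷ᶠ []ᶠ

  irreducibleI : Irreducible W₀
  irreducibleI = ThinBasis.irreducible B₀ (i≤D ℕ.≤-refl)
    (λ { 0F → fromℤ-invertible {+ 1} λ () ; 1F → fromℤ-invertible {+ 2} λ ()
       ; 2F → fromℤ-invertible {+ 3} λ () })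
    (λ { 0F → fromℤ-invertible {+ 3} λ () ; 1F → fromℤ-invertible {+ 2} λ ()
       ; 2F → fromℤ-invertible {+ 1} λ () })

  irreducibleII : ∀ (B : ThinBasis 1 (fromRows rowsII)) → Irreducible (ThinBasis.toModule B)
  irreducibleII B = ThinBasis.irreducible B (i≤D (ℕ.n≤1+n 2))
    (λ { 0F → fromℤ-invertible {+ 1} λ () }) (λ { 0F → fromℤ-invertible {+ 1} λ () })

  private
    tables-orthogonal : ∀ {l m} (u : Fin l → V) (u′ : Fin m → V)
      (s : Fin l → Fin 8 → ℤ) (t : Fin m → Fin 8 → ℤ) →
      (∀ k → u k ≋ fromTable (s k)) → (∀ k → u′ k ≋ fromTable (t k)) →
      {True (Fin.all? λ j → Fin.all? λ k → sumᶻ (λ a → s j a ℤ.* t k a) ℤ.≟ 0ℤ)} →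
      ∀ {v w} → v ∈ span u → w ∈ span u′ → ⟨ v , w ⟩ ≈ᶜ 0ᶜ
    tables-orthogonal u u′ s t u≋s u′≋t {s⊥t} {v} {w} = spans-orthogonal u u′ (λ j k →
      ℂ.trans (⟨⟩-fromTable (s j) (t k) (u≋s j) (u′≋t k))
               (ℂ.reflexive (cong fromℤ (toWitness s⊥t j k)))) {v} {w}

    orthogonal : ∀ {j k} → j ≢ k → ∀ {v w} → v ∈ ∥ W j ∥ → w ∈ ∥ W k ∥ → ⟨ v , w ⟩ ≈ᶜ 0ᶜ
    orthogonal {0F} {0F} j≢k = contradiction refl j≢k
    orthogonal {0F} {1F} _ {v} {w} = tables-orthogonal u₀ uₐ t₀ tₐ u₀≋ uₐ≋ {_} {v} {w}
    orthogonal {0F} {2F} _ {v} {w} = tables-orthogonal u₀ uᵦ t₀ tᵦ u₀≋ uᵦ≋ {_} {v} {w}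
    orthogonal {1F} {0F} _ {v} {w} = tables-orthogonal uₐ u₀ tₐ t₀ uₐ≋ u₀≋ {_} {v} {w}
    orthogonal {1F} {1F} j≢k = contradiction refl j≢k
    orthogonal {1F} {2F} _ {v} {w} = tables-orthogonal uₐ uᵦ tₐ tᵦ uₐ≋ uᵦ≋ {_} {v} {w}
    orthogonal {2F} {0F} _ {v} {w} = tables-orthogonal uᵦ u₀ tᵦ t₀ uᵦ≋ u₀≋ {_} {v} {w}
    orthogonal {2F} {1F} _ {v} {w} = tables-orthogonal uᵦ uₐ tᵦ tₐ uᵦ≋ uₐ≋ {_} {v} {w}
    orthogonal {2F} {2F} j≢k = contradiction refl j≢k

    weighted : Fin 8 → Fin 8 → ℤ
    weighted k a = moduleWeight k ℤ.* moduleTable k a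

    -- The eight rows are mutually orthogonal, so each is dual to itself up to its squared norm,
    -- which is 1, 2, 3 or 6; their least common multiple is N = 6.
    basis : Dual (λ k → moduleTable k ∘ label) (λ k → weighted k ∘ label)
    basis = labelled-dual (+ 6) moduleTable weighted (λ ()) resolution biorthogonality
      where
      abstract
        resolution : ∀ a b → sumᶻ (λ k → moduleTable k a ℤ.* weighted k b) ≡ + 6 ℤ.* δᶻ a b
        resolution = from-yes (Fin.all? λ a → Fin.all? λ b →
          sumᶻ (λ k → moduleTable k a ℤ.* weighted k b) ℤ.≟ + 6 ℤ.* δᶻ a b)
        biorthogonality : ∀ j k → sumᶻ (λ a → weighted j a ℤ.* moduleTable k a) ≡ + 6 ℤ.* δᶻ j k
        biorthogonality = from-yes (Fin.all? λ j → Fin.all? λ k →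
          sumᶻ (λ a → weighted j a ℤ.* moduleTable k a) ℤ.≟ + 6 ℤ.* δᶻ j k)

    component : (Fin 8 → ℂ) → Fin 3 → V
    component c = combination (λ k → c (k ↑ˡ 4)) u₀ ∷ᶠ combination (λ k → c (4 ↑ʳ (k ↑ˡ 2))) uₐ ∷ᶠ
                  combination (λ k → c (4 ↑ʳ (2 ↑ʳ k))) uᵦ ∷ᶠ []ᶠ

    combination-split : ∀ c → combination c (Dual.vectors basis) ≋ Σⱽ (component c)
    combination-split c v = ℂ.trans (sum-split 4 f)
      (ℂ.+-cong (part (λ k → k ↑ˡ 4) u₀ u₀≋) (ℂ.trans (sum-split 2 (f ∘ (4 ↑ʳ_)))
        (ℂ.+-cong (part (λ k → 4 ↑ʳ (k ↑ˡ 2)) uₐ uₐ≋)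
          (ℂ.trans (part (λ k → 4 ↑ʳ (2 ↑ʳ k)) uᵦ uᵦ≋) (ℂ.sym (ℂ.+-identityʳ _))))))
      where
      f : Fin 8 → ℂ
      f k = c k *ᶜ fromℤ (moduleTable k (label v))
      part : ∀ {m} (e : Fin m → Fin 8) u → (∀ k → u k ≋ fromTable (moduleTable (e k))) →
             sum (f ∘ e) ≈ᶜ combination (c ∘ e) u v
      part e u u≋ = Σᶜ.sum-cong-≋ λ k → ℂ.*-congˡ (ℂ.sym (u≋ k v))

    spanning : ∀ v → ∃ λ (w : Fin 3 → V) → (∀ j → w j ∈ ∥ W j ∥) × v ≋ Σⱽ w
    spanning v = component c , member , ≋-trans (Dual.expansion basis v) (combination-split c)
      where
      c : Fin 8 → ℂ
      c k = Dual.N⁻¹ basis *ᶜ Dual.coefficient basis k v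
      member : ∀ j → component c j ∈ ∥ W j ∥
      member 0F = (λ k → c (k ↑ˡ 4)) , ≋-refl
      member 1F = (λ k → c (4 ↑ʳ (k ↑ˡ 2))) , ≋-refl
      member 2F = (λ k → c (4 ↑ʳ (2 ↑ʳ k))) , ≋-refl

    direct : ∀ (w : Fin 3 → V) → (∀ j → w j ∈ ∥ W j ∥) → Σⱽ w ≋ 𝟎 → ∀ j → w j ≋ 𝟎
    direct w w∈ Σw≋𝟎 = λ
      { 0F → vanish u₀ {w 0F} (w∈ 0F) λ { 0F → c≋𝟎 0F ; 1F → c≋𝟎 1F ; 2F → c≋𝟎 2F ; 3F → c≋𝟎 3F }
      ; 1F → vanish uₐ {w 1F} (w∈ 1F) λ { 0F → c≋𝟎 4F ; 1F → c≋𝟎 5F }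
      ; 2F → vanish uᵦ {w 2F} (w∈ 2F) λ { 0F → c≋𝟎 6F ; 1F → c≋𝟎 7F } }
      where
      c : Fin 8 → ℂ
      -- The coordinates of the three components, glued along 8 = 4 + 2 + 2, form one relation
      -- between the eight basis vectors.
      c = [ proj₁ (w∈ 0F) , [ proj₁ (w∈ 1F) , proj₁ (w∈ 2F) ]′ ∘ Fin.splitAt 2 ]′ ∘ Fin.splitAt 4
      c≋𝟎 : c ≋ 𝟎
      c≋𝟎 = Dual.vectors-independent basis (λ k → k) (λ eq → eq) c
        (≋-trans (combination-split c) (≋-trans (λ v → ℂ.+-cong (ℂ.sym (proj₂ (w∈ 0F) v))
          (ℂ.+-cong (ℂ.sym (proj₂ (w∈ 1F) v)) (ℂ.+-congʳ (ℂ.sym (proj₂ (w∈ 2F) v))))) Σw≋𝟎))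
      vanish : ∀ {m} (u : Fin m → V) {v} (v∈ : v ∈ span u) → proj₁ v∈ ≋ 𝟎 → v ≋ 𝟎
      vanish u (a , v≋) a≋𝟎 = ≋-trans v≋ (≋-trans (combination-congˡ u a≋𝟎) (combination-𝟎 u))

  decomposition : OrthogonalDecomposition W
  decomposition = record
    { irreducible = λ { 0F → irreducibleI ; 1F → irreducibleII Bₐ ; 2F → irreducibleII Bᵦ }
    ; orthogonal  = orthogonal
    ; spanning    = spanning
    ; direct      = direct
    }

  private
    I≇II : ∀ (B : ThinBasis 1 (fromRows rowsII)) → ¬ (W₀ ≅ ThinBasis.toModule B)
    I≇II B iso = ThinBasis.layer-zero {r = 1} B 0 (λ _ ())
      (≅-layer-nonzero iso ℕ.z≤n (ThinBasis.layer-nonzero B₀ 0F))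

    II≇I : ∀ (B : ThinBasis 1 (fromRows rowsII)) → ¬ (ThinBasis.toModule B ≅ W₀)
    II≇I B iso = ThinBasis.layer-zero {r = 1} B 0 (λ _ ())
      (≅-layer-nonzero⁻¹ iso ℕ.z≤n (ThinBasis.layer-nonzero B₀ 0F))

  classification : ∀ j k → (W j ≅ W k) ⇔ (moduleType j ≡ moduleType k)
  classification 0F 0F = mk⇔ (λ _ → refl) (λ _ → thin-≅ B₀ B₀)
  classification 0F 1F = mk⇔ (λ iso → contradiction iso (I≇II Bₐ)) λ ()
  classification 0F 2F = mk⇔ (λ iso → contradiction iso (I≇II Bᵦ)) λ ()
  classification 1F 0F = mk⇔ (λ iso → contradiction iso (II≇I Bₐ)) λ ()
  classification 1F 1F = mk⇔ (λ _ → refl) (λ _ → thin-≅ Bₐ Bₐ)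
  classification 1F 2F = mk⇔ (λ _ → refl) (λ _ → thin-≅ Bₐ Bᵦ)
  classification 2F 0F = mk⇔ (λ iso → contradiction iso (II≇I Bᵦ)) λ ()
  classification 2F 1F = mk⇔ (λ _ → refl) (λ _ → thin-≅ Bᵦ Bₐ)
  classification 2F 2F = mk⇔ (λ _ → refl) (λ _ → thin-≅ Bᵦ Bᵦ)

  _≟ᵗ_ : ∀ (s t : ModuleType) → Dec (s ≡ t)
  typeI  ≟ᵗ typeI  = yes refl
  typeI  ≟ᵗ typeII = no λ ()
  typeII ≟ᵗ typeI  = no λ ()
  typeII ≟ᵗ typeII = yes refl

  -- `classification` replaces isomorphism by equality of types, which is decidable, so the number
  -- of summands evaluates.
  multiplicity : ∀ k →
    HasMultiplicity W (W k) ∣ tabulate (λ j → does (moduleType j ≟ᵗ moduleType k)) ∣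
  multiplicity k = _ , (λ j → mk⇔ (λ j∈ → Equivalence.from (classification j k) (member⁻¹ j j∈))
                               (λ iso → member j (Equivalence.to (classification j k) iso))) , refl
    where
    S : Fin 3 → Bool
    S j = does (moduleType j ≟ᵗ moduleType k)
    member : ∀ j → moduleType j ≡ moduleType k → j ∈ˢ tabulate S
    member j eq = Vec.lookup⇒[]= j (tabulate S)
      (trans (Vec.lookup∘tabulate S j) (dec-true (moduleType j ≟ᵗ moduleType k) eq))
    member⁻¹ : ∀ j → j ∈ˢ tabulate S → moduleType j ≡ moduleType k
    member⁻¹ j j∈ = does⇒ (moduleType j ≟ᵗ moduleType k)
      (trans (sym (Vec.lookup∘tabulate S j)) (Vec.[]=⇒lookup j∈))

  private
    layer∈ : ∀ r m {n} → Fin n → Bool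
    layer∈ r m i = does (Fin.any? {n = ℕ.suc m} λ k → toℕ i ℕ.≟ r ℕ.+ toℕ k)

    layer-count : ∀ {D} r m → D ≡ 3 →
      {True (∣ tabulate {n = 4} (layer∈ r m) ∣ ℕ.≟ ℕ.suc m)} →
      ∣ tabulate {n = ℕ.suc D} (layer∈ r m) ∣ ≡ ℕ.suc m
    layer-count r m refl {eq} = toWitness eq

  -- Matrix and basis are variables because the conversion checker, comparing concrete ones under
  -- Represents or IsPureBasis, unfolds them down to Cauchy sequences.
  TypeI : TModule → Mat 4 → (Fin 4 → V) → Set _
  TypeI W′ 𝔹 u =
    HasEndpoint W′ 0 × HasMultiplicity W W′ 1 × HasDim ∥ W′ ∥ 4 ×
    HasDiameter W′ 3 × HasShape W′ 0 3 (1 ∷ 1 ∷ 1 ∷ 1 ∷ []) ×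
    IsPureBasis W′ u × Represents 𝔹 u ×
    HasEigenvalues 𝔹 (fromℤ (+ 3) ∷ˡ fromℤ (+ 1) ∷ˡ fromℤ (- (+ 1)) ∷ˡ fromℤ (- (+ 3)) ∷ˡ []ˡ)

  typeI-data : ∀ (B : ThinBasis 0 (fromRows rowsI)) {𝔹 u} →
               fromRows rowsI ≡ 𝔹 → ThinBasis.u B ≡ u →
               HasMultiplicity W (ThinBasis.toModule B) 1 → TypeI (ThinBasis.toModule B) 𝔹 u
  typeI-data B refl refl mult =
    hasEndpoint ℕ.z≤n , mult , (u , isBasis) ,
    hasDiameter (layer-count 0 3 diameter≡3) ,
    (λ { 0F → _ , layer-basis 0F ; 1F → _ , layer-basis 1F
       ; 2F → _ , layer-basis 2F ; 3F → _ , layer-basis 3F }) ,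
    isPureBasis , action ,
    eigenvaluesFromTable diagonalisedI (+ 3 ∷ˡ + 1 ∷ˡ - (+ 1) ∷ˡ - (+ 3) ∷ˡ []ˡ)
    where open ThinBasis B

  TypeII : TModule → Mat 2 → (Fin 2 → V) → Set _
  TypeII W′ 𝔹 u =
    HasEndpoint W′ 1 × HasMultiplicity W W′ 2 × HasDim ∥ W′ ∥ 2 ×
    HasDiameter W′ 1 × HasShape W′ 1 1 (1 ∷ 1 ∷ []) ×
    Spans (E* 1 ⟨ ∥ W′ ∥ ⟩) (u 0F ∷ᶠ []ᶠ) × HasDim (E* 1 ⟨ ∥ W′ ∥ ⟩) 1 ×
    u 1F ≋ E* 2 *ᵥ u 1F × IsPureBasis W′ u × Represents 𝔹 u ×
    HasEigenvalues 𝔹 (fromℤ (+ 1) ∷ˡ fromℤ (- (+ 1)) ∷ˡ []ˡ)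

  typeII-data : ∀ (B : ThinBasis 1 (fromRows rowsII)) {𝔹 u} →
                fromRows rowsII ≡ 𝔹 → ThinBasis.u B ≡ u →
                HasMultiplicity W (ThinBasis.toModule B) 2 → TypeII (ThinBasis.toModule B) 𝔹 u
  typeII-data B refl refl mult =
    hasEndpoint (i≤D (ℕ.s≤s ℕ.z≤n)) , mult , (u , isBasis) ,
    hasDiameter (layer-count 1 1 diameter≡3) ,
    (λ { 0F → _ , layer-basis 0F ; 1F → _ , layer-basis 1F }) ,
    proj₁ (layer-basis 0F) , (_ , layer-basis 0F) ,
    ≋-sym (E*-fixes {v = u 1F} (supported 1F)) , isPureBasis , action ,
    eigenvaluesFromTable diagonalisedII (+ 1 ∷ˡ - (+ 1) ∷ˡ []ˡ)
    where open ThinBasis B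

  private
    matrixI≡ : fromRows rowsI ≡ fromRows
      ( (+ 0 ∷ + 3 ∷ + 0 ∷ + 0 ∷ [])
      ∷ (+ 1 ∷ + 0 ∷ + 2 ∷ + 0 ∷ [])
      ∷ (+ 0 ∷ + 2 ∷ + 0 ∷ + 1 ∷ [])
      ∷ (+ 0 ∷ + 0 ∷ + 3 ∷ + 0 ∷ [])
      ∷ [])
    matrixI≡ = refl

    matrixII≡ : fromRows rowsII ≡ fromRows
      ( (+ 0 ∷ + 1 ∷ [])
      ∷ (+ 1 ∷ + 0 ∷ [])
      ∷ [])
    matrixII≡ = refl

    uI≡ : ThinBasis.u B₀ ≡ (e* 0 ∷ᶠ e* 1 ∷ᶠ e* 2 ∷ᶠ e* 3 ∷ᶠ []ᶠ)
    uI≡ = refl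

    uₐ≡ : let ν = fromEssential 1 ordering (fromℤ ∘ (1ℤ ∷ᶠ -1ℤ ∷ᶠ 0ℤ ∷ᶠ []ᶠ)) in
          ThinBasis.u Bₐ ≡ (ν ∷ᶠ A *ᵥ ν ∷ᶠ []ᶠ)
    uₐ≡ = refl

    uᵦ≡ : let ν = fromEssential 1 ordering (fromℤ ∘ (1ℤ ∷ᶠ 1ℤ ∷ᶠ - (+ 2) ∷ᶠ []ᶠ)) in
          ThinBasis.u Bᵦ ≡ (ν ∷ᶠ A *ᵥ ν ∷ᶠ []ᶠ)
    uᵦ≡ = refl

  abstract
    structure :
      let νₐ = fromEssential 1 ordering (fromℤ ∘ (1ℤ ∷ᶠ -1ℤ ∷ᶠ 0ℤ ∷ᶠ []ᶠ))
          νᵦ = fromEssential 1 ordering (fromℤ ∘ (1ℤ ∷ᶠ 1ℤ ∷ᶠ - (+ 2) ∷ᶠ []ᶠ))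
          basisI = e* 0 ∷ᶠ e* 1 ∷ᶠ e* 2 ∷ᶠ e* 3 ∷ᶠ []ᶠ
          matrixI = fromRows
            ( (+ 0 ∷ + 3 ∷ + 0 ∷ + 0 ∷ [])
            ∷ (+ 1 ∷ + 0 ∷ + 2 ∷ + 0 ∷ [])
            ∷ (+ 0 ∷ + 2 ∷ + 0 ∷ + 1 ∷ [])
            ∷ (+ 0 ∷ + 0 ∷ + 3 ∷ + 0 ∷ [])
            ∷ [])
          matrixII = fromRows
            ( (+ 0 ∷ + 1 ∷ [])
            ∷ (+ 1 ∷ + 0 ∷ [])
            ∷ [])
          type = typeI ∷ᶠ typeII ∷ᶠ typeII ∷ᶠ []ᶠ
      in
      (∃ λ (W₀ : TModule) → ∃ λ (W₁ₐ : TModule) → ∃ λ (W₁ᵦ : TModule) →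
        let W = W₀ ∷ᶠ W₁ₐ ∷ᶠ W₁ᵦ ∷ᶠ []ᶠ
            TypeII = λ (U : TModule) (ν : V) →
              HasEndpoint U 1 × HasMultiplicity W U 2 × HasDim ∥ U ∥ 2 ×
              HasDiameter U 1 × HasShape U 1 1 (1 ∷ 1 ∷ []) ×
              Spans (E* 1 ⟨ ∥ U ∥ ⟩) (ν ∷ᶠ []ᶠ) × HasDim (E* 1 ⟨ ∥ U ∥ ⟩) 1 ×
              A *ᵥ ν ≋ E* 2 *ᵥ (A *ᵥ ν) ×
              IsPureBasis U (ν ∷ᶠ A *ᵥ ν ∷ᶠ []ᶠ) ×
              Represents matrixII (ν ∷ᶠ A *ᵥ ν ∷ᶠ []ᶠ) ×
              HasEigenvalues matrixII (fromℤ (+ 1) ∷ˡ fromℤ (- (+ 1)) ∷ˡ []ˡ)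
        in
        OrthogonalDecomposition W ×
        (∀ j k → (W j ≅ W k) ⇔ (type j ≡ type k)) ×
        ( HasEndpoint W₀ 0 × HasMultiplicity W W₀ 1 × HasDim ∥ W₀ ∥ 4 ×
          HasDiameter W₀ 3 × HasShape W₀ 0 3 (1 ∷ 1 ∷ 1 ∷ 1 ∷ []) ×
          IsPureBasis W₀ basisI ×
          Represents matrixI basisI ×
          HasEigenvalues matrixI (fromℤ (+ 3) ∷ˡ fromℤ (+ 1) ∷ˡ fromℤ (- (+ 1)) ∷ˡ fromℤ (- (+ 3)) ∷ˡ []ˡ)) ×
        TypeII W₁ₐ νₐ ×
        TypeII W₁ᵦ νᵦ)
    structure =
      ThinBasis.toModule B₀ , ThinBasis.toModule Bₐ , ThinBasis.toModule Bᵦ ,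
      decomposition , classification ,
      typeI-data B₀ matrixI≡ uI≡ (multiplicity 0F) ,
      typeII-data Bₐ matrixII≡ uₐ≡ (multiplicity 1F) ,
      typeII-data Bᵦ matrixII≡ uᵦ≡ (multiplicity 2F)

-- The symmetric group on the three neighbours of the base vertex acts on labels, and each element
-- of T is constant on the 20 orbits of pairs.

act : Fin 6 → Fin 8 → Fin 8
act g a = lookup (lookup
    ( (0F ∷ 1F ∷ 2F ∷ 3F ∷ 4F ∷ 5F ∷ 6F ∷ 7F ∷ [])
    ∷ (0F ∷ 1F ∷ 3F ∷ 2F ∷ 4F ∷ 6F ∷ 5F ∷ 7F ∷ [])
    ∷ (0F ∷ 2F ∷ 1F ∷ 3F ∷ 5F ∷ 4F ∷ 6F ∷ 7F ∷ [])
    ∷ (0F ∷ 2F ∷ 3F ∷ 1F ∷ 5F ∷ 6F ∷ 4F ∷ 7F ∷ [])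
    ∷ (0F ∷ 3F ∷ 1F ∷ 2F ∷ 6F ∷ 4F ∷ 5F ∷ 7F ∷ [])
    ∷ (0F ∷ 3F ∷ 2F ∷ 1F ∷ 6F ∷ 5F ∷ 4F ∷ 7F ∷ [])
    ∷ []) g) a

-- The identity and the transpositions are involutions; only the two 3-cycles, numbered 3 and 4, are
-- exchanged.
act⁻¹ : Fin 6 → Fin 8 → Fin 8
act⁻¹ g = act (lookup (0F ∷ 1F ∷ 2F ∷ 4F ∷ 3F ∷ 5F ∷ []) g)

-- Pairs on given levels form one orbit if one of the levels is 0 or 3, a single vertex. On levels 1
-- and 2, pairs with equal and with different indices are separate orbits. This gives 12 · 1 + 4 · 2
-- = 20.
orbit : Fin 8 → Fin 8 → Fin 20
orbit a b = lookup (lookup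
    ( (# 0 ∷ # 1 ∷ # 1 ∷ # 1 ∷ # 2 ∷ # 2 ∷ # 2 ∷ # 3 ∷ [])
    ∷ (# 4 ∷ # 5 ∷ # 6 ∷ # 6 ∷ # 7 ∷ # 8 ∷ # 8 ∷ # 9 ∷ [])
    ∷ (# 4 ∷ # 6 ∷ # 5 ∷ # 6 ∷ # 8 ∷ # 7 ∷ # 8 ∷ # 9 ∷ [])
    ∷ (# 4 ∷ # 6 ∷ # 6 ∷ # 5 ∷ # 8 ∷ # 8 ∷ # 7 ∷ # 9 ∷ [])
    ∷ (# 10 ∷ # 11 ∷ # 12 ∷ # 12 ∷ # 13 ∷ # 14 ∷ # 14 ∷ # 15 ∷ [])
    ∷ (# 10 ∷ # 12 ∷ # 11 ∷ # 12 ∷ # 14 ∷ # 13 ∷ # 14 ∷ # 15 ∷ [])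
    ∷ (# 10 ∷ # 12 ∷ # 12 ∷ # 11 ∷ # 14 ∷ # 14 ∷ # 13 ∷ # 15 ∷ [])
    ∷ (# 16 ∷ # 17 ∷ # 17 ∷ # 17 ∷ # 18 ∷ # 18 ∷ # 18 ∷ # 19 ∷ [])
    ∷ []) a) b

row column : Fin 20 → Fin 8
row = lookup
  ( 0F ∷ 0F ∷ 0F ∷ 0F ∷ 1F ∷ 1F ∷ 1F ∷ 1F ∷ 1F ∷ 1F ∷
    4F ∷ 4F ∷ 4F ∷ 4F ∷ 4F ∷ 4F ∷ 7F ∷ 7F ∷ 7F ∷ 7F ∷ [])
column = lookup
  ( 0F ∷ 1F ∷ 4F ∷ 7F ∷ 0F ∷ 1F ∷ 2F ∷ 4F ∷ 5F ∷ 7F ∷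
    0F ∷ 1F ∷ 2F ∷ 4F ∷ 5F ∷ 7F ∷ 0F ∷ 1F ∷ 4F ∷ 7F ∷ [])

orbitᶻ : Fin 20 → Fin 8 → Fin 8 → ℤ
orbitᶻ k a b = δᶻ (orbit a b) k

levelᶻ : ℕ → Fin 8 → Fin 8 → ℤ
levelᶻ i a b = (if does (level a ℕ.≟ i) then 1ℤ else 0ℤ) ℤ.* δᶻ a b

infixl 7 _⊛_
_⊛_ : (M N : Fin 8 → Fin 8 → ℤ) → Fin 8 → Fin 8 → ℤ
(M ⊛ N) a b = sumᶻ λ k → M a k ℤ.* N k b

abstract
  act-inverseˡ : ∀ g a → act g (act⁻¹ g a) ≡ a
  act-inverseˡ = from-yes (Fin.all? λ g → Fin.all? λ a → act g (act⁻¹ g a) Fin.≟ a)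

  act-inverseʳ : ∀ g a → act⁻¹ g (act g a) ≡ a
  act-inverseʳ = from-yes (Fin.all? λ g → Fin.all? λ a → act⁻¹ g (act g a) Fin.≟ a)

  act-level : ∀ g a → level (act g a) ≡ level a
  act-level = from-yes (Fin.all? λ g → Fin.all? λ a → level (act g a) ℕ.≟ level a)

  act-δ : ∀ g a b → δᶻ (act g a) (act g b) ≡ δᶻ a b
  act-δ = from-yes (Fin.all? λ g → Fin.all? λ a → Fin.all? λ b → δᶻ (act g a) (act g b) ℤ.≟ δᶻ a b)

  act-adjacency : ∀ g a b → adjacencyᶻ (act g a) (act g b) ≡ adjacencyᶻ a b
  act-adjacency = from-yes (Fin.all? λ g → Fin.all? λ a → Fin.all? λ b →
    adjacencyᶻ (act g a) (act g b) ℤ.≟ adjacencyᶻ a b)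

  act-transitive : ∀ a b → ∃ λ g → act g (row (orbit a b)) ≡ a × act g (column (orbit a b)) ≡ b
  act-transitive = from-yes (Fin.all? λ a → Fin.all? λ b → Fin.any? λ g →
    (act g (row (orbit a b)) Fin.≟ a) ×-dec (act g (column (orbit a b)) Fin.≟ b))

  orbit-representative : ∀ k → orbit (row k) (column k) ≡ k
  orbit-representative = from-yes (Fin.all? λ k → orbit (row k) (column k) Fin.≟ k)

-- The orbit matrices as a basis of T

module TerwilligerAlgebra {Γ : Graph 8} {x : Fin 8} {y : Fin 3 → Fin 8}
  (labelling : CubeLabelling Γ x y)
  (diameter≡3 : diameter Γ ≡ 3) where
  open CubeLabelling labelling
  open Terwilliger Γ x
  open ThinModules Γ x
  open Cube labelling

  matrixFromTable : (Fin 8 → Fin 8 → ℤ) → Mat 8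
  matrixFromTable M v w = fromℤ (M (label v) (label w))

  1ᴹ-label : ∀ v w → 1ᴹ v w ≈ᶜ matrixFromTable δᶻ v w
  1ᴹ-label v w = ℂ.sym (ℂ.trans (ℂ.reflexive (cong fromℤ (δᶻ-label v w))) (fromℤ-δ v w))

  E*-label : ∀ i v w → E* i v w ≈ᶜ matrixFromTable (levelᶻ i) v w
  E*-label i v w = ℂ.trans (E*-entry i v w) (ℂ.sym (ℂ.trans
    (fromℤ-* (if does (level (label v) ℕ.≟ i) then 1ℤ else 0ℤ) (δᶻ (label v) (label w)))
    (ℂ.*-cong (ℂ.sym (e*-fromTable i v)) (ℂ.sym (1ᴹ-label v w)))))

  automorphism : Fin 6 → Fin 8 → Fin 8
  automorphism g v = vertex (act g (label v))

  automorphisms : Fin 6 → Perm.Permutation 8 8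
  automorphisms g = Perm.permutation (automorphism g) (λ v → vertex (act⁻¹ g (label v)))
    (λ v → trans (cong (vertex ∘ act g) (label-vertex _))
                 (trans (cong vertex (act-inverseˡ g (label v))) (vertex-label v)))
    (λ v → trans (cong (vertex ∘ act⁻¹ g) (label-vertex _))
                 (trans (cong vertex (act-inverseʳ g (label v))) (vertex-label v)))

  Invariant : Mat 8 → Set
  Invariant M = ∀ g v w → M (automorphism g v) (automorphism g w) ≈ᶜ M v w

  table-invariant : ∀ {M} N → (∀ v w → M v w ≈ᶜ matrixFromTable N v w) →
                    (∀ g a b → N (act g a) (act g b) ≡ N a b) → Invariant M
  table-invariant N M≈N N-invariant g v w = ℂ.trans (M≈N (automorphism g v) (automorphism g w))
    (ℂ.trans (ℂ.reflexive (cong fromℤ (trans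
        (cong₂ N (label-vertex (act g (label v))) (label-vertex (act g (label w))))
        (N-invariant g (label v) (label w)))))
      (ℂ.sym (M≈N v w)))

  -- The automorphisms preserve adjacency and the distance to x, which settles the generators; for a
  -- product the inner sum is reindexed along the permutation.
  T-invariant : ∀ {M} → M ∈ T → Invariant M
  T-invariant A∈ = table-invariant adjacencyᶻ A-label act-adjacency
  T-invariant (E*∈ {i} _) = table-invariant (levelᶻ i) (E*-label i) λ g a b →
    cong₂ (λ l δ → (if does (l ℕ.≟ i) then 1ℤ else 0ℤ) ℤ.* δ) (act-level g a) (act-δ g a b)
  T-invariant 1∈ = table-invariant δᶻ 1ᴹ-label act-δ
  T-invariant (+∈ p q) g v w = ℂ.+-cong (T-invariant p g v w) (T-invariant q g v w)
  T-invariant (*∈ {M} {N} p q) g v w = ℂ.trans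
    (Σᶜ.sum-permute (λ k → M (automorphism g v) k *ᶜ N k (automorphism g w)) (automorphisms g))
    (Σᶜ.sum-cong-≋ λ k → ℂ.*-cong (T-invariant p g v k) (T-invariant q g k w))
  T-invariant (·∈ a p) g v w = ℂ.*-congˡ (T-invariant p g v w)
  T-invariant (resp M≋N p) g v w = ℂ.trans (ℂ.sym (M≋N (automorphism g v) (automorphism g w)))
    (ℂ.trans (T-invariant p g v w) (M≋N v w))

  invariant-on-orbit : ∀ {M} → Invariant M → ∀ v w → let k = orbit (label v) (label w) in
                       M v w ≈ᶜ M (vertex (row k)) (vertex (column k))
  invariant-on-orbit {M} M-invariant v w =
    let g , row≡ , column≡ = act-transitive (label v) (label w)
        move : ∀ {a v} → act g a ≡ label v → automorphism g (vertex a) ≡ v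
        move {a} {v} eq = trans (cong (vertex ∘ act g) (label-vertex a))
                                  (trans (cong vertex eq) (vertex-label v))
    in ℂ.trans (ℂ.reflexive (sym (cong₂ M (move row≡) (move column≡)))) (M-invariant g _ _)

  -- A record, so that the table M can be inferred from a membership proof.
  record Table∈T (M : Fin 8 → Fin 8 → ℤ) : Set where
    constructor table
    field
      member : matrixFromTable M ∈ T

  adjacency∈T : Table∈T adjacencyᶻ
  adjacency∈T = table (resp A-label A∈)

  level∈T : ∀ i → {True (i ℕ.≤? 3)} → Table∈T (levelᶻ i)
  level∈T i {i≤3} = table (resp (E*-label i) (E*∈ (subst (i ≤_) (sym diameter≡3) (toWitness i≤3))))

  ⊛∈T : ∀ {M N} → Table∈T M → Table∈T N → Table∈T (M ⊛ N)
  ⊛∈T {M} {N} (table M∈) (table N∈) = table (resp (λ v w → ℂ.trans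
    (fromℤ-sum-* (M (label v) ∘ label) (λ k → N (label k) (label w)))
    (ℂ.reflexive (cong fromℤ (sumᶻ-label λ k → M (label v) k ℤ.* N k (label w))))) (*∈ M∈ N∈))

  scaled∈T : ∀ c k {M} → Table∈T M → {True (¬? (c ℤ.≟ 0ℤ))} →
             {True (Fin.all? λ a → Fin.all? λ b → M a b ℤ.≟ c ℤ.* orbitᶻ k a b)} →
             Table∈T (orbitᶻ k)
  scaled∈T c k {M} (table M∈) {c≢0} {M≡cR} =
    let c⁻¹ , c⁻¹c≈1 = fromℤ-invertible (toWitness c≢0) in
    table (resp (λ v w → ℂ.trans
      (ℂ.*-congˡ (ℂ.trans (ℂ.reflexive (cong fromℤ (toWitness M≡cR (label v) (label w))))
                            (fromℤ-* c (orbitᶻ k (label v) (label w)))))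
      (ℂ.trans (ℂ.sym (ℂ.*-assoc c⁻¹ (fromℤ c) (fromℤ (orbitᶻ k (label v) (label w)))))
        (ℂ.trans (ℂ.*-congʳ c⁻¹c≈1) (ℂ.*-identityˡ (fromℤ (orbitᶻ k (label v) (label w)))))))
      (·∈ c⁻¹ M∈))

  difference∈T : ∀ k {M N} → Table∈T M → Table∈T N →
                 {True (Fin.all? λ a → Fin.all? λ b → M a b ℤ.+ -1ℤ ℤ.* N a b ℤ.≟ orbitᶻ k a b)} →
                 Table∈T (orbitᶻ k)
  difference∈T k {M} {N} (table M∈) (table N∈) {eq} = table (resp (λ v w → ℂ.trans
    (ℂ.+-congˡ (ℂ.sym (fromℤ-* -1ℤ (N (label v) (label w)))))
    (ℂ.trans (ℂ.sym (fromℤ-+ (M (label v) (label w)) (-1ℤ ℤ.* N (label v) (label w))))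
      (ℂ.reflexive (cong fromℤ (toWitness eq (label v) (label w))))))
    (+∈ M∈ (·∈ (fromℤ -1ℤ) N∈)))

  -- J i j and N i j are the pairs on levels (i , j), all of them and those with different indices;
  -- the block J i j factors through level 0 or level 3.
  orbits∈T : ∀ k → Table∈T (orbitᶻ k)
  orbits∈T k = VecAll.lookup all (∈-allFin⁺ k)
    where
    A∈T = adjacency∈T
    E₀ = level∈T 0
    E₁ = level∈T 1
    E₂ = level∈T 2
    E₃ = level∈T 3
    J00 = scaled∈T (+ 1) (# 0) E₀
    J01 = scaled∈T (+ 1) (# 1) (⊛∈T E₀ A∈T)
    J10 = scaled∈T (+ 1) (# 4) (⊛∈T A∈T E₀)
    D11 = scaled∈T (+ 1) (# 5) E₁
    D22 = scaled∈T (+ 1) (# 13) E₂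
    J33 = scaled∈T (+ 1) (# 19) E₃
    N12 = scaled∈T (+ 1) (# 8) (⊛∈T (⊛∈T E₁ A∈T) E₂)
    N21 = scaled∈T (+ 1) (# 12) (⊛∈T (⊛∈T E₂ A∈T) E₁)
    J23 = scaled∈T (+ 1) (# 15) (⊛∈T A∈T E₃)
    J32 = scaled∈T (+ 1) (# 18) (⊛∈T E₃ A∈T)
    -- The scalars count intermediate vertices: a vertex of level 2 has c₂ = 2 neighbours on level
    -- 1, and label 7 has c₃ = 3 neighbours on level 2.
    J02 = scaled∈T (+ 2) (# 2) (⊛∈T J01 N12)
    J20 = scaled∈T (+ 2) (# 10) (⊛∈T N21 J10)
    J03 = scaled∈T (+ 3) (# 3) (⊛∈T J02 J23)
    J30 = scaled∈T (+ 3) (# 16) (⊛∈T J32 J20)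
    J13 = scaled∈T (+ 1) (# 9) (⊛∈T J10 J03)
    J31 = scaled∈T (+ 1) (# 17) (⊛∈T J30 J01)
    N11 = difference∈T (# 6) (⊛∈T J10 J01) D11
    D12 = difference∈T (# 7) (⊛∈T J10 J02) N12
    D21 = difference∈T (# 11) (⊛∈T J20 J01) N21
    N22 = difference∈T (# 14) (⊛∈T J20 J02) D22
    all : VecAll.All (Table∈T ∘ orbitᶻ) (Vec.allFin 20)
    all =
      J00 VecAll.∷ J01 VecAll.∷ J02 VecAll.∷ J03 VecAll.∷
      J10 VecAll.∷ D11 VecAll.∷ N11 VecAll.∷ D12 VecAll.∷ N12 VecAll.∷ J13 VecAll.∷
      J20 VecAll.∷ D21 VecAll.∷ N21 VecAll.∷ D22 VecAll.∷ N22 VecAll.∷ J23 VecAll.∷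
      J30 VecAll.∷ J31 VecAll.∷ J32 VecAll.∷ J33 VecAll.∷ VecAll.[]

  -- The supports of the orbit matrices partition the pairs of vertices, so the entry of a
  -- combination at a pair is the coefficient of its orbit. Spanning is then invariance, and
  -- independence is evaluation at representatives.
  T-dimension : HasDim T-space 20
  T-dimension = vs , (Table∈T.member ∘ orbits∈T , spans) , independent
    where
    open ≈ᶜ-Reasoning
    vs : Fin 20 → Fin 8 × Fin 8 → ℂ
    vs k (v , w) = matrixFromTable (orbitᶻ k) v w

    combination-vs : ∀ a v w → combination a vs (v , w) ≈ᶜ a (orbit (label v) (label w))
    combination-vs a v w = ℂ.trans
      (Σᶜ.sum-cong-≋ λ k → ℂ.trans (ℂ.*-congˡ (fromℤ-δ (orbit (label v) (label w)) k))
                                    (ℂ.*-comm (a k) (1ᴹ (orbit (label v) (label w)) k)))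
      (sum-δˡ a (orbit (label v) (label w)))

    spans : ∀ M → M ∈ T-space → ∃ λ a → M ≋ combination a vs
    spans M M∈T = a , λ (v , w) → ℂ.trans
      (invariant-on-orbit {λ v w → M (v , w)} (T-invariant M∈T) v w) (ℂ.sym (combination-vs a v w))
      where
      a : Fin 20 → ℂ
      a k = M (vertex (row k) , vertex (column k))

    independent : LinearlyIndependent vs
    independent a comb≋𝟎 k = begin
      a k
        ≡⟨ cong a (trans (cong₂ orbit (label-vertex (row k)) (label-vertex (column k)))
                         (orbit-representative k)) ⟨
      a (orbit (label (vertex (row k))) (label (vertex (column k))))
        ≈⟨ combination-vs a (vertex (row k)) (vertex (column k)) ⟨
      combination a vs (vertex (row k) , vertex (column k))
        ≈⟨ comb≋𝟎 (vertex (row k) , vertex (column k)) ⟩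
      0ᶜ ∎

proj₁-injective : ∀ {m} {I : Set} {f : I → ℕ} {k} (e : Fin m ↔ (∃ λ y → f y ≡ k)) →
                  ∀ {i j} → proj₁ (Inverse.to e i) ≡ proj₁ (Inverse.to e j) → i ≡ j
proj₁-injective e {i} {j} eq = trans (sym (Inverse.strictlyInverseʳ e i))
  (trans (cong (Inverse.from e) (Product.Σ-≡,≡→≡ (eq , ℕ.≡-irrelevant _ _)))
         (Inverse.strictlyInverseʳ e j))

mainTheorem4 :
  (Γ : Graph 8) (dr : DistanceRegular Γ) →
  HasIntersectionArray Γ dr (3 ∷ 2 ∷ 1 ∷ []) (1 ∷ 2 ∷ 3 ∷ []) →
  HasSpectrum (adjacency Γ)
    ((fromℤ (+ 3) , 1) ∷ˡ (fromℤ (+ 1) , 3) ∷ˡ (fromℤ (- (+ 1)) , 3) ∷ˡ (fromℤ (- (+ 3)) , 1) ∷ˡ []ˡ) ×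
  (∀ (x : Fin 8) (ordering : Fin 3 ↔ (∃ λ y → d Γ x y ≡ 1)) →
    let open Terwilliger Γ x
        νₐ = fromEssential 1 ordering (fromℤ ∘ (1ℤ ∷ᶠ -1ℤ ∷ᶠ 0ℤ ∷ᶠ []ᶠ))
        νᵦ = fromEssential 1 ordering (fromℤ ∘ (1ℤ ∷ᶠ 1ℤ ∷ᶠ - (+ 2) ∷ᶠ []ᶠ))
        basisI = e* 0 ∷ᶠ e* 1 ∷ᶠ e* 2 ∷ᶠ e* 3 ∷ᶠ []ᶠ
        matrixI = fromRows
          ( (+ 0 ∷ + 3 ∷ + 0 ∷ + 0 ∷ [])
          ∷ (+ 1 ∷ + 0 ∷ + 2 ∷ + 0 ∷ [])
          ∷ (+ 0 ∷ + 2 ∷ + 0 ∷ + 1 ∷ [])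
          ∷ (+ 0 ∷ + 0 ∷ + 3 ∷ + 0 ∷ [])
          ∷ [])
        matrixII = fromRows
          ( (+ 0 ∷ + 1 ∷ [])
          ∷ (+ 1 ∷ + 0 ∷ [])
          ∷ [])
        type = typeI ∷ᶠ typeII ∷ᶠ typeII ∷ᶠ []ᶠ
    in
    (∃ λ (W₀ : TModule) → ∃ λ (W₁ₐ : TModule) → ∃ λ (W₁ᵦ : TModule) →
      let W = W₀ ∷ᶠ W₁ₐ ∷ᶠ W₁ᵦ ∷ᶠ []ᶠ
          TypeII = λ (U : TModule) (ν : V) →
            HasEndpoint U 1 × HasMultiplicity W U 2 × HasDim ∥ U ∥ 2 ×
            HasDiameter U 1 × HasShape U 1 1 (1 ∷ 1 ∷ []) ×
            Spans (E* 1 ⟨ ∥ U ∥ ⟩) (ν ∷ᶠ []ᶠ) × HasDim (E* 1 ⟨ ∥ U ∥ ⟩) 1 ×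
            A *ᵥ ν ≋ E* 2 *ᵥ (A *ᵥ ν) ×
            IsPureBasis U (ν ∷ᶠ A *ᵥ ν ∷ᶠ []ᶠ) ×
            Represents matrixII (ν ∷ᶠ A *ᵥ ν ∷ᶠ []ᶠ) ×
            HasEigenvalues matrixII (fromℤ (+ 1) ∷ˡ fromℤ (- (+ 1)) ∷ˡ []ˡ)
      in
      OrthogonalDecomposition W ×
      (∀ j k → (W j ≅ W k) ⇔ (type j ≡ type k)) ×
      ( HasEndpoint W₀ 0 × HasMultiplicity W W₀ 1 × HasDim ∥ W₀ ∥ 4 ×
        HasDiameter W₀ 3 × HasShape W₀ 0 3 (1 ∷ 1 ∷ 1 ∷ 1 ∷ []) ×
        IsPureBasis W₀ basisI ×
        Represents matrixI basisI ×
        HasEigenvalues matrixI (fromℤ (+ 3) ∷ˡ fromℤ (+ 1) ∷ˡ fromℤ (- (+ 1)) ∷ˡ fromℤ (- (+ 3)) ∷ˡ []ˡ)) ×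
      TypeII W₁ₐ νₐ ×
      TypeII W₁ᵦ νᵦ) ×
    HasDim T-space (4 ^ 2 + 2 ^ 2) × 4 ^ 2 + 2 ^ 2 ≡ 20)
mainTheorem4 Γ dr ia =
  -- The spectrum does not depend on a base vertex: 0 and the order of its neighbours are arbitrary
  -- choices.
  (let y , y-injective , d-y = neighbours Γ dr ia 0F
   in Cube.A-spectrum (cubeLabelling Γ dr ia 0F y y-injective d-y)) ,
  λ x ordering →
    -- Built from the given ordering itself, so that labels 1, 2, 3 follow the coordinates of the
    -- seed vectors.
    let L = cubeLabelling Γ dr ia x (proj₁ ∘ Inverse.to ordering)
              (proj₁-injective ordering) (proj₂ ∘ Inverse.to ordering)
        W₀ , W₁ₐ , W₁ᵦ , decomposition , classification , I ,
          (endpointₐ , multiplicityₐ , dimₐ , diameterₐ , shapeₐ , seedₐ , layerₐ ,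
            supportₐ , basisₐ , actionₐ , eigenvaluesₐ) ,
          (endpointᵦ , multiplicityᵦ , dimᵦ , diameterᵦ , shapeᵦ , seedᵦ , layerᵦ ,
            supportᵦ , basisᵦ , actionᵦ , eigenvaluesᵦ)
          = Decomposition.structure {Γ} {x} L (proj₁ ia) ordering (λ _ → refl)
    in
    -- Splitting Represents by basis vector keeps the conversion check of the module copies cheap.
    ( W₀ , W₁ₐ , W₁ᵦ , decomposition , classification , I
    , (endpointₐ , multiplicityₐ , dimₐ , diameterₐ , shapeₐ , seedₐ , layerₐ , supportₐ , basisₐ
      , (λ { 0F → actionₐ 0F ; 1F → actionₐ 1F }) , eigenvaluesₐ)
    , (endpointᵦ , multiplicityᵦ , dimᵦ , diameterᵦ , shapeᵦ , seedᵦ , layerᵦ , supportᵦ , basisᵦ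
      , (λ { 0F → actionᵦ 0F ; 1F → actionᵦ 1F }) , eigenvaluesᵦ) ) ,
    TerwilligerAlgebra.T-dimension L (proj₁ ia) , refl
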